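{- Let $\mathfrak{H}$, $\mathfrak{H}y$, $Z_q^t$, $\varphi_\hbar^t$, $S_\hbar^t$, $\ast$ and $\stackrel{t}{\circledast}_\hbar$ be as defined in the context below. For every integer $m\geq 1$ and all $v,w\in\mathfrak{H}y$, \[ \sum_{\substack{i+j=m\\ i,j\geq 1}} Z_q^t\bigl(\varphi_\hbar^t(v)\stackrel{t}{\circledast}_\hbar(-tx+y-\hbar t)^{i-1}y\bigr)\, Z_q^t\bigl(\varphi_\hbar^t(w)\stackrel{t}{\circledast}_\hbar(-tx+y-\hbar t)^{j-1}y\bigr) = -Z_q^t\Bigl(\varphi_\hbar^t\,(S_\hbar^t)^{ -1}\bigl(S_\hbar^t(v)\ast S_\hbar^t(w)\bigr)\stackrel{t}{\circledast}_\hbar(-tx+y-\hbar t)^{m-1}y\Bigr). \]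
   Context: Let $q$, $t$ be formal parameters and $[n]=\frac{1-q^n}{1-q}$. For positive integers $k_1,\dots,k_l$ with $k_1\ge 2$ put $\zeta_q(k_1,\dots,k_l)=\sum_{m_1>m_2>\cdots>m_l\ge1}\prod_{a=1}^l \frac{q^{(k_a-1)m_a}}{[m_a]^{k_a}}\in\mathbb{Q}[[q]]$. The weight of an index $(k_1,\dots,k_l)$ is $k_1+\cdots+k_l$ and its depth is $l$. Define $\zeta_q^t(k_1,\dots,k_l)=\sum'_{\mathbf p}(1-q)^{k-\mathrm{wt}(\mathbf p)}\zeta_q(\mathbf p)\,t^{l-\mathrm{dep}(\mathbf p)}\in\mathbb{Q}[[q]][t]$, where $k=k_1+\cdots+k_l$ and $\mathbf p$ runs over all indices of the form $(k_1\ \square\ k_2\ \square\cdots\square\ k_l)$ in which each $\square$ is filled by one of the three symbols "," (comma), "$+$" or "$-1+$" (e.g. $(3\,{ -1+}\,2, 1)=(4,1)$). Let $\hbar$ be a formal variable and $\mathfrak{H}=\mathbb{Q}[\hbar,t]\langle x,y\rangle$ the noncommutative polynomial algebra over $\mathbb{Q}[\hbar,t]$; put $\mathfrak{H}^1=\mathbb{Q}[\hbar,t]+\mathfrak{H}y$, $\mathfrak{H}^0=\mathbb{Q}[\hbar,t]+x\mathfrak{H}y$, and $z_j=x^{j-1}y$ ($j\ge1$). Let $\widehat Z_q^t:\mathfrak{H}^0\to\mathbb{Q}[\hbar,t][[q]]$ be the $\mathbb{Q}[\hbar,t]$-linear map with $\widehat Z_q^t(1)=1$ and $\widehat Z_q^t(z_{k_1}\cdots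 z_{k_l})=\zeta_q^t(k_1,\dots,k_l)$ ($k_1\ge2$), and let $Z_q^t=f\circ\widehat Z_q^t$ where $f$ substitutes $\hbar\mapsto 1-q$. Let $\mathfrak z$ be the $\mathbb{Q}[\hbar,t]$-span of $\{z_j\}_{j\ge1}$, with the bilinear product $z_i\circ_+ z_j=z_{i+j}+\hbar z_{i+j-1}$, extended to an action of $\mathfrak z$ on $\mathfrak{H}^1$ by $z_i\circ_+1=0$, $z_i\circ_+(z_jw)=(z_i\circ_+z_j)w$. Let $S_\hbar^t:\mathfrak{H}^1\to\mathfrak{H}^1$ be the $\mathbb{Q}[\hbar,t]$-linear map with $S_\hbar^t(1)=1$ and $S_\hbar^t(z_kw)=z_kS_\hbar^t(w)+t\,z_k\circ_+S_\hbar^t(w)$ for words $w\in\mathfrak{H}^1$ (it is bijective). Let $\varphi$ be the algebra automorphism of $\mathfrak{H}$ with $\varphi(x)=x+y$, $\varphi(y)=-y$, and $\varphi_\hbar^t=-(S_\hbar^t)^{ -1}\varphi S_\hbar^t$. The harmonic product $\ast$ on $\mathfrak{H}^1$ is the $\mathbb{Q}[\hbar,t]$-bilinear product with $1\ast w=w\ast 1=w$ and $z_iu\ast z_jv=z_i(u\ast z_jv)+z_j(z_iu\ast v)+z_{i+j}(u\ast v)$ for words $u,v,w$. The product $\ast_+$ on $\mathfrak{H}^1$ is defined by the same rules with the last term replaced by $(z_i\circ_+z_j)(u\ast_+v)$. On $\mathfrak{H}y$ define $z_iu\circledast_\hbar z_jv=z_{i+j}(u\ast_+v)$ ($i,j\ge1$,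 $u,v\in\mathfrak{H}^1$, extended bilinearly) and $u\stackrel{t}{\circledast}_\hbar v=(S_\hbar^t)^{ -1}\bigl(S_\hbar^t(u)\circledast_\hbar S_\hbar^t(v)\bigr)$. -}

module Defs where

open import Algebra.Bundles using (Semiring; Ring; CommutativeRing; RawRing)
open import Algebra.Structures using (IsMonoid; IsCommutativeMonoid)
import Algebra.Definitions.RawSemiring as RawSemiringDefinitions
import Algebra.Properties.CommutativeSemigroup as CommutativeSemigroupProperties
open import Data.Bool.Base using (if_then_else_)
open import Data.Empty using (⊥-elim)
open import Data.Fin.Base using (toℕ)
open import Data.List.Base using (List; []; _∷_; _++_; [_]; map; foldr; length; replicate; deduplicate)
open import Data.List.Membership.Propositional using (_∈_)
open import Data.List.Membership.Propositional.Properties using (∈-++⁺ˡ; ∈-++⁺ʳ; ∈-deduplicate⁺)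
import Data.List.Properties as List
open import Data.List.Relation.Unary.All using (All; []; _∷_)
import Data.List.Relation.Unary.All as All
import Data.List.Relation.Unary.All.Properties as All
open import Data.List.Relation.Unary.Any using (here; there)
open import Data.List.Relation.Unary.AllPairs using ([]; _∷_)
open import Data.List.Relation.Unary.Unique.Propositional using (Unique)
import Data.List.Relation.Unary.Unique.DecPropositional.Properties as Unique
open import Data.Maybe.Base using (Maybe; just; nothing)
import Data.Maybe.Base as Maybe
open import Data.Nat.Base as ℕ using (ℕ; zero; suc; _∸_)
import Data.Nat.Properties as ℕ
open import Data.Nat.ListAction using (sum)
open import Data.Product.Base using (_×_; _,_; proj₁; proj₂; map₁; map₂; ∃; ∃₂)
open import Data.Rational.Base using (ℚ)
import Data.Rational.Properties as ℚ
open import Function.Base using (_∘_; id)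
open import Function.Bundles using (Inverse)
open import Level using (0ℓ)
open import Relation.Binary.Bundles using (Setoid)
open import Relation.Binary.Definitions using (DecidableEquality)
open import Relation.Binary.PropositionalEquality as ≡ using (_≡_; _≢_)
open import Relation.Nullary.Decidable.Core using (Dec; does; yes; no)
import Relation.Binary.Reasoning.Setoid as SetoidReasoning

-- Free modules: a formal sum Σ cᵢ xᵢ is the list of its terms, and two formal
-- sums are equal when every basis element has the same total coefficient.

module FreeModule (K : CommutativeRing 0ℓ 0ℓ) where

  open CommutativeRing K
  open CommutativeSemigroupProperties +-commutativeSemigroup using (interchange)
  open CommutativeSemigroupProperties *-commutativeSemigroup using (x∙yz≈y∙xz)

  Lin : Set → Set
  Lin X = List (Carrier × X)

  infixr 7 _•_
  _•_ : {X : Set} → Carrier → Lin X → Lin X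
  c • p = map (map₁ (c *_)) p

  basis : {X : Set} → X → Lin X
  basis x = [ 1# , x ]

  rename : {X Y : Set} → (X → Y) → Lin X → Lin Y
  rename f = map (map₂ f)

  -- The linear map that sends each basis element x to f x.
  extend : {X Y : Set} → (X → Lin Y) → Lin X → Lin Y
  extend f []            = []
  extend f ((c , x) ∷ p) = c • f x ++ extend f p

  eval : {X : Set} → (X → Carrier) → Lin X → Carrier
  eval f []            = 0#
  eval f ((c , x) ∷ p) = c * f x + eval f p

  private variable X Y : Set

  eval-cong : {f g : X → Carrier} → (∀ x → f x ≈ g x) → ∀ p → eval f p ≈ eval g p
  eval-cong h []            = refl
  eval-cong h ((c , x) ∷ p) = +-cong (*-congˡ (h x)) (eval-cong h p)

  eval-++ : ∀ (f : X → Carrier) p q → eval f (p ++ q) ≈ eval f p + eval f q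
  eval-++ f []            q = sym (+-identityˡ _)
  eval-++ f ((c , x) ∷ p) q = trans (+-congˡ (eval-++ f p q)) (sym (+-assoc _ _ _))

  eval-• : ∀ (f : X → Carrier) c p → eval f (c • p) ≈ c * eval f p
  eval-• f c []            = sym (zeroʳ c)
  eval-• f c ((d , x) ∷ p) =
    trans (+-cong (*-assoc _ _ _) (eval-• f c p)) (sym (distribˡ _ _ _))

  eval-basis : ∀ (f : X → Carrier) x → eval f (basis x) ≈ f x
  eval-basis f x = trans (+-identityʳ _) (*-identityˡ _)

  eval-rename : ∀ (g : Y → Carrier) (f : X → Y) p → eval g (rename f p) ≈ eval (g ∘ f) p
  eval-rename g f []            = refl
  eval-rename g f ((c , x) ∷ p) = +-congˡ (eval-rename g f p)

  eval-extend : ∀ (g : Y → Carrier) (f : X → Lin Y) p →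
                eval g (extend f p) ≈ eval (λ x → eval g (f x)) p
  eval-extend g f []            = refl
  eval-extend g f ((c , x) ∷ p) =
    trans (eval-++ g (c • f x) _) (+-cong (eval-• g c (f x)) (eval-extend g f p))

  eval-0 : ∀ (p : Lin X) → eval (λ _ → 0#) p ≈ 0#
  eval-0 []            = refl
  eval-0 ((c , x) ∷ p) = trans (+-cong (zeroʳ c) (eval-0 p)) (+-identityˡ _)

  eval-+ : ∀ (f g : X → Carrier) p → eval (λ x → f x + g x) p ≈ eval f p + eval g p
  eval-+ f g []            = sym (+-identityˡ _)
  eval-+ f g ((c , x) ∷ p) =
    trans (+-cong (distribˡ _ _ _) (eval-+ f g p)) (interchange _ _ _ _)

  eval-* : ∀ c (f : X → Carrier) p → eval (λ x → c * f x) p ≈ c * eval f p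
  eval-* c f []            = sym (zeroʳ c)
  eval-* c f ((d , x) ∷ p) =
    trans (+-cong (x∙yz≈y∙xz _ _ _) (eval-* c f p)) (sym (distribˡ _ _ _))

  eval-swap : ∀ (f : X → Y → Carrier) p q →
              eval (λ x → eval (f x) q) p ≈ eval (λ y → eval (λ x → f x y) p) q
  eval-swap f []            q = sym (eval-0 q)
  eval-swap f ((c , x) ∷ p) q = trans
    (+-cong (sym (eval-* c (f x) q)) (eval-swap f p q))
    (sym (eval-+ (λ y → c * f x y) _ q))

  module Equality {X : Set} (_≟_ : DecidableEquality X) where

    δ : X → X → Carrier
    δ x y = if does (x ≟ y) then 1# else 0#

    coeff : Lin X → X → Carrier
    coeff p x = eval (δ x) p

    infix 4 _≋_
    record _≋_ (p q : Lin X) : Set where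
      constructor mk≋
      field coeff≈ : ∀ x → coeff p x ≈ coeff q x
    open _≋_ public

    private
      total : List X → (X → Carrier) → Carrier
      total L f = foldr (λ x s → f x + s) 0# L

      total-cong : ∀ L {f g : X → Carrier} → (∀ x → f x ≈ g x) → total L f ≈ total L g
      total-cong []      h = refl
      total-cong (x ∷ L) h = +-cong (h x) (total-cong L h)

      total-0 : ∀ L → total L (λ _ → 0#) ≈ 0#
      total-0 []      = refl
      total-0 (x ∷ L) = trans (+-identityˡ _) (total-0 L)

      total-+ : ∀ L (f g : X → Carrier) → total L (λ x → f x + g x) ≈ total L f + total L g
      total-+ []      f g = sym (+-identityˡ _)
      total-+ (x ∷ L) f g = trans (+-congˡ (total-+ L f g)) (interchange _ _ _ _)

      δ-≡ : ∀ x → δ x x ≈ 1#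
      δ-≡ x with x ≟ x
      ... | yes _ = refl
      ... | no ¬p = ⊥-elim (¬p ≡.refl)

      δ-≢ : ∀ {x y} → x ≢ y → δ x y ≈ 0#
      δ-≢ {x} {y} ne with x ≟ y
      ... | yes p = ⊥-elim (ne p)
      ... | no _  = refl

      total-δ∉ : ∀ L {x} (f : X → Carrier) → All (x ≢_) L → total L (λ m → δ m x * f m) ≈ 0#
      total-δ∉ []      f []       = refl
      total-δ∉ (y ∷ L) f (ne ∷ a) = trans
        (+-cong (trans (*-congʳ (δ-≢ (ne ∘ ≡.sym))) (zeroˡ _)) (total-δ∉ L f a)) (+-identityˡ _)

      total-δ : ∀ {L x} (f : X → Carrier) → Unique L → x ∈ L → total L (λ m → δ m x * f m) ≈ f x
      total-δ {y ∷ L} f (a ∷ u) (here ≡.refl) = trans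
        (+-cong (trans (*-congʳ (δ-≡ y)) (*-identityˡ _)) (total-δ∉ L f a)) (+-identityʳ _)
      total-δ {y ∷ L} f (a ∷ u) (there x∈L) = trans
        (+-cong (trans (*-congʳ (δ-≢ (All.lookup a x∈L))) (zeroˡ _)) (total-δ f u x∈L)) (+-identityˡ _)

      total-* : ∀ L c (f : X → Carrier) → total L (λ x → c * f x) ≈ c * total L f
      total-* []      c f = sym (zeroʳ c)
      total-* (x ∷ L) c f = trans (+-congˡ (total-* L c f)) (sym (distribˡ _ _ _))

      eval-total : ∀ {L} (f : X → Carrier) → Unique L → ∀ p → (∀ {x} → x ∈ map proj₂ p → x ∈ L) →
                   eval f p ≈ total L (λ m → coeff p m * f m)
      eval-total {L} f u []            s = sym (trans (total-cong L (λ _ → zeroˡ _)) (total-0 L))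
      eval-total {L} f u ((c , x) ∷ p) s = sym (trans
        (total-cong L (λ m → trans (distribʳ _ _ _) (+-congʳ (*-assoc _ _ _))))
        (trans (total-+ L _ _)
          (+-cong (trans (total-* L c _) (*-congˡ (total-δ f u (s (here ≡.refl)))))
                  (sym (eval-total f u p (s ∘ there))))))

    -- Linear functionals respect equality; conversely they determine it.
    eval-resp : ∀ (f : X → Carrier) {p q} → p ≋ q → eval f p ≈ eval f q
    eval-resp f {p} {q} e = trans
      (eval-total f u p (∈-deduplicate⁺ _≟_ ∘ ∈-++⁺ˡ))
      (trans (total-cong L (λ m → *-congʳ (coeff≈ e m)))
             (sym (eval-total f u q (∈-deduplicate⁺ _≟_ ∘ ∈-++⁺ʳ (map proj₂ p)))))
      where
      L = deduplicate _≟_ (map proj₂ p ++ map proj₂ q)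
      u = Unique.deduplicate-! _≟_ (map proj₂ p ++ map proj₂ q)

    ≋-by-eval : ∀ {p q} → (∀ f → eval f p ≈ eval f q) → p ≋ q
    ≋-by-eval h = mk≋ (λ x → h (δ x))

    ≋-refl : ∀ {p} → p ≋ p
    ≋-refl = mk≋ (λ _ → refl)

    ≋-sym : ∀ {p q} → p ≋ q → q ≋ p
    ≋-sym e = mk≋ (λ x → sym (coeff≈ e x))

    ≋-trans : ∀ {p q r} → p ≋ q → q ≋ r → p ≋ r
    ≋-trans d e = mk≋ (λ x → trans (coeff≈ d x) (coeff≈ e x))

    ≋-reflexive : ∀ {p q} → p ≡ q → p ≋ q
    ≋-reflexive ≡.refl = ≋-refl

    setoid≋ : Setoid 0ℓ 0ℓ
    setoid≋ = record
      { Carrier = Lin X ; _≈_ = _≋_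
      ; isEquivalence = record { refl = ≋-refl ; sym = ≋-sym ; trans = ≋-trans } }

    ++-cong : ∀ {p p′ q q′} → p ≋ p′ → q ≋ q′ → p ++ q ≋ p′ ++ q′
    ++-cong {p} {p′} {q} {q′} d e = mk≋ λ x → trans (eval-++ (δ x) p q)
      (trans (+-cong (coeff≈ d x) (coeff≈ e x)) (sym (eval-++ (δ x) p′ q′)))

    ++-comm : ∀ p q → p ++ q ≋ q ++ p
    ++-comm p q = mk≋ λ x → trans (eval-++ (δ x) p q)
      (trans (+-comm _ _) (sym (eval-++ (δ x) q p)))

    •-cong : ∀ {c d p q} → c ≈ d → p ≋ q → c • p ≋ d • q
    •-cong {c} {d} {p} {q} e h = mk≋ λ x → trans (eval-• (δ x) c p)
      (trans (*-cong e (coeff≈ h x)) (sym (eval-• (δ x) d q)))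

    •-distrib-++ : ∀ c p q → c • (p ++ q) ≋ c • p ++ c • q
    •-distrib-++ c p q = ≋-reflexive (List.map-++ _ p q)

    •-distrib-+ : ∀ c d p → (c + d) • p ≋ c • p ++ d • p
    •-distrib-+ c d p = mk≋ λ x → trans (eval-• (δ x) (c + d) p) (trans (distribʳ _ _ _)
      (sym (trans (eval-++ (δ x) (c • p) _) (+-cong (eval-• (δ x) c p) (eval-• (δ x) d p)))))

    •-assoc : ∀ c d p → (c * d) • p ≋ c • d • p
    •-assoc c d p = mk≋ λ x → trans (eval-• (δ x) (c * d) p) (trans (*-assoc _ _ _)
      (sym (trans (eval-• (δ x) c (d • p)) (*-congˡ (eval-• (δ x) d p)))))

    •-identity : ∀ p → 1# • p ≋ p
    •-identity p = mk≋ λ x → trans (eval-• (δ x) 1# p) (*-identityˡ _)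

    •-zero : ∀ p → 0# • p ≋ []
    •-zero p = mk≋ λ x → trans (eval-• (δ x) 0# p) (zeroˡ _)

    extend-cong : ∀ (f : X → Lin X) {p q} → p ≋ q → extend f p ≋ extend f q
    extend-cong f {p} {q} e = mk≋ λ x → trans (eval-extend (δ x) f p)
      (trans (eval-resp _ e) (sym (eval-extend (δ x) f q)))

    record IsLinear (F : Lin X → Lin X) : Set where
      field
        cong  : ∀ {p q} → p ≋ q → F p ≋ F q
        add   : ∀ p q → F (p ++ q) ≋ F p ++ F q
        scale : ∀ c p → F (c • p) ≋ c • F p
    open IsLinear public

    extend-linear : ∀ (f : X → Lin X) → IsLinear (extend f)
    extend-linear f = record
      { cong  = extend-cong f
      ; add   = λ p q → mk≋ λ x → trans (eval-extend (δ x) f (p ++ q))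
          (trans (eval-++ _ p q) (sym (trans (eval-++ (δ x) (extend f p) _)
            (+-cong (eval-extend (δ x) f p) (eval-extend (δ x) f q)))))
      ; scale = λ c p → mk≋ λ x → trans (eval-extend (δ x) f (c • p))
          (trans (eval-• _ c p) (sym (trans (eval-• (δ x) c (extend f p))
            (*-congˡ (eval-extend (δ x) f p)))))
      }

    id-linear : IsLinear id
    id-linear = record { cong = id ; add = λ _ _ → ≋-refl ; scale = λ _ _ → ≋-refl }

    ∘-linear : ∀ {F G} → IsLinear F → IsLinear G → IsLinear (F ∘ G)
    ∘-linear F G = record
      { cong  = cong F ∘ cong G
      ; add   = λ p q → ≋-trans (cong F (add G p q)) (add F _ _)
      ; scale = λ c p → ≋-trans (cong F (scale G c p)) (scale F _ _)
      }

    +-linear : ∀ {F G} → IsLinear F → IsLinear G → IsLinear (λ p → F p ++ G p)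
    +-linear {F′} {G′} F G = record
      { cong  = λ e → ++-cong (cong F e) (cong G e)
      ; add   = λ p q → mk≋ λ x → trans (coeff≈ (++-cong (add F p q) (add G p q)) x)
          (trans (trans (eval-++ (δ x) (F′ p ++ F′ q) _)
                        (+-cong (eval-++ (δ x) (F′ p) _) (eval-++ (δ x) (G′ p) _)))
          (trans (interchange _ _ _ _)
          (sym (trans (eval-++ (δ x) (F′ p ++ G′ p) _)
                      (+-cong (eval-++ (δ x) (F′ p) _) (eval-++ (δ x) (F′ q) _))))))
      ; scale = λ c p → ≋-trans (++-cong (scale F c p) (scale G c p)) (≋-sym (•-distrib-++ c (F′ p) (G′ p)))
      }

    •-linear : ∀ c {F} → IsLinear F → IsLinear (λ p → c • F p)
    •-linear c {F′} F = record
      { cong  = λ e → •-cong refl (cong F e)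
      ; add   = λ p q → ≋-trans (•-cong refl (add F p q)) (•-distrib-++ c (F′ p) (F′ q))
      ; scale = λ d p → ≋-trans (•-cong refl (scale F d p))
          (≋-trans (≋-sym (•-assoc c d (F′ p))) (≋-trans (•-cong (*-comm c d) (≋-refl {F′ p})) (•-assoc d c (F′ p))))
      }

    linear-ext : ∀ {F G} → IsLinear F → IsLinear G → (∀ x → F (basis x) ≋ G (basis x)) →
                 ∀ p → F p ≋ G p
    linear-ext F G h [] = ≋-trans (scale F 0# [])
      (≋-trans (•-zero _) (≋-sym (≋-trans (scale G 0# []) (•-zero _))))
    linear-ext {F′} {G′} F G h ((c , x) ∷ p) =
      ≋-trans (split F) (≋-trans (++-cong (•-cong (refl {c}) (h x)) (linear-ext F G h p)) (≋-sym (split G)))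
      where
      split : ∀ {H} → IsLinear H → H ((c , x) ∷ p) ≋ c • H (basis x) ++ H p
      split H = ≋-trans
        (cong H {q = c • basis x ++ p} (mk≋ λ y → +-congʳ (*-congʳ (sym (*-identityʳ c)))))
        (≋-trans (add H (c • basis x) p) (++-cong (scale H c (basis x)) ≋-refl))

    extend-basis : ∀ (f : X → Lin X) x → extend f (basis x) ≋ f x
    extend-basis f x = mk≋ λ y → trans (eval-extend (δ y) f (basis x)) (eval-basis (λ z → eval (δ y) (f z)) x)

module MonoidAlgebra (K : CommutativeRing 0ℓ 0ℓ) {M : Set} (_≟_ : DecidableEquality M)
                     {_∙_ : M → M → M} {ε : M} where

  open CommutativeRing K
  open FreeModule K
  open Equality _≟_

  infixl 7 _⋆_
  _⋆_ : Lin M → Lin M → Lin M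
  p ⋆ q = extend (λ x → rename (x ∙_) q) p

  eval-⋆ : ∀ f p q → eval f (p ⋆ q) ≈ eval (λ x → eval (λ y → f (x ∙ y)) q) p
  eval-⋆ f p q = trans (eval-extend f _ p) (eval-cong (λ x → eval-rename f (x ∙_) q) p)

  module _ (isMonoid : IsMonoid _≡_ _∙_ ε) where

    private module M = IsMonoid isMonoid

    algebra : Ring 0ℓ 0ℓ
    algebra = record
      { Carrier = Lin M ; _≈_ = _≋_ ; _+_ = _++_ ; _*_ = _⋆_ ; -_ = (- 1#) •_ ; 0# = [] ; 1# = basis ε
      ; isRing = record
        { +-isAbelianGroup = record
          { isGroup = record
            { isMonoid = record
              { isSemigroup = record
                { isMagma = record
                  { isEquivalence = Setoid.isEquivalence setoid≋ ; ∙-cong = ++-cong }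
                ; assoc = λ p q r → ≋-reflexive (List.++-assoc p q r) }
              ; identity = (λ p → ≋-refl) , (λ p → ≋-reflexive (List.++-identityʳ p)) }
            ; inverse = inverseˡ , (λ p → ≋-trans (++-comm p _) (inverseˡ p))
            ; ⁻¹-cong = •-cong refl }
          ; comm = ++-comm }
        ; *-cong = λ {p} {p′} {q} {q′} d e → ≋-by-eval λ f → trans (eval-⋆ f p q)
            (trans (eval-resp _ d) (trans (eval-cong (λ x → eval-resp _ e) p′) (sym (eval-⋆ f p′ q′))))
        ; *-assoc = λ p q r → ≋-by-eval λ f →
            trans (eval-⋆ f (p ⋆ q) r) (trans (eval-⋆ _ p q) (sym (trans (eval-⋆ f p (q ⋆ r))
              (eval-cong (λ x → trans (eval-⋆ _ q r) (eval-cong (λ y → eval-cong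
                (λ z → reflexive (≡.cong f (≡.sym (M.assoc x y z)))) r) q)) p))))
        ; *-identity =
            (λ p → ≋-by-eval λ f → trans (eval-⋆ f (basis ε) p) (trans (eval-basis (λ x → eval (λ y → f (x ∙ y)) p) ε)
              (eval-cong (λ x → reflexive (≡.cong f (M.identityˡ x))) p)))
          , (λ p → ≋-by-eval λ f → trans (eval-⋆ f p (basis ε)) (eval-cong (λ x →
              trans (eval-basis (λ y → f (x ∙ y)) ε) (reflexive (≡.cong f (M.identityʳ x)))) p))
        ; distrib =
            (λ p q r → ≋-by-eval λ f → trans (eval-⋆ f p (q ++ r))
              (trans (eval-cong (λ x → eval-++ _ q r) p) (trans (eval-+ _ _ p)
                (sym (trans (eval-++ f (p ⋆ q) (p ⋆ r)) (+-cong (eval-⋆ f p q) (eval-⋆ f p r)))))))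
          , (λ p q r → add (extend-linear (λ x → rename (x ∙_) p)) q r)
        } }
      where
      inverseˡ : ∀ p → (- 1#) • p ++ p ≋ []
      inverseˡ p = ≋-trans (++-cong ≋-refl (≋-sym (•-identity p)))
        (≋-trans (≋-sym (•-distrib-+ _ _ p)) (≋-trans (•-cong (-‿inverseˡ 1#) ≋-refl) (•-zero p)))

    ⋆-linear : ∀ p → IsLinear (p ⋆_)
    ⋆-linear p = record
      { cong  = λ {q} {r} e → Ring.*-congˡ algebra {p} {q} {r} e
      ; add   = Ring.distribˡ algebra p
      ; scale = λ c q → ≋-by-eval λ f → trans (eval-⋆ f p (c • q)) (trans
          (trans (eval-cong (λ x → eval-• _ c q) p) (eval-* c _ p))
          (sym (trans (eval-• f c (p ⋆ q)) (*-congˡ (eval-⋆ f p q)))))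
      }

    •-⋆ : ∀ c p q → (c • p) ⋆ q ≋ c • (p ⋆ q)
    •-⋆ c p q = scale (extend-linear (λ x → rename (x ∙_) q)) c p

    basis-⋆ : ∀ x y → basis x ⋆ basis y ≋ basis (x ∙ y)
    basis-⋆ x y = ≋-by-eval λ f → trans (eval-⋆ f (basis x) (basis y))
      (trans (eval-basis (λ z → eval (λ w → f (z ∙ w)) (basis y)) x)
      (trans (eval-basis (λ w → f (x ∙ w)) y) (sym (eval-basis f (x ∙ y)))))

  commutativeAlgebra : IsCommutativeMonoid _≡_ _∙_ ε → CommutativeRing 0ℓ 0ℓ
  commutativeAlgebra isCM = record
    { isCommutativeRing = record
      { isRing = Ring.isRing (algebra CM.isMonoid)
      ; *-comm = λ p q → ≋-by-eval λ f → trans (eval-⋆ f p q) (trans (eval-swap _ p q)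
          (trans (eval-cong (λ y → eval-cong (λ x → reflexive (≡.cong f (CM.comm x y))) p) q)
                 (sym (eval-⋆ f q p))))
      } }
    where module CM = IsCommutativeMonoid isCM

-- The polynomial ring in one variable; the monomial of degree n is represented by n.
polynomials : CommutativeRing 0ℓ 0ℓ → CommutativeRing 0ℓ 0ℓ
polynomials K = MonoidAlgebra.commutativeAlgebra K ℕ._≟_ ℕ.+-0-isCommutativeMonoid

-- K⟦q⟧, a series being its sequence of coefficients.
module PowerSeries (K : CommutativeRing 0ℓ 0ℓ) where

  open CommutativeRing K
  open RawSemiringDefinitions (Semiring.rawSemiring semiring) using () renaming (sum to ∑)

  Series : Set
  Series = ℕ → Carrier

  const : Carrier → Series
  const c zero    = c
  const c (suc _) = 0#

  q : Series
  q (suc zero) = 1#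
  q _          = 0#

  rawRing⟦q⟧ : RawRing 0ℓ 0ℓ
  rawRing⟦q⟧ = record
    { Carrier = Series
    ; _≈_     = λ a b → ∀ n → a n ≈ b n
    ; _+_     = λ a b n → a n + b n
    ; _*_     = λ a b n → ∑ {suc n} (λ i → a (toℕ i) * b (n ∸ toℕ i))
    ; -_      = λ a n → - a n
    ; 0#      = λ _ → 0#
    ; 1#      = const 1#
    }

  private module ⟦q⟧ = RawRing rawRing⟦q⟧
  open RawSemiringDefinitions ⟦q⟧.rawSemiring using () renaming (_^_ to _^⟦q⟧_)

  -- For a of constant term 1, the inverse a⁻¹ = Σⱼ (1 - a)ʲ; the terms with
  -- j > n do not contribute to the coefficient of qⁿ.
  inv : Series → Series
  inv a n = ∑ {suc n} (λ j → ((⟦q⟧.1# ⟦q⟧.+ (⟦q⟧.- a)) ^⟦q⟧ toℕ j) n)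

module Hoffman (K : CommutativeRing 0ℓ 0ℓ) (ħ t : CommutativeRing.Carrier K) where

  open CommutativeRing K using (Carrier; 1#; 0#) renaming (_*_ to _*ᴷ_; -_ to -ᴷ_)
  private module K = CommutativeRing K
  open FreeModule K

  data Letter : Set where
    X Y : Letter

  _≟ᴸ_ : DecidableEquality Letter
  X ≟ᴸ X = yes ≡.refl
  X ≟ᴸ Y = no λ ()
  Y ≟ᴸ X = no λ ()
  Y ≟ᴸ Y = yes ≡.refl

  -- The list of exponents a₁, …, aᵣ stands for z_{a₁+1} ⋯ z_{aᵣ+1} = x^{a₁} y ⋯ x^{aᵣ} y.
  Word Word¹ : Set
  Word  = List Letter
  Word¹ = List ℕ

  𝔥-ring 𝔥¹-ring : Ring 0ℓ 0ℓ
  𝔥-ring  = MonoidAlgebra.algebra K (List.≡-dec _≟ᴸ_) List.++-isMonoid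
  𝔥¹-ring = MonoidAlgebra.algebra K (List.≡-dec ℕ._≟_) List.++-isMonoid

  module 𝔥  = Ring 𝔥-ring
  module 𝔥¹ = Ring 𝔥¹-ring
  open RawSemiringDefinitions (Semiring.rawSemiring 𝔥.semiring) using () renaming (_^_ to _^𝔥_)

  𝔥 𝔥¹ : Set
  𝔥  = 𝔥.Carrier
  𝔥¹ = 𝔥¹.Carrier

  x y : 𝔥
  x = basis [ X ]
  y = basis [ Y ]

  infix 4 _∈𝔥y _∈𝔥⁰
  _∈𝔥y _∈𝔥⁰ : 𝔥 → Set
  p ∈𝔥y = ∃ λ u → p 𝔥.≈ u 𝔥.* y
  p ∈𝔥⁰ = ∃₂ λ c u → p 𝔥.≈ c • 𝔥.1# 𝔥.+ x 𝔥.* u 𝔥.* y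

  -- 𝔥¹ is the free algebra on z₁, z₂, …; ι is its inclusion into 𝔥.
  ιʷ : Word¹ → Word
  ιʷ []      = []
  ιʷ (a ∷ w) = replicate a X ++ Y ∷ ιʷ w

  ι : 𝔥¹ → 𝔥
  ι = rename ιʷ

  -- parse a w is the factorisation of xᵃ w into the zⱼ, if there is one.
  parse : ℕ → Word → Maybe Word¹
  parse zero    []      = just []
  parse (suc _) []      = nothing
  parse a       (X ∷ w) = parse (suc a) w
  parse a       (Y ∷ w) = Maybe.map (a ∷_) (parse 0 w)

  -- The retraction of ι that sends the words outside 𝔥¹ to 0. It is only applied
  -- to elements of the image of ι, where it is the inverse of ι.
  π : 𝔥 → 𝔥¹
  π []            = []
  π ((c , w) ∷ p) = Maybe.maybe (λ u → (c , u) ∷ π p) (π p) (parse 0 w)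

  φᴸ : Letter → 𝔥
  φᴸ X = x 𝔥.+ y
  φᴸ Y = 𝔥.- y

  φʷ : Word → 𝔥
  φʷ = foldr (λ l p → φᴸ l 𝔥.* p) 𝔥.1#

  φ : 𝔥 → 𝔥
  φ = extend φʷ

  -- φ maps 𝔥¹ to itself (see ι-φ¹).
  φ¹ : 𝔥¹ → 𝔥¹
  φ¹ = π ∘ φ ∘ ι

  z⁺ : ℕ → 𝔥¹
  z⁺ a = basis [ a ]

  -- With the indices shifted by one: z_{i+1} ∘₊ z_{j+1} = z_{i+j+2} + ħ z_{i+j+1}.
  _∘₊_ : ℕ → ℕ → 𝔥¹
  i ∘₊ j = z⁺ (suc (i ℕ.+ j)) 𝔥¹.+ ħ • z⁺ (i ℕ.+ j)

  act : ℕ → Word¹ → 𝔥¹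
  act i []      = 𝔥¹.0#
  act i (j ∷ w) = (i ∘₊ j) 𝔥¹.* basis w

  -- i ▷ p is the action z_{i+1} ∘₊ p of 𝔷 on 𝔥¹.
  infixr 7 _▷_
  _▷_ : ℕ → 𝔥¹ → 𝔥¹
  i ▷ p = extend (act i) p

  -- The map S_ħ^s, for an arbitrary scalar s in place of t.
  Sʷ : Carrier → Word¹ → 𝔥¹
  Sʷ s []      = 𝔥¹.1#
  Sʷ s (a ∷ w) = z⁺ a 𝔥¹.* Sʷ s w 𝔥¹.+ s • a ▷ Sʷ s w

  S[_] : Carrier → 𝔥¹ → 𝔥¹
  S[ s ] = extend (Sʷ s)

  bilinear : (Word¹ → Word¹ → 𝔥¹) → 𝔥¹ → 𝔥¹ → 𝔥¹
  bilinear f p q = extend (λ u → extend (f u) q) p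

  quasiShuffle : (ℕ → ℕ → 𝔥¹) → Word¹ → Word¹ → 𝔥¹
  quasiShuffle _◇_ []      v       = basis v
  quasiShuffle _◇_ (i ∷ u) []      = basis (i ∷ u)
  quasiShuffle _◇_ (i ∷ u) (j ∷ v) =
         z⁺ i    𝔥¹.* quasiShuffle _◇_ u (j ∷ v)
    𝔥¹.+ z⁺ j    𝔥¹.* quasiShuffle _◇_ (i ∷ u) v
    𝔥¹.+ (i ◇ j) 𝔥¹.* quasiShuffle _◇_ u v

  infixl 7 _∗_ _∗₊_ _⊛_ _⊛ᵗ_
  _∗_ _∗₊_ _⊛_ : 𝔥¹ → 𝔥¹ → 𝔥¹
  _∗_  = bilinear (quasiShuffle (λ i j → z⁺ (suc (i ℕ.+ j))))
  _∗₊_ = bilinear (quasiShuffle _∘₊_)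

  -- Defined on 𝔥y, and extended to 𝔥¹ by 1 ⊛ v = u ⊛ 1 = 0.
  ⊛ʷ : Word¹ → Word¹ → 𝔥¹
  ⊛ʷ (i ∷ u) (j ∷ v) = z⁺ (suc (i ℕ.+ j)) 𝔥¹.* (basis u ∗₊ basis v)
  ⊛ʷ _       _       = 𝔥¹.0#

  _⊛_ = bilinear ⊛ʷ

  open Equality {Word¹} (List.≡-dec ℕ._≟_) hiding (coeff; δ)
  open MonoidAlgebra K {Word¹} (List.≡-dec ℕ._≟_) {_++_} {[]} using (⋆-linear; •-⋆; basis-⋆)

  z-linear : ∀ k → IsLinear (z⁺ k 𝔥¹.*_)
  z-linear k = ⋆-linear List.++-isMonoid (z⁺ k)

  ▷-linear : ∀ k → IsLinear (k ▷_)
  ▷-linear k = extend-linear (act k)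

  S-linear : ∀ s → IsLinear S[ s ]
  S-linear s = extend-linear (Sʷ s)

  basis-∷ : ∀ k w → z⁺ k 𝔥¹.* basis w ≋ basis (k ∷ w)
  basis-∷ k w = basis-⋆ List.++-isMonoid [ k ] w

  ∘₊-* : ∀ k j p → (k ∘₊ j) 𝔥¹.* p ≋ z⁺ (suc (k ℕ.+ j)) 𝔥¹.* p ++ ħ • (z⁺ (k ℕ.+ j) 𝔥¹.* p)
  ∘₊-* k j p = ≋-trans (𝔥¹.distribʳ p (z⁺ (suc (k ℕ.+ j))) (ħ • z⁺ (k ℕ.+ j)))
    (++-cong (≋-refl {z⁺ (suc (k ℕ.+ j)) 𝔥¹.* p}) (•-⋆ List.++-isMonoid ħ (z⁺ (k ℕ.+ j)) p))

  ▷-1 : ∀ k → k ▷ basis [] ≋ []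
  ▷-1 k = extend-basis (act k) []

  ▷-∷ : ∀ k j w → k ▷ basis (j ∷ w) ≋ (k ∘₊ j) 𝔥¹.* basis w
  ▷-∷ k j w = extend-basis (act k) (j ∷ w)

  ▷-z : ∀ k j p → k ▷ (z⁺ j 𝔥¹.* p) ≋ (k ∘₊ j) 𝔥¹.* p
  ▷-z k j = linear-ext (∘-linear (▷-linear k) (z-linear j)) (⋆-linear List.++-isMonoid (k ∘₊ j))
    (λ w → ≋-trans (cong (▷-linear k) (basis-∷ j w)) (▷-∷ k j w))

  ▷-▷ : ∀ k j p → k ▷ j ▷ p ≋ suc (k ℕ.+ j) ▷ p ++ ħ • (k ℕ.+ j) ▷ p
  ▷-▷ k j = linear-ext (∘-linear (▷-linear k) (▷-linear j))
    (+-linear (▷-linear (suc (k ℕ.+ j))) (•-linear ħ (▷-linear (k ℕ.+ j)))) on-basis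
    where
    on-basis : ∀ w → k ▷ j ▷ basis w ≋ suc (k ℕ.+ j) ▷ basis w ++ ħ • (k ℕ.+ j) ▷ basis w
    on-basis [] = ≋-trans (cong (▷-linear k) (▷-1 j))
      (≋-sym (++-cong (▷-1 (suc (k ℕ.+ j))) (•-cong (K.refl {ħ}) (▷-1 (k ℕ.+ j)))))
    on-basis (i ∷ w) = begin
      k ▷ j ▷ basis (i ∷ w)
        ≈⟨ cong (▷-linear k) (≋-trans (▷-∷ j i w) (∘₊-* j i (basis w))) ⟩
      k ▷ (z⁺ (suc (j ℕ.+ i)) 𝔥¹.* basis w ++ ħ • (z⁺ (j ℕ.+ i) 𝔥¹.* basis w))
        ≈⟨ add (▷-linear k) (z⁺ (suc (j ℕ.+ i)) 𝔥¹.* basis w) (ħ • (z⁺ (j ℕ.+ i) 𝔥¹.* basis w)) ⟩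
      k ▷ (z⁺ (suc (j ℕ.+ i)) 𝔥¹.* basis w) ++ k ▷ (ħ • (z⁺ (j ℕ.+ i) 𝔥¹.* basis w))
        ≈⟨ ++-cong (▷-z k (suc (j ℕ.+ i)) (basis w)) (≋-trans (scale (▷-linear k) ħ (z⁺ (j ℕ.+ i) 𝔥¹.* basis w))
             (•-cong (K.refl {ħ}) (▷-z k (j ℕ.+ i) (basis w)))) ⟩
      (k ∘₊ suc (j ℕ.+ i)) 𝔥¹.* basis w ++ ħ • ((k ∘₊ (j ℕ.+ i)) 𝔥¹.* basis w)
        ≡⟨ ≡.cong₂ (λ m n → (z⁺ (suc m) ++ ħ • z⁺ m) 𝔥¹.* basis w
                            ++ ħ • ((z⁺ (suc n) ++ ħ • z⁺ n) 𝔥¹.* basis w))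
             (≡.trans (ℕ.+-suc k (j ℕ.+ i)) (≡.cong suc n≡)) n≡ ⟩
      (suc (k ℕ.+ j) ∘₊ i) 𝔥¹.* basis w ++ ħ • (((k ℕ.+ j) ∘₊ i) 𝔥¹.* basis w)
        ≈⟨ ++-cong (▷-∷ (suc (k ℕ.+ j)) i w) (•-cong K.refl (▷-∷ (k ℕ.+ j) i w)) ⟨
      suc (k ℕ.+ j) ▷ basis (i ∷ w) ++ ħ • (k ℕ.+ j) ▷ basis (i ∷ w) ∎
      where
      open SetoidReasoning setoid≋
      n≡ : k ℕ.+ (j ℕ.+ i) ≡ k ℕ.+ j ℕ.+ i
      n≡ = ≡.sym (ℕ.+-assoc k j i)

  S-basis : ∀ s w → S[ s ] (basis w) ≋ Sʷ s w
  S-basis s w = extend-basis (Sʷ s) w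

  S-z : ∀ s k p → S[ s ] (z⁺ k 𝔥¹.* p) ≋ z⁺ k 𝔥¹.* S[ s ] p ++ s • k ▷ S[ s ] p
  S-z s k = linear-ext (∘-linear (S-linear s) (z-linear k))
    (+-linear (∘-linear (z-linear k) (S-linear s)) (•-linear s (∘-linear (▷-linear k) (S-linear s))))
    (λ w → ≋-trans (cong (S-linear s) (basis-∷ k w)) (≋-trans (S-basis s (k ∷ w))
      (≋-sym (++-cong (cong (z-linear k) (S-basis s w))
                      (•-cong K.refl (cong (▷-linear k) (S-basis s w)))))))

  S-▷ : ∀ s k p → S[ s ] (k ▷ p) ≋ k ▷ S[ s ] p
  S-▷ s k = linear-ext (∘-linear (S-linear s) (▷-linear k)) (∘-linear (▷-linear k) (S-linear s)) on-basis
    where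
    on-basis : ∀ w → S[ s ] (k ▷ basis w) ≋ k ▷ S[ s ] (basis w)
    on-basis [] = ≋-trans (cong (S-linear s) (▷-1 k))
      (≋-sym (≋-trans (cong (▷-linear k) (S-basis s [])) (▷-1 k)))
    on-basis (j ∷ u) = begin
      S[ s ] (k ▷ basis (j ∷ u))
        ≈⟨ cong (S-linear s) (≋-trans (▷-∷ k j u) (∘₊-* k j (basis u))) ⟩
      S[ s ] (z⁺ n′ 𝔥¹.* basis u ++ ħ • (z⁺ n 𝔥¹.* basis u))
        ≈⟨ ≋-trans (add (S-linear s) (z⁺ n′ 𝔥¹.* basis u) (ħ • (z⁺ n 𝔥¹.* basis u)))
             (++-cong (≋-refl {S[ s ] (z⁺ n′ 𝔥¹.* basis u)})
               (scale (S-linear s) ħ (z⁺ n 𝔥¹.* basis u))) ⟩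
      S[ s ] (z⁺ n′ 𝔥¹.* basis u) ++ ħ • S[ s ] (z⁺ n 𝔥¹.* basis u)
        ≈⟨ ++-cong (S-z s n′ (basis u)) (•-cong (K.refl {ħ}) (S-z s n (basis u))) ⟩
      (A ++ s • B) ++ ħ • (C ++ s • D)
        ≈⟨ ++-cong (≋-refl {A ++ s • B}) (≋-trans (•-distrib-++ ħ C (s • D)) (++-cong (≋-refl {ħ • C})
             (≋-trans (≋-sym (•-assoc ħ s D))
               (≋-trans (•-cong (K.*-comm ħ s) (≋-refl {D})) (•-assoc s ħ D))))) ⟩
      (A ++ s • B) ++ (ħ • C ++ s • ħ • D)
        ≈⟨ interchange A (s • B) (ħ • C) (s • ħ • D) ⟩
      (A ++ ħ • C) ++ (s • B ++ s • ħ • D)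
        ≈⟨ ++-cong (∘₊-* k j U) (≋-trans (•-cong K.refl (▷-▷ k j U)) (•-distrib-++ s B (ħ • D))) ⟨
      (k ∘₊ j) 𝔥¹.* U ++ s • k ▷ j ▷ U
        ≈⟨ ++-cong (▷-z k j U) (scale (▷-linear k) s (j ▷ U)) ⟨
      k ▷ (z⁺ j 𝔥¹.* U) ++ k ▷ (s • j ▷ U)
        ≈⟨ add (▷-linear k) (z⁺ j 𝔥¹.* U) (s • j ▷ U) ⟨
      k ▷ (z⁺ j 𝔥¹.* U ++ s • j ▷ U)
        ≈⟨ cong (▷-linear k) (≋-trans (cong (S-linear s) (≋-sym (basis-∷ j u))) (S-z s j (basis u))) ⟨
      k ▷ S[ s ] (basis (j ∷ u)) ∎
      where
      open SetoidReasoning setoid≋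
      n n′ : ℕ
      n  = k ℕ.+ j
      n′ = suc n
      U A B C D : 𝔥¹
      U = S[ s ] (basis u)
      A = z⁺ n′ 𝔥¹.* U
      B = n′ ▷ U
      C = z⁺ n 𝔥¹.* U
      D = n ▷ U
      interchange : ∀ p q r s → (p ++ q) ++ (r ++ s) ≋ (p ++ r) ++ (q ++ s)
      interchange = CommutativeSemigroupProperties.interchange
        (record { isCommutativeSemigroup = record
          { isSemigroup = 𝔥¹.+-isSemigroup ; comm = 𝔥¹.+-comm } })

  S-inverse : ∀ s s′ → s K.+ s′ K.≈ 0# → ∀ p → S[ s ] (S[ s′ ] p) ≋ p
  S-inverse s s′ e = linear-ext (∘-linear (S-linear s) (S-linear s′)) id-linear
    (λ w → ≋-trans (cong (S-linear s) (S-basis s′ w)) (on-words w))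
    where
    open SetoidReasoning setoid≋
    on-words : ∀ w → S[ s ] (Sʷ s′ w) ≋ basis w
    on-words []      = S-basis s []
    on-words (k ∷ w) = begin
      S[ s ] (z⁺ k 𝔥¹.* U ++ s′ • k ▷ U)
        ≈⟨ add (S-linear s) (z⁺ k 𝔥¹.* U) (s′ • k ▷ U) ⟩
      S[ s ] (z⁺ k 𝔥¹.* U) ++ S[ s ] (s′ • k ▷ U)
        ≈⟨ ++-cong (S-z s k U) (≋-trans (scale (S-linear s) s′ (k ▷ U)) (•-cong K.refl (S-▷ s k U))) ⟩
      (z⁺ k 𝔥¹.* V ++ s • k ▷ V) ++ s′ • k ▷ V
        ≡⟨ List.++-assoc (z⁺ k 𝔥¹.* V) (s • k ▷ V) (s′ • k ▷ V) ⟩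
      z⁺ k 𝔥¹.* V ++ (s • k ▷ V ++ s′ • k ▷ V)
        ≈⟨ ++-cong (≋-refl {z⁺ k 𝔥¹.* V}) (•-distrib-+ s s′ (k ▷ V)) ⟨
      z⁺ k 𝔥¹.* V ++ (s K.+ s′) • k ▷ V
        ≈⟨ ++-cong (≋-refl {z⁺ k 𝔥¹.* V}) (≋-trans (•-cong e (≋-refl {k ▷ V})) (•-zero (k ▷ V))) ⟩
      z⁺ k 𝔥¹.* V ++ []
        ≡⟨ List.++-identityʳ (z⁺ k 𝔥¹.* V) ⟩
      z⁺ k 𝔥¹.* V
        ≈⟨ cong (z-linear k) (on-words w) ⟩
      z⁺ k 𝔥¹.* basis w
        ≈⟨ basis-∷ k w ⟩
      basis (k ∷ w) ∎
      where
      U = Sʷ s′ w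
      V = S[ s ] U

  S-bijective : Inverse 𝔥¹.setoid 𝔥¹.setoid
  S-bijective = record
    { to        = S[ t ]
    ; from      = S[ -ᴷ t ]
    ; to-cong   = cong (S-linear t)
    ; from-cong = cong (S-linear (-ᴷ t))
    ; inverse   = (λ {p} e → ≋-trans (cong (S-linear t) e) (S-inverse t (-ᴷ t) (K.-‿inverseʳ t) p))
                , (λ {p} e → ≋-trans (cong (S-linear (-ᴷ t)) e) (S-inverse (-ᴷ t) t (K.-‿inverseˡ t) p))
    }

  S S⁻¹ : 𝔥¹ → 𝔥¹
  S   = Inverse.to S-bijective
  S⁻¹ = Inverse.from S-bijective

  φᵗ : 𝔥¹ → 𝔥¹
  φᵗ v = 𝔥¹.- S⁻¹ (φ¹ (S v))

  _⊛ᵗ_ : 𝔥¹ → 𝔥¹ → 𝔥¹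
  u ⊛ᵗ v = S⁻¹ (S u ⊛ S v)

  b[_] : ℕ → 𝔥¹
  b[ n ] = π ((((-ᴷ t) • x 𝔥.+ y 𝔥.- (ħ *ᴷ t) • 𝔥.1#) ^𝔥 n) 𝔥.* y)

  private
    AllWords : {W : Set} → (W → Set) → Lin W → Set
    AllWords P p = All (P ∘ proj₂) p

    all-• : {W : Set} {P : W → Set} → ∀ c {p} → AllWords P p → AllWords P (c • p)
    all-• c = All.map⁺

    all-extend : {V W : Set} (P : W → Set) (f : V → Lin W) → ∀ p →
                 AllWords (AllWords P ∘ f) p → AllWords P (extend f p)
    all-extend P f []            []       = []
    all-extend P f ((c , v) ∷ p) (a ∷ as) = All.++⁺ (all-• {P = P} c a) (all-extend P f p as)

    all-* : {A : Set} (P : List A → Set) → ∀ p q →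
            AllWords (λ u → AllWords (λ v → P (u ++ v)) q) p →
            AllWords P (extend (λ u → rename (u ++_) q) p)
    all-* P p q a = all-extend P _ p (All.map All.map⁺ a)

    parse-replicate : ∀ n a w → parse n (replicate a X ++ Y ∷ w) ≡ Maybe.map ((n ℕ.+ a) ∷_) (parse 0 w)
    parse-replicate zero    zero    w = ≡.refl
    parse-replicate (suc n) zero    w rewrite ℕ.+-identityʳ n = ≡.refl
    parse-replicate zero    (suc a) w = parse-replicate 1 a w
    parse-replicate (suc n) (suc a) w rewrite ℕ.+-suc n a = parse-replicate (suc (suc n)) a w

    parse-ιʷ : ∀ w → parse 0 (ιʷ w) ≡ just w
    parse-ιʷ []      = ≡.refl
    parse-ιʷ (a ∷ w) rewrite parse-replicate 0 a (ιʷ w) | parse-ιʷ w = ≡.refl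

    InImage NonEmpty : Word → Set
    InImage  w = ∃ λ u → w ≡ ιʷ u
    NonEmpty w = ∃₂ λ a u → w ≡ ιʷ (a ∷ u)

    ι-π : ∀ p → AllWords InImage p → ι (π p) ≡ p
    ι-π []            []                 = ≡.refl
    ι-π ((c , _) ∷ p) ((u , ≡.refl) ∷ a) rewrite parse-ιʷ u = ≡.cong (_ ∷_) (ι-π p a)

    X∷ : ∀ {w} → NonEmpty w → NonEmpty (X ∷ w)
    X∷ (a , u , ≡.refl) = suc a , u , ≡.refl

    Y∷ : ∀ {w} → InImage w → NonEmpty (Y ∷ w)
    Y∷ (u , ≡.refl) = 0 , u , ≡.refl

    weaken : ∀ {w} → NonEmpty w → InImage w
    weaken (a , u , e) = a ∷ u , e

    φʷ-InImage : ∀ u → AllWords InImage (φʷ (ιʷ u))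
    φʷ-NonEmpty : ∀ a u → AllWords NonEmpty (φʷ (replicate a X ++ Y ∷ ιʷ u))
    φʷ-InImage []      = ([] , ≡.refl) ∷ []
    φʷ-InImage (a ∷ u) = All.map weaken (φʷ-NonEmpty a u)
    φʷ-NonEmpty zero    u = all-* NonEmpty (𝔥.- y) (φʷ (ιʷ u)) (All.map Y∷ (φʷ-InImage u) ∷ [])
    φʷ-NonEmpty (suc a) u = all-* NonEmpty (x 𝔥.+ y) (φʷ (replicate a X ++ Y ∷ ιʷ u))
      (All.map X∷ (φʷ-NonEmpty a u) ∷ All.map (Y∷ ∘ weaken) (φʷ-NonEmpty a u) ∷ [])

    all-φι : ∀ v → AllWords InImage (φ (ι v))
    all-φι v = all-extend InImage φʷ (ι v) (All.map⁺ (All.universal (λ (_ , u) → φʷ-InImage u) v))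

  π-ι : ∀ p → π (ι p) ≡ p
  π-ι []            = ≡.refl
  π-ι ((c , u) ∷ p) rewrite parse-ιʷ u = ≡.cong (_ ∷_) (π-ι p)

  ι-φ¹ : ∀ v → ι (φ¹ v) ≡ φ (ι v)
  ι-φ¹ v = ι-π (φ (ι v)) (all-φι v)

  private
    Admissible : Word¹ → Set
    Admissible w = ∃₂ λ a u → w ≡ suc a ∷ u

    all-z : ∀ a p → AllWords Admissible (z⁺ (suc a) 𝔥¹.* p)
    all-z a p = all-* Admissible (z⁺ (suc a)) p (All.universal (λ (_ , u) → a , u , ≡.refl) p ∷ [])

    all-act : ∀ a u → AllWords Admissible (act (suc a) u)
    all-act a []      = []
    all-act a (j ∷ u) = all-* Admissible (suc a ∘₊ j) (basis u)
      (((_ , u , ≡.refl) ∷ []) ∷ ((_ , u , ≡.refl) ∷ []) ∷ [])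

    all-Sʷ : ∀ s {w} → Admissible w → AllWords Admissible (Sʷ s w)
    all-Sʷ s (a , u , ≡.refl) = All.++⁺ (all-z a (Sʷ s u))
      (all-• {P = Admissible} s (all-extend Admissible (act (suc a)) (Sʷ s u)
        (All.universal (λ (_ , w) → all-act a w) (Sʷ s u))))

    all-S : ∀ s p → AllWords Admissible p → AllWords Admissible (S[ s ] p)
    all-S s p a = all-extend Admissible (Sʷ s) p (All.map (all-Sʷ s) a)

    all-⊛ : ∀ u v → AllWords Admissible (u ⊛ v)
    all-⊛ u v = all-extend Admissible (λ u′ → extend (⊛ʷ u′) v) u (All.universal (λ (_ , u′) →
      all-extend Admissible (⊛ʷ u′) v (All.universal (λ (_ , v′) → all-⊛ʷ u′ v′) v)) u)
      where
      all-⊛ʷ : ∀ u v → AllWords Admissible (⊛ʷ u v)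
      all-⊛ʷ []      v       = []
      all-⊛ʷ (i ∷ u) []      = []
      all-⊛ʷ (i ∷ u) (j ∷ v) = all-z (i ℕ.+ j) (basis u ∗₊ basis v)

    last-Y : ∀ a u → ∃ λ w → ιʷ (a ∷ u) ≡ w ++ [ Y ]
    last-Y zero [] = [] , ≡.refl
    last-Y zero (b ∷ u) with last-Y b u
    ... | w , e = Y ∷ w , ≡.cong (Y ∷_) e
    last-Y (suc a) u with last-Y a u
    ... | w , e = X ∷ w , ≡.cong (X ∷_) e

    module ≋𝔥 = Equality {Word} (List.≡-dec _≟ᴸ_)

    ι-Admissible : ∀ p → AllWords Admissible p → ∃ λ u → ι p 𝔥.≈ x 𝔥.* u 𝔥.* y
    ι-Admissible []            []                      = [] , 𝔥.refl
    ι-Admissible ((c , _) ∷ p) ((a , u , ≡.refl) ∷ as) with last-Y a u | ι-Admissible p as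
    ... | w , e | q , h = (c , w) ∷ q , 𝔥.trans (𝔥.+-cong (head e) 𝔥.refl) (𝔥.+-cong {[ _ ]} 𝔥.refl h)
      where
      head : ∀ {v} → v ≡ w ++ [ Y ] → [ c , X ∷ v ] 𝔥.≈ [ (1# *ᴷ c) *ᴷ 1# , X ∷ w ++ [ Y ] ]
      head ≡.refl = Equality.mk≋ λ _ → K.+-congʳ (K.*-congʳ
        (K.sym (K.trans (K.*-identityʳ _) (K.*-identityˡ c))))

  ⊛ᵗ-∈𝔥⁰ : ∀ u v → ι (u ⊛ᵗ v) ∈𝔥⁰
  ⊛ᵗ-∈𝔥⁰ u v with ι-Admissible (u ⊛ᵗ v) (all-S (-ᴷ t) (S u ⊛ S v) (all-⊛ (S u) (S v)))
  ... | w , e = 0# , w , 𝔥.trans e (𝔥.+-cong (𝔥.sym (≋𝔥.•-zero 𝔥.1#)) 𝔥.refl)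

-- ℚ[ħ,t] is the ring of polynomials in ħ over ℚ[t].
ℚ-ring ℚ[t] ℚ[ħ,t] : CommutativeRing 0ℓ 0ℓ
ℚ-ring  = ℚ.+-*-commutativeRing
ℚ[t]    = polynomials ℚ-ring
ℚ[ħ,t]  = polynomials ℚ[t]

module ℚ[t]   = CommutativeRing ℚ[t]
module ℚ[ħ,t] = CommutativeRing ℚ[ħ,t]

t ħ : ℚ[ħ,t].Carrier
t = [ FreeModule.basis ℚ-ring 1 , 0 ]
ħ = FreeModule.basis ℚ[t] 1

open Hoffman ℚ[ħ,t] ħ t public

module ℚ⟦q⟧ where
  open PowerSeries ℚ-ring public
  open RawRing rawRing⟦q⟧ public
  open RawSemiringDefinitions rawSemiring public using (_^_) renaming (sum to ∑)

module ℚ[t]⟦q⟧ where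
  open PowerSeries ℚ[t] public
  open RawRing rawRing⟦q⟧ public
  open RawSemiringDefinitions rawSemiring public using (_^_) renaming (sum to ∑)

module ℚ[ħ,t]⟦q⟧ where
  open PowerSeries ℚ[ħ,t] public
  open RawRing rawRing⟦q⟧ public

Index : Set
Index = List ℕ

module _ where
  open ℚ⟦q⟧

  [_]q : ℕ → Series
  [ n ]q = (1# + (- (q ^ n))) * inv (1# + (- q))

  -- The sum over M > m₁ > ⋯ > m_l ≥ 1.
  ζ< : ℕ → Index → Series
  ζ< M []       = 1#
  ζ< M (k ∷ ks) = ∑ {M ∸ 1} λ i → let m = suc (toℕ i) in
    q ^ ((k ∸ 1) ℕ.* m) * inv [ m ]q ^ k * ζ< m ks

  -- For k₁ ≥ 2 the terms with m₁ > n are divisible by qⁿ⁺¹, so the coefficient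
  -- of qⁿ in the infinite sum is that of the sum over m₁ < n + 1.
  ζ : Index → Series
  ζ ks n = ζ< (suc n) ks n

  -- fillings k (k₂, …, k_l) lists the (k □ k₂ □ ⋯ □ k_l), one for each of the
  -- 3ˡ⁻¹ choices of the symbols.
  fillings : ℕ → List ℕ → List Index
  fillings k []        = [ [ k ] ]
  fillings k (k′ ∷ ks) = map (k ∷_) (fillings k′ ks)
                      ++ fillings (k ℕ.+ k′) ks
                      ++ fillings (k ℕ.+ k′ ∸ 1) ks

  -- An element of ℚ⟦q⟧[t], as a list of terms (coefficient, exponent of t).
  ζᵗ : Index → List (Series × ℕ)
  ζᵗ []       = [ 1# , 0 ]
  ζᵗ (k ∷ ks) = map (λ p → (1# + (- q)) ^ (sum (k ∷ ks) ∸ sum p) * ζ p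
                         , length (k ∷ ks) ∸ length p)
                    (fillings k ks)

-- The inclusion ℚ⟦q⟧[t] ⊆ ℚ[ħ,t]⟦q⟧.
embed : List (ℚ⟦q⟧.Series × ℕ) → ℚ[ħ,t]⟦q⟧.Series
embed p n = [ map (map₁ (λ a → a n)) p , 0 ]

-- The linear extension to 𝔥¹ of Ẑ_q^t; only its values on 𝔥⁰ are meaningful,
-- since ζ needs k₁ ≥ 2 (see ⊛ᵗ-∈𝔥⁰).
Ẑ : 𝔥¹ → ℚ[ħ,t]⟦q⟧.Series
Ẑ []            = ℚ[ħ,t]⟦q⟧.0#
Ẑ ((c , w) ∷ p) = ℚ[ħ,t]⟦q⟧.const c ℚ[ħ,t]⟦q⟧.* embed (ζᵗ (map suc w)) ℚ[ħ,t]⟦q⟧.+ Ẑ p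

module _ where
  open ℚ[t]⟦q⟧

  -- The substitution ħ ↦ 1 - q, on ℚ[ħ,t] and on ℚ[ħ,t]⟦q⟧.
  subst-ħ : ℚ[ħ,t].Carrier → Series
  subst-ħ []            = 0#
  subst-ħ ((c , a) ∷ p) = const c * (1# + (- q)) ^ a + subst-ħ p

  f : ℚ[ħ,t]⟦q⟧.Series → Series
  f F n = ℚ[t]∑ {suc n} (λ i → subst-ħ (F (toℕ i)) (n ∸ toℕ i))
    where open RawSemiringDefinitions (Semiring.rawSemiring ℚ[t].semiring) using () renaming (sum to ℚ[t]∑)

  Z : 𝔥¹ → Series
  Z = f ∘ Ẑ

  -- Σ a i j over the i, j ≥ 1 with i + j = m.
  ∑[i+j=_] : ℕ → (ℕ → ℕ → Series) → Series
  ∑[i+j= m ] a = ∑ {m ∸ 1} (λ i → a (suc (toℕ i)) (m ∸ suc (toℕ i)))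

open ℚ[t]⟦q⟧ public using (_≈_; _*_; -_)

module Submission where

-- For a word w of 𝔥¹ let w_m be the part of the sum ζ_q(w) with largest index m; then
-- Σ_m q^m u_m v_m is the value of ζ_q on u ⊛ v. As Z is ζ_q after S, and S maps b[ n ]
-- to yⁿ⁺¹, both sides are coefficients of the series
--   G_V(X) = Σ_m q^m φ(V)_m B_m(X),   B_m(X) = (X / [m]) ∏_{j<m} (1 + X / [j]),
-- and the claim is G_V G_W = G_{V ∗ W}. At X = -[N] the series is finite and, by
-- summation by parts, equal to the sum over N ≥ m₁ > ⋯ > m_l ≥ 1 of the products of
-- the (q^m / [m])^k; these sums turn ∗ into the product. In terms of U = 1 + (1 - q) X
-- the points X = -[N] are U = q^N, and an element of ℚ[t][U]⟦q⟧ is determined by its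
-- values there.

open import Defs using (module FreeModule; module MonoidAlgebra; polynomials; module PowerSeries; module Hoffman; Index; fillings)
open import Algebra.Bundles using (CommutativeRing; RawRing; Semiring)
import Algebra.Definitions.RawSemiring as RawSemiringDefinitions
open import Algebra.Morphism.Structures using (module RingMorphisms)
import Algebra.Properties.CommutativeSemigroup as CommutativeSemigroupProperties
import Algebra.Properties.CommutativeSemiring.Exp as CommutativeSemiringExp
import Algebra.Properties.Ring as RingProperties
import Algebra.Properties.Semiring.Exp as SemiringExp
import Algebra.Properties.Semiring.Sum as SemiringSum
import Algebra.Solver.Ring.NaturalCoefficients.Default as NaturalCoefficientsSolver
open import Data.Fin.Base as Fin using (toℕ)
import Data.Fin.Properties as Fin
open import Data.List.Base using (List; []; _∷_; _++_; map; length; replicate)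
import Data.List.Properties as List
open import Data.List.Relation.Unary.All using (All; []; _∷_)
import Data.List.Relation.Unary.All as All
import Data.List.Relation.Unary.All.Properties as All
open import Data.Maybe.Base using (Maybe; just; nothing; maybe; _>>=_)
open import Data.Nat.Base as ℕ using (ℕ; zero; suc; _∸_; _≥_; _≤_; _<_; s≤s)
open import Data.Nat.ListAction using (sum)
import Data.Nat.Properties as ℕ
open import Data.Product.Base using (_×_; _,_; map₁)
open import Function.Base using (_∘_; id)
open import Level using (0ℓ)
open import Relation.Binary.Definitions using (DecidableEquality)
open import Relation.Binary.PropositionalEquality as ≡ using (_≡_)
import Relation.Binary.Reasoning.Setoid as SetoidReasoning
open import Relation.Nullary.Decidable.Core using (yes; no)

-- Formal power series

-- B_m is the generating function of the terms of the powers of y: the coefficient of Xⁱ in B_m(X)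
-- is (yⁱ)_m. So the coefficient of Xⁿ⁺¹ in G_V is the value of ζ_q on φ(V) ⊛ yⁿ⁺¹, and the sum over
-- i + j = m is a Cauchy product in X. The coefficient of X⁰ vanishes on 𝔥y, which is why i and j
-- start at 1. Each `φᵗ` carries a minus sign, twice on the left and once on the right; this is the
-- sign in the claim. Two families of truncated sums occur. The terms w_m have the weights
-- q^((k-1)m) / [m]^k of ζ_q, for which ∗₊ is the product because 1/[m] = q^m/[m] + (1 - q). The
-- values at X = -[N] have the weights q^(km) / [m]^k, for which ∗ is the product. Evaluation at
-- -[N] after φ passes from one family to the other. The variable U is chosen because the points X =
-- -[N] accumulate q-adically at -1/(1 - q), that is, at U = 0. Values at these points do not show
-- single coefficients of X; they are read off after a second substitution, U = 1 + (1 - q) X, into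
-- power series in X.

module PowerSeriesRing (K : CommutativeRing 0ℓ 0ℓ) where

  open CommutativeRing K
  open SetoidReasoning setoid
  open PowerSeries K using (Series; const; rawRing⟦q⟧)
  private
    module ⟦q⟧ = RawRing rawRing⟦q⟧
    module Sum = SemiringSum semiring
  open ⟦q⟧ using () renaming (_*_ to infixl 7 _⊗_; _+_ to infixl 6 _⊕_)

  ⊗-cong : ∀ {a a′ b b′} → a ⟦q⟧.≈ a′ → b ⟦q⟧.≈ b′ → a ⊗ b ⟦q⟧.≈ a′ ⊗ b′
  ⊗-cong d e n = Sum.sum-cong-≋ {suc n} λ i → *-cong (d (toℕ i)) (e (n ∸ toℕ i))

  ⊗-zeroˡ : ∀ a → ⟦q⟧.0# ⊗ a ⟦q⟧.≈ ⟦q⟧.0#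
  ⊗-zeroˡ a n = trans (Sum.sum-cong-≋ {suc n} λ i → zeroˡ (a (n ∸ toℕ i))) (Sum.sum-replicate-zero (suc n))

  const-⊗ : ∀ c a n → (const c ⊗ a) n ≈ c * a n
  const-⊗ c a zero    = +-identityʳ _
  const-⊗ c a (suc n) = trans (+-congˡ (⊗-zeroˡ a n)) (+-identityʳ _)

  ⊗-distribʳ : ∀ c a b → (a ⊕ b) ⊗ c ⟦q⟧.≈ (a ⊗ c) ⊕ (b ⊗ c)
  ⊗-distribʳ c a b n = trans
    (Sum.sum-cong-≋ {suc n} λ i → distribʳ (c (n ∸ toℕ i)) (a (toℕ i)) (b (toℕ i)))
    (Sum.∑-distrib-+ {suc n} (λ i → a (toℕ i) * c (n ∸ toℕ i)) (λ i → b (toℕ i) * c (n ∸ toℕ i)))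

  ⊗-sucʳ : ∀ a b n → (a ⊗ b) (suc n) ≈ a (suc n) * b 0 + (a ⊗ (b ∘ suc)) n
  ⊗-sucʳ a b zero = begin
    a 0 * b 1 + (a 1 * b 0 + 0#)   ≈⟨ +-cong (sym (+-identityʳ _)) (+-identityʳ _) ⟩
    (a 0 * b 1 + 0#) + a 1 * b 0   ≈⟨ +-comm _ _ ⟩
    a 1 * b 0 + (a 0 * b 1 + 0#)   ∎
  ⊗-sucʳ a b (suc n) = begin
    a 0 * b (suc (suc n)) + (a ∘ suc ⊗ b) (suc n)
      ≈⟨ +-congˡ (⊗-sucʳ (a ∘ suc) b n) ⟩
    a 0 * b (suc (suc n)) + (a (suc (suc n)) * b 0 + (a ∘ suc ⊗ b ∘ suc) n)
      ≈⟨ x∙yz≈y∙xz _ _ _ ⟩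
    a (suc (suc n)) * b 0 + (a 0 * b (suc (suc n)) + (a ∘ suc ⊗ b ∘ suc) n) ∎
    where open CommutativeSemigroupProperties +-commutativeSemigroup using (x∙yz≈y∙xz)

  ⊗-comm : ∀ a b → a ⊗ b ⟦q⟧.≈ b ⊗ a
  ⊗-comm a b zero    = +-congʳ (*-comm _ _)
  ⊗-comm a b (suc n) = trans (+-cong (*-comm _ _) (⊗-comm (a ∘ suc) b n)) (sym (⊗-sucʳ b a n))

  ⊗-assoc : ∀ a b c → (a ⊗ b) ⊗ c ⟦q⟧.≈ a ⊗ (b ⊗ c)
  ⊗-assoc a b c zero = +-congʳ (begin
    (a 0 * b 0 + 0#) * c 0   ≈⟨ *-congʳ (+-identityʳ _) ⟩
    a 0 * b 0 * c 0          ≈⟨ *-assoc _ _ _ ⟩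
    a 0 * (b 0 * c 0)        ≈⟨ *-congˡ (+-identityʳ _) ⟨
    a 0 * (b 0 * c 0 + 0#)   ∎)
  ⊗-assoc a b c (suc n) = begin
    (a 0 * b 0 + 0#) * c (suc n) + (((λ i → a 0 * b (suc i)) ⊕ (a ∘ suc ⊗ b)) ⊗ c) n
      ≈⟨ +-cong (*-congʳ (+-identityʳ _)) (⊗-distribʳ c (λ i → a 0 * b (suc i)) (a ∘ suc ⊗ b) n) ⟩
    a 0 * b 0 * c (suc n) + (((λ i → a 0 * b (suc i)) ⊗ c) n + ((a ∘ suc ⊗ b) ⊗ c) n)
      ≈⟨ +-assoc _ _ _ ⟨
    (a 0 * b 0 * c (suc n) + ((λ i → a 0 * b (suc i)) ⊗ c) n) + ((a ∘ suc ⊗ b) ⊗ c) n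
      ≈⟨ +-cong (+-cong (*-assoc _ _ _) scaled) (⊗-assoc (a ∘ suc) b c n) ⟩
    (a 0 * (b 0 * c (suc n)) + a 0 * (b ∘ suc ⊗ c) n) + (a ∘ suc ⊗ (b ⊗ c)) n
      ≈⟨ +-congʳ (distribˡ _ _ _) ⟨
    a 0 * (b ⊗ c) (suc n) + (a ∘ suc ⊗ (b ⊗ c)) n ∎
    where
    scaled : ((λ i → a 0 * b (suc i)) ⊗ c) n ≈ a 0 * (b ∘ suc ⊗ c) n
    scaled = trans (Sum.sum-cong-≋ {suc n} λ i → *-assoc (a 0) (b (suc (toℕ i))) (c (n ∸ toℕ i)))
                   (sym (Sum.*-distribˡ-sum {suc n} (a 0) (λ i → b (suc (toℕ i)) * c (n ∸ toℕ i))))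

  ⊗-identityˡ : ∀ a → ⟦q⟧.1# ⊗ a ⟦q⟧.≈ a
  ⊗-identityˡ a n = trans (const-⊗ 1# a n) (*-identityˡ _)

  commutativeRing : CommutativeRing 0ℓ 0ℓ
  commutativeRing = record
    { Carrier = Series ; _≈_ = ⟦q⟧._≈_ ; _+_ = ⟦q⟧._+_ ; _*_ = ⟦q⟧._*_ ; -_ = ⟦q⟧.-_ ; 0# = ⟦q⟧.0# ; 1# = ⟦q⟧.1#
    ; isCommutativeRing = record
      { isRing = record
        { +-isAbelianGroup = record
          { isGroup = record
            { isMonoid = record
              { isSemigroup = record
                { isMagma = record
                  { isEquivalence = record
                    { refl = λ _ → refl ; sym = λ e n → sym (e n) ; trans = λ d e n → trans (d n) (e n) }
                  ; ∙-cong = λ d e n → +-cong (d n) (e n) }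
                ; assoc = λ a b c n → +-assoc (a n) (b n) (c n) }
              ; identity = (λ a n → +-identityˡ (a n)) , (λ a n → +-identityʳ (a n)) }
            ; inverse = (λ a n → -‿inverseˡ (a n)) , (λ a n → -‿inverseʳ (a n))
            ; ⁻¹-cong = λ e n → -‿cong (e n) }
          ; comm = λ a b n → +-comm (a n) (b n) }
        ; *-cong = λ {a} {a′} {b} {b′} → ⊗-cong {a} {a′} {b} {b′}
        ; *-assoc = ⊗-assoc
        ; *-identity = ⊗-identityˡ , λ a n → trans (⊗-comm a ⟦q⟧.1# n) (⊗-identityˡ a n)
        ; distrib = (λ c a b n → trans (⊗-comm c (a ⊕ b) n)
                      (trans (⊗-distribʳ c a b n) (+-cong (⊗-comm a c n) (⊗-comm b c n))))
                  , ⊗-distribʳ }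
      ; *-comm = ⊗-comm } }

series : CommutativeRing 0ℓ 0ℓ → CommutativeRing 0ℓ 0ℓ
series = PowerSeriesRing.commutativeRing

-- Ring homomorphisms and semilinear evaluation

IsHom : (R S : CommutativeRing 0ℓ 0ℓ) → (CommutativeRing.Carrier R → CommutativeRing.Carrier S) → Set
IsHom R S = RingMorphisms.IsRingHomomorphism (CommutativeRing.rawRing R) (CommutativeRing.rawRing S)

module IsHom {R S : CommutativeRing 0ℓ 0ℓ} {h : CommutativeRing.Carrier R → CommutativeRing.Carrier S}
             (isHom : IsHom R S h) where

  open RingMorphisms.IsRingHomomorphism isHom public
    using (⟦⟧-cong; +-homo; *-homo; 0#-homo; 1#-homo; -‿homo)
  private
    module R = CommutativeRing R
    module S = CommutativeRing S

  sum-homo : ∀ n (v : Fin.Fin n → R.Carrier) →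
             h (SemiringSum.sum R.semiring {n} v) S.≈ SemiringSum.sum S.semiring {n} (h ∘ v)
  sum-homo zero    v = 0#-homo
  sum-homo (suc n) v = S.trans (+-homo _ _) (S.+-congˡ (sum-homo n (v ∘ Fin.suc)))

  ^-homo : ∀ a n → h (SemiringExp._^_ R.semiring a n) S.≈ SemiringExp._^_ S.semiring (h a) n
  ^-homo a zero    = 1#-homo
  ^-homo a (suc n) = S.trans (*-homo _ _) (S.*-congˡ (^-homo a n))

module _ (R S : CommutativeRing 0ℓ 0ℓ) where

  private
    module R = CommutativeRing R
    module S = CommutativeRing S
    open RingProperties S.ring using (+-identityˡ-unique; +-inverseˡ-unique)

  -- Preservation of zero and of negatives follows from additivity by cancellation in the additive
  -- group.
  mkHom : {h : R.Carrier → S.Carrier} → (∀ {a b} → a R.≈ b → h a S.≈ h b) →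
          (∀ a b → h (a R.+ b) S.≈ h a S.+ h b) → (∀ a b → h (a R.* b) S.≈ h a S.* h b) →
          h R.1# S.≈ S.1# → IsHom R S h
  mkHom {h} cong add mul one = record
    { isSemiringHomomorphism = record
      { isNearSemiringHomomorphism = record
        { +-isMonoidHomomorphism = record
          { isMagmaHomomorphism = record { isRelHomomorphism = record { cong = cong } ; homo = add }
          ; ε-homo = h0 }
        ; *-homo = mul }
      ; 1#-homo = one }
    ; -‿homo = λ a → +-inverseˡ-unique _ _ (S.trans (S.sym (add (R.- a) a)) (S.trans (cong (R.-‿inverseˡ a)) h0))
    }
    where
    h0 : h R.0# S.≈ S.0#
    h0 = +-identityˡ-unique _ _ (S.trans (S.sym (add R.0# R.0#)) (cong (R.+-identityˡ R.0#)))

∘-hom : ∀ {Q R S : CommutativeRing 0ℓ 0ℓ} {g h} → IsHom R S g → IsHom Q R h → IsHom Q S (g ∘ h)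
∘-hom {Q} {R} {S} {g} {h} g-hom h-hom = mkHom Q S
  (g.⟦⟧-cong ∘ h.⟦⟧-cong)
  (λ a b → S.trans (g.⟦⟧-cong (h.+-homo a b)) (g.+-homo _ _))
  (λ a b → S.trans (g.⟦⟧-cong (h.*-homo a b)) (g.*-homo _ _))
  (S.trans (g.⟦⟧-cong h.1#-homo) g.1#-homo)
  where
  module S = CommutativeRing S
  module g = IsHom {R} {S} g-hom
  module h = IsHom {Q} {R} h-hom

module Semilinear (K R : CommutativeRing 0ℓ 0ℓ) {κ : CommutativeRing.Carrier K → CommutativeRing.Carrier R}
                  (κ-hom : IsHom K R κ) where

  private
    module K  = CommutativeRing K
    module FK = FreeModule K
    module FR = FreeModule R
    module κ  = IsHom {K} {R} κ-hom
    variable X Y : Set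
  open CommutativeRing R
  open FK using (Lin)

  base-change : Lin X → FR.Lin X
  base-change = map (map₁ κ)

  -- The κ-semilinear extension of f. Functionals on 𝔥 over ℚ[ħ,t] thereby take values in series
  -- where ħ has already become 1 - q.
  eval : (X → Carrier) → Lin X → Carrier
  eval f = FR.eval f ∘ base-change

  eval-cong : {f g : X → Carrier} → (∀ x → f x ≈ g x) → ∀ p → eval f p ≈ eval g p
  eval-cong h = FR.eval-cong h ∘ base-change

  eval-++ : ∀ (f : X → Carrier) p q → eval f (p ++ q) ≈ eval f p + eval f q
  eval-++ f []            q = sym (+-identityˡ _)
  eval-++ f ((c , x) ∷ p) q = trans (+-congˡ (eval-++ f p q)) (sym (+-assoc _ _ _))

  eval-• : ∀ (f : X → Carrier) c p → eval f (c FK.• p) ≈ κ c * eval f p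
  eval-• f c []            = sym (zeroʳ _)
  eval-• f c ((d , x) ∷ p) = trans
    (+-cong (trans (*-congʳ (κ.*-homo c d)) (*-assoc _ _ _)) (eval-• f c p)) (sym (distribˡ _ _ _))

  eval-basis : ∀ (f : X → Carrier) x → eval f (FK.basis x) ≈ f x
  eval-basis f x = trans (+-identityʳ _) (trans (*-congʳ κ.1#-homo) (*-identityˡ _))

  eval-rename : ∀ (g : Y → Carrier) (f : X → Y) p → eval g (FK.rename f p) ≈ eval (g ∘ f) p
  eval-rename g f []            = refl
  eval-rename g f ((c , x) ∷ p) = +-congˡ (eval-rename g f p)

  eval-extend : ∀ (g : Y → Carrier) (f : X → Lin Y) p → eval g (FK.extend f p) ≈ eval (λ x → eval g (f x)) p
  eval-extend g f []            = refl
  eval-extend g f ((c , x) ∷ p) =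
    trans (eval-++ g (c FK.• f x) _) (+-cong (eval-• g c (f x)) (eval-extend g f p))

  eval-* : ∀ c (f : X → Carrier) p → eval (λ x → c * f x) p ≈ c * eval f p
  eval-* c f = FR.eval-* c f ∘ base-change

  eval-+ : ∀ (f g : X → Carrier) p → eval (λ x → f x + g x) p ≈ eval f p + eval g p
  eval-+ f g = FR.eval-+ f g ∘ base-change

  eval-0 : ∀ (p : Lin X) → eval (λ _ → 0#) p ≈ 0#
  eval-0 = FR.eval-0 ∘ base-change

  eval-image : ∀ (f : X → K.Carrier) p → κ (FK.eval f p) ≈ eval (κ ∘ f) p
  eval-image f []            = κ.0#-homo
  eval-image f ((c , x) ∷ p) = trans (κ.+-homo _ _) (+-cong (κ.*-homo c (f x)) (eval-image f p))

  module _ {X : Set} (_≟_ : DecidableEquality X) where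

    private
      module EK = FK.Equality _≟_
      module ER = FR.Equality _≟_

      base-change-coeff : ∀ p x → ER.coeff (base-change p) x ≈ κ (EK.coeff p x)
      base-change-coeff []            x = sym κ.0#-homo
      base-change-coeff ((c , y) ∷ p) x = trans
        (+-cong (trans (*-congˡ (δ-homo y)) (sym (κ.*-homo c _))) (base-change-coeff p x))
        (sym (κ.+-homo _ _))
        where
        δ-homo : ∀ y → ER.δ x y ≈ κ (EK.δ x y)
        δ-homo y with x ≟ y
        ... | yes _ = sym κ.1#-homo
        ... | no  _ = sym κ.0#-homo

    eval-resp : ∀ (f : X → Carrier) {p q} → p EK.≋ q → eval f p ≈ eval f q
    eval-resp f {p} {q} e = ER.eval-resp f {base-change p} {base-change q} (ER.mk≋ λ x → trans (base-change-coeff p x)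
      (trans (κ.⟦⟧-cong (EK.coeff≈ e x)) (sym (base-change-coeff q x))))

  module _ {M : Set} (_≟_ : DecidableEquality M) (_∙_ : M → M → M) {ε : M} where

    eval-⋆ : ∀ f p q → eval f (MonoidAlgebra._⋆_ K _≟_ {_∙_} {ε} p q) ≈ eval (λ x → eval (λ y → f (x ∙ y)) q) p
    eval-⋆ f p q = trans (eval-extend f _ p) (eval-cong (λ x → eval-rename f (x ∙_) q) p)

  open SemiringExp semiring using (_^_; ^-homo-*)

  polynomial-hom : ∀ u → IsHom (polynomials K) R (eval (u ^_))
  polynomial-hom u = mkHom (polynomials K) R
    (eval-resp ℕ._≟_ (u ^_))
    (eval-++ (u ^_))
    (λ p q → trans (eval-⋆ ℕ._≟_ ℕ._+_ {0} (u ^_) p q)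
      (trans (eval-cong (λ a → trans (eval-cong (λ b → ^-homo-* u a b) q) (eval-* (u ^ a) (u ^_) q)) p)
      (trans (eval-cong (λ a → *-comm _ _) p) (trans (eval-* _ (u ^_) p) (*-comm _ _)))))
    (eval-basis (u ^_) 0)

-- Convergent sums of series, inverses and q-integers

module PowerSeriesProperties (K : CommutativeRing 0ℓ 0ℓ) where

  open PowerSeriesRing K public
  open PowerSeries K using (Series; const; q)
  private
    module K   = CommutativeRing K
    module KS  = SemiringSum K.semiring
    module S²  = PowerSeriesRing commutativeRing
    module PS² = PowerSeries commutativeRing
  open CommutativeRing S².commutativeRing using () renaming (_*_ to infixl 7 _⊗²_)
  open CommutativeRing commutativeRing
  open SemiringExp semiring using (_^_)
  open SetoidReasoning setoid
  open CommutativeSemigroupProperties *-commutativeSemigroup using (x∙yz≈y∙xz)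

  const-hom : IsHom K commutativeRing const
  const-hom = mkHom K commutativeRing
    (λ { e zero → e ; e (suc n) → K.refl })
    (λ { a b zero → K.refl ; a b (suc n) → K.sym (K.+-identityˡ _) })
    (λ { a b zero → K.sym (const-⊗ a (const b) 0)
       ; a b (suc n) → K.sym (K.trans (const-⊗ a (const b) (suc n)) (K.zeroʳ a)) })
    (λ _ → K.refl)

  q-suc : ∀ a n → (q * a) (suc n) K.≈ a n
  q-suc a n = K.trans (K.+-cong (K.zeroˡ _)
    (*-congʳ {a} {λ i → q (suc i)} {1#} (λ { zero → K.refl ; (suc _) → K.refl }) n))
    (K.trans (K.+-identityˡ _) (*-identityˡ a n))

  q-zero : ∀ a → (q * a) 0 K.≈ K.0#
  q-zero a = K.trans (K.+-identityʳ _) (K.zeroˡ _)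

  q^-zero : ∀ N a {n} → n < N → (q ^ N * a) n K.≈ K.0#
  q^-zero (suc N) a {zero}  _       = K.trans (*-assoc q (q ^ N) a 0) (q-zero (q ^ N * a))
  q^-zero (suc N) a {suc n} (s≤s l) = K.trans (*-assoc q (q ^ N) a (suc n))
    (K.trans (q-suc (q ^ N * a) n) (q^-zero N a l))

  q^-cancel : ∀ N a → q ^ N * a ≈ 0# → a ≈ 0#
  q^-cancel zero    a e = trans {a} {1# * a} (sym {1# * a} {a} (*-identityˡ a)) e
  q^-cancel (suc N) a e = q^-cancel N a λ n → K.trans (K.sym (q-suc (q ^ N * a) n))
    (K.trans (K.sym (*-assoc q (q ^ N) a (suc n))) (e (suc n)))

  -- Σₘ qᵐ sₘ
  Σq : (ℕ → Series) → Series
  Σq s n = KS.sum {suc n} λ i → s (toℕ i) (n ∸ toℕ i)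

  Σq-unfold : ∀ s → Σq s ≈ s 0 + q * Σq (s ∘ suc)
  Σq-unfold s zero    = K.+-congˡ (K.sym (q-zero (Σq (s ∘ suc))))
  Σq-unfold s (suc n) = K.+-congˡ (K.sym (q-suc (Σq (s ∘ suc)) n))

  -- Every unfolding contributes a factor q, so n + 1 unfoldings fix the coefficient of qⁿ. This
  -- takes the place of convergence arguments: two infinite sums agree once they satisfy the same
  -- recursion.
  q-unique : {I : Set} (F G h : I → Series) (next : I → I) →
             (∀ i → F i ≈ h i + q * F (next i)) → (∀ i → G i ≈ h i + q * G (next i)) → ∀ i → F i ≈ G i
  q-unique F G h next eF eG i zero = K.trans (eF i 0) (K.trans
    (K.+-congˡ (K.trans (q-zero (F (next i))) (K.sym (q-zero (G (next i)))))) (K.sym (eG i 0)))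
  q-unique F G h next eF eG i (suc n) = K.trans (eF i (suc n)) (K.trans
    (K.+-congˡ (K.trans (q-suc (F (next i)) n) (K.trans (q-unique F G h next eF eG (next i) n)
      (K.sym (q-suc (G (next i)) n))))) (K.sym (eG i (suc n))))

  Σq-cong : ∀ {s s′} → (∀ m → s m ≈ s′ m) → Σq s ≈ Σq s′
  Σq-cong e n = KS.sum-cong-≋ {suc n} λ i → e (toℕ i) (n ∸ toℕ i)

  Σq-0 : Σq (λ _ → 0#) ≈ 0#
  Σq-0 n = KS.sum-replicate-zero (suc n)

  Σq-+ : ∀ s s′ → Σq (λ m → s m + s′ m) ≈ Σq s + Σq s′
  Σq-+ s s′ n = KS.∑-distrib-+ {suc n} (λ i → s (toℕ i) (n ∸ toℕ i)) (λ i → s′ (toℕ i) (n ∸ toℕ i))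

  Σq-const : ∀ a → Σq (PS².const a) ≈ a
  Σq-const a = begin
    Σq (PS².const a)            ≈⟨ Σq-unfold (PS².const a) ⟩
    a + q * Σq (λ _ → 0#)       ≈⟨ +-congˡ {a} (*-congˡ {q} Σq-0) ⟩
    a + q * 0#                  ≈⟨ +-congˡ {a} (zeroʳ q) ⟩
    a + 0#                      ≈⟨ +-identityʳ a ⟩
    a                           ∎

  Σq-scaleˡ : ∀ c s → Σq (λ m → c * s m) ≈ c * Σq s
  Σq-scaleˡ c = q-unique (λ s → Σq (λ m → c * s m)) (λ s → c * Σq s) (λ s → c * s 0) (_∘ suc)
    (λ s → Σq-unfold (λ m → c * s m))
    (λ s → begin
      c * Σq s                             ≈⟨ *-congˡ {c} (Σq-unfold s) ⟩
      c * (s 0 + q * Σq (s ∘ suc))         ≈⟨ distribˡ c (s 0) (q * Σq (s ∘ suc)) ⟩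
      c * s 0 + c * (q * Σq (s ∘ suc))     ≈⟨ +-congˡ {c * s 0} (x∙yz≈y∙xz c q (Σq (s ∘ suc))) ⟩
      c * s 0 + q * (c * Σq (s ∘ suc))     ∎)

  -- With m read as the exponent of a second variable Q, `Σq` is the substitution Q = q from K⟦q⟧⟦Q⟧
  -- to K⟦q⟧.
  Σq-* : ∀ s s′ → Σq (s ⊗² s′) ≈ Σq s * Σq s′
  Σq-* s s′ = q-unique (λ s → Σq (s ⊗² s′)) (λ s → Σq s * Σq s′) (λ s → s 0 * Σq s′) (_∘ suc)
    unfoldˡ
    (λ s → begin
      Σq s * Σq s′                                 ≈⟨ *-congʳ {Σq s′} (Σq-unfold s) ⟩
      (s 0 + q * Σq (s ∘ suc)) * Σq s′             ≈⟨ distribʳ (Σq s′) (s 0) (q * Σq (s ∘ suc)) ⟩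
      s 0 * Σq s′ + q * Σq (s ∘ suc) * Σq s′       ≈⟨ +-congˡ {s 0 * Σq s′} (*-assoc q (Σq (s ∘ suc)) (Σq s′)) ⟩
      s 0 * Σq s′ + q * (Σq (s ∘ suc) * Σq s′)     ∎)
    s
    where
    unfoldˡ : ∀ s → Σq (s ⊗² s′) ≈ s 0 * Σq s′ + q * Σq ((s ∘ suc) ⊗² s′)
    unfoldˡ s = begin
      Σq (s ⊗² s′)
        ≈⟨ Σq-unfold (s ⊗² s′) ⟩
      (s 0 * s′ 0 + 0#) + q * Σq (λ m → s 0 * s′ (suc m) + ((s ∘ suc) ⊗² s′) m)
        ≈⟨ +-cong {s 0 * s′ 0 + 0#} (+-identityʳ (s 0 * s′ 0)) (*-congˡ {q} (Σq-+ (λ m → s 0 * s′ (suc m)) ((s ∘ suc) ⊗² s′))) ⟩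
      s 0 * s′ 0 + q * (Σq (λ m → s 0 * s′ (suc m)) + Σq ((s ∘ suc) ⊗² s′))
        ≈⟨ +-congˡ {s 0 * s′ 0} (distribˡ q (Σq (λ m → s 0 * s′ (suc m))) (Σq ((s ∘ suc) ⊗² s′))) ⟩
      s 0 * s′ 0 + (q * Σq (λ m → s 0 * s′ (suc m)) + q * Σq ((s ∘ suc) ⊗² s′))
        ≈⟨ +-assoc (s 0 * s′ 0) (q * Σq (λ m → s 0 * s′ (suc m))) (q * Σq ((s ∘ suc) ⊗² s′)) ⟨
      (s 0 * s′ 0 + q * Σq (λ m → s 0 * s′ (suc m))) + q * Σq ((s ∘ suc) ⊗² s′)
        ≈⟨ +-congʳ (Σq-unfold (λ m → s 0 * s′ m)) ⟨
      Σq (λ m → s 0 * s′ m) + q * Σq ((s ∘ suc) ⊗² s′)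
        ≈⟨ +-congʳ (Σq-scaleˡ (s 0) s′) ⟩
      s 0 * Σq s′ + q * Σq ((s ∘ suc) ⊗² s′) ∎

  Σq-hom : IsHom S².commutativeRing commutativeRing Σq
  Σq-hom = mkHom S².commutativeRing commutativeRing
    (λ {s} {s′} → Σq-cong {s} {s′}) Σq-+ Σq-* (Σq-const 1#)

module SeriesInverse (K : CommutativeRing 0ℓ 0ℓ) where

  open PowerSeriesProperties K
  open PowerSeries K using (Series; q; inv)
  private
    module K   = CommutativeRing K
    module KS  = SemiringSum K.semiring
  open CommutativeRing commutativeRing
  open SemiringExp semiring using (_^_; ^-congˡ)
  open CommutativeSemiringExp commutativeSemiring using (^-distrib-*)
  open RingProperties ring using (-‿distribˡ-*; -‿involutive)
  open SetoidReasoning setoid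

  q^-shift : ∀ N a {n} → N ≤ n → (q ^ N * a) n K.≈ a (n ∸ N)
  q^-shift zero    a {n}     _       = *-identityˡ a n
  q^-shift (suc N) a {suc n} (s≤s l) = K.trans (*-assoc q (q ^ N) a (suc n))
    (K.trans (q-suc (q ^ N * a) n) (q^-shift N a l))

  q-factor : ∀ a → a 0 K.≈ K.0# → a ≈ q * (a ∘ suc)
  q-factor a a₀ zero    = K.trans a₀ (K.sym (q-zero (a ∘ suc)))
  q-factor a a₀ (suc n) = K.sym (q-suc (a ∘ suc) n)

  -- The geometric series s in b = 1 - a satisfies s = 1 + b s, which rearranges to s (1 - b) = 1.
  inv-inverse : ∀ a → a 0 K.≈ K.1# → inv a * a ≈ 1#
  inv-inverse a a₀ = begin
    inv a * a                     ≈⟨ *-congˡ {inv a} a≈1-b ⟩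
    inv a * (1# + - b)            ≈⟨ distribˡ (inv a) 1# (- b) ⟩
    inv a * 1# + inv a * - b      ≈⟨ +-cong {inv a * 1#} (*-identityʳ (inv a)) (*-comm (inv a) (- b)) ⟩
    inv a + - b * inv a           ≈⟨ +-cong {inv a} geometric (sym { - (b * inv a)} { - b * inv a} (-‿distribˡ-* b (inv a))) ⟩
    (1# + b * inv a) + - (b * inv a)   ≈⟨ +-assoc 1# (b * inv a) (- (b * inv a)) ⟩
    1# + (b * inv a + - (b * inv a))   ≈⟨ +-congˡ {1#} (-‿inverseʳ (b * inv a)) ⟩
    1# + 0#                            ≈⟨ +-identityʳ 1# ⟩
    1#                                 ∎
    where
    b b′ : Series
    b  = 1# + - a
    b′ = b ∘ suc
    b≈qb′ : b ≈ q * b′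
    b≈qb′ = q-factor b (K.trans (K.+-congˡ (K.-‿cong a₀)) (K.-‿inverseʳ K.1#))
    a≈1-b : a ≈ 1# + - b
    a≈1-b n = K.sym (K.trans (K.+-congˡ (K.trans (K.sym (RP.-‿+-comm (1# n) (K.- a n))) (K.+-congˡ (RP.-‿involutive (a n)))))
      (K.trans (K.sym (K.+-assoc _ _ _)) (K.trans (K.+-congʳ (K.-‿inverseʳ (1# n))) (K.+-identityˡ (a n)))))
      where module RP = RingProperties K.ring
    -- Both `inv` and `Σq` stop at j = n in the coefficient of qⁿ. As b = q b′, the summand bʲ is qʲ
    -- b′ʲ, so the truncated geometric sum is a sum of the form `Σq`.
    inv≈Σq : inv a ≈ Σq (b′ ^_)
    inv≈Σq n = KS.sum-cong-≋ {suc n} λ i → let j = toℕ i in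
      K.trans (^-congˡ j {b} {q * b′} b≈qb′ n)
      (K.trans (^-distrib-* q b′ j n) (q^-shift j (b′ ^ j) (Fin.toℕ≤pred[n] i)))
    geometric : inv a ≈ 1# + b * inv a
    geometric = begin
      inv a                            ≈⟨ inv≈Σq ⟩
      Σq (b′ ^_)                       ≈⟨ Σq-unfold (b′ ^_) ⟩
      1# + q * Σq (λ j → b′ * b′ ^ j)  ≈⟨ +-congˡ {1#} (*-congˡ {q} (Σq-scaleˡ b′ (b′ ^_))) ⟩
      1# + q * (b′ * Σq (b′ ^_))       ≈⟨ +-congˡ {1#} (*-assoc q b′ (Σq (b′ ^_))) ⟨
      1# + q * b′ * Σq (b′ ^_)         ≈⟨ +-congˡ {1#} (*-cong {b} {q * b′} b≈qb′ inv≈Σq) ⟨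
      1# + b * inv a                   ∎

module QIntegers (K : CommutativeRing 0ℓ 0ℓ) where

  open PowerSeriesProperties K
  open SeriesInverse K
  open PowerSeries K using (Series; q; inv)
  private
    module K   = CommutativeRing K
  open CommutativeRing commutativeRing
  open SemiringExp semiring using (_^_)
  open SetoidReasoning setoid

  ⟦_⟧ : ℕ → Series
  ⟦ n ⟧ = (1# + - q ^ n) * inv (1# + - q)

  inv-1-q : inv (1# + - q) * (1# + - q) ≈ 1#
  inv-1-q = inv-inverse (1# + - q) (K.trans (K.+-congˡ RP.-0#≈0#) (K.+-identityʳ K.1#))
    where module RP = RingProperties K.ring

  ⟦⟧-zero : ⟦ 0 ⟧ ≈ 0#
  ⟦⟧-zero = begin
    (1# + - 1#) * inv (1# + - q)   ≈⟨ *-congʳ {inv (1# + - q)} {1# + - 1#} (-‿inverseʳ 1#) ⟩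
    0# * inv (1# + - q)            ≈⟨ zeroˡ (inv (1# + - q)) ⟩
    0#                             ∎

  ⟦⟧-suc : ∀ n → ⟦ suc n ⟧ ≈ 1# + q * ⟦ n ⟧
  ⟦⟧-suc n = begin
    (1# + - (q * Q)) * w                      ≈⟨ *-congʳ {w} {1# + - (q * Q)} split ⟩
    ((1# + - q) + q * (1# + - Q)) * w         ≈⟨ distribʳ w (1# + - q) (q * (1# + - Q)) ⟩
    (1# + - q) * w + q * (1# + - Q) * w       ≈⟨ +-cong {(1# + - q) * w} (trans {(1# + - q) * w} (*-comm (1# + - q) w) inv-1-q) (*-assoc q (1# + - Q) w) ⟩
    1# + q * ((1# + - Q) * w)                 ∎
    where
    w Q : Series
    w = inv (1# + - q)
    Q = q ^ n
    split : 1# + - (q * Q) ≈ (1# + - q) + q * (1# + - Q)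
    split = sym {(1# + - q) + q * (1# + - Q)} {1# + - (q * Q)} (begin
      (1# + - q) + q * (1# + - Q)               ≈⟨ +-congˡ {1# + - q} (distribˡ q 1# (- Q)) ⟩
      (1# + - q) + (q * 1# + q * - Q)           ≈⟨ +-congˡ {1# + - q} (+-cong {q * 1#} (*-identityʳ q) (sym { - (q * Q)} {q * - Q} (-‿distribʳ-* q Q))) ⟩
      (1# + - q) + (q + - (q * Q))              ≈⟨ +-assoc 1# (- q) (q + - (q * Q)) ⟩
      1# + (- q + (q + - (q * Q)))              ≈⟨ +-congˡ {1#} (+-assoc (- q) q (- (q * Q))) ⟨
      1# + ((- q + q) + - (q * Q))              ≈⟨ +-congˡ {1#} (+-congʳ { - (q * Q)} { - q + q} (-‿inverseˡ q)) ⟩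
      1# + (0# + - (q * Q))                     ≈⟨ +-congˡ {1#} (+-identityˡ (- (q * Q))) ⟩
      1# + - (q * Q)                            ∎)
      where open RingProperties ring using (-‿distribʳ-*)

  inv-⟦⟧ : ∀ n → inv ⟦ suc n ⟧ * ⟦ suc n ⟧ ≈ 1#
  inv-⟦⟧ n = inv-inverse ⟦ suc n ⟧ (K.trans (⟦⟧-suc n 0)
    (K.trans (K.+-congˡ (q-zero ⟦ n ⟧)) (K.+-identityʳ K.1#)))

module SeriesMap (K L : CommutativeRing 0ℓ 0ℓ) {h : CommutativeRing.Carrier K → CommutativeRing.Carrier L}
                 (h-hom : IsHom K L h) where

  private
    module PK = PowerSeriesProperties K
    module PL = PowerSeriesProperties L
    module K  = CommutativeRing K
    module L  = CommutativeRing L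
    module KP = PowerSeries K
    module LP = PowerSeries L
    module h  = IsHom {K} {L} h-hom
    module LS = SemiringSum L.semiring
  open CommutativeRing PL.commutativeRing

  map-hom : IsHom PK.commutativeRing PL.commutativeRing (h ∘_)
  map-hom = mkHom PK.commutativeRing PL.commutativeRing
    (λ e n → h.⟦⟧-cong (e n))
    (λ a b n → h.+-homo (a n) (b n))
    (λ a b n → L.trans (h.sum-homo (suc n) (λ i → a (toℕ i) K.* b (n ∸ toℕ i)))
      (LS.sum-cong-≋ {suc n} λ i → h.*-homo (a (toℕ i)) (b (n ∸ toℕ i))))
    (λ { zero → h.1#-homo ; (suc n) → h.0#-homo })

  map-q : h ∘ KP.q ≈ LP.q
  map-q zero          = h.0#-homo
  map-q (suc zero)    = h.1#-homo
  map-q (suc (suc _)) = h.0#-homo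

  map-const : ∀ c → h ∘ KP.const c ≈ LP.const (h c)
  map-const c zero    = L.refl
  map-const c (suc n) = h.0#-homo

  map-Σq : ∀ s → h ∘ PK.Σq s ≈ PL.Σq (λ m → h ∘ s m)
  map-Σq s n = h.sum-homo (suc n) (λ i → s (toℕ i) (n ∸ toℕ i))

-- Newton series in the points -[N]

module PartialSums (R : CommutativeRing 0ℓ 0ℓ) where

  open CommutativeRing R
  open CommutativeSemigroupProperties +-commutativeSemigroup using (interchange)

  ∑< : ℕ → (ℕ → Carrier) → Carrier
  ∑< zero    a = 0#
  ∑< (suc M) a = ∑< M a + a M

  ∑<-cong : ∀ M {a b : ℕ → Carrier} → (∀ m → a m ≈ b m) → ∑< M a ≈ ∑< M b
  ∑<-cong zero    e = refl
  ∑<-cong (suc M) e = +-cong (∑<-cong M e) (e M)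

  ∑<-+ : ∀ M (a b : ℕ → Carrier) → ∑< M (λ m → a m + b m) ≈ ∑< M a + ∑< M b
  ∑<-+ zero    a b = sym (+-identityˡ _)
  ∑<-+ (suc M) a b = trans (+-congʳ (∑<-+ M a b)) (interchange _ _ _ _)

  ∑<-* : ∀ M c (a : ℕ → Carrier) → ∑< M (λ m → c * a m) ≈ c * ∑< M a
  ∑<-* zero    c a = sym (zeroʳ c)
  ∑<-* (suc M) c a = trans (+-congʳ (∑<-* M c a)) (sym (distribˡ _ _ _))

  ∑<-front : ∀ M (a : ℕ → Carrier) → ∑< (suc M) a ≈ a 0 + ∑< M (λ m → a (suc m))
  ∑<-front zero    a = +-comm _ _
  ∑<-front (suc M) a = trans (+-congʳ (∑<-front M a)) (+-assoc _ _ _)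

-- r j stands for 1/[j].
module NewtonBasis (R : CommutativeRing 0ℓ 0ℓ) (r : ℕ → CommutativeRing.Carrier R) where

  open CommutativeRing R
  open NaturalCoefficientsSolver commutativeSemiring using (solve; _:+_; _:*_; _:=_; con)
  open PartialSums R

  ∏ : Carrier → ℕ → Carrier
  ∏ X zero    = 1#
  ∏ X (suc m) = ∏ X m * (1# + X * r (suc m))

  B : Carrier → ℕ → Carrier
  B X zero    = 1#
  B X (suc m) = X * r (suc m) * ∏ X m

  -- The sum telescopes, B_(m+1) being the difference of consecutive products. Hence B_(m+1) is X
  -- r_(m+1) times the sum of all earlier B_j, a recursion that later identifies the coefficients in
  -- X.
  ∑<-B : ∀ X m → ∑< (suc m) (B X) ≈ ∏ X m
  ∑<-B X zero    = +-identityˡ 1#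
  ∑<-B X (suc m) = trans (+-congʳ (∑<-B X m))
    (solve 3 (λ p x r → p :+ x :* r :* p := p :* (con 1 :+ x :* r)) refl (∏ X m) X (r (suc m)))

module _ {R S : CommutativeRing 0ℓ 0ℓ} {h : CommutativeRing.Carrier R → CommutativeRing.Carrier S} (h-hom : IsHom R S h)
         {r : ℕ → CommutativeRing.Carrier R} {r′ : ℕ → CommutativeRing.Carrier S}
         (hr : ∀ m → CommutativeRing._≈_ S (h (r m)) (r′ m)) where

  private
    module S  = CommutativeRing S
    module BR = NewtonBasis R r
    module BS = NewtonBasis S r′
    module h  = IsHom {R} {S} h-hom

  ∏-homo : ∀ {X X′} → h X S.≈ X′ → ∀ m → h (BR.∏ X m) S.≈ BS.∏ X′ m
  ∏-homo e zero    = h.1#-homo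
  ∏-homo e (suc m) = S.trans (h.*-homo _ _) (S.*-cong (∏-homo e m) (S.trans (h.+-homo _ _)
    (S.+-cong h.1#-homo (S.trans (h.*-homo _ _) (S.*-cong e (hr (suc m)))))))

  B-homo : ∀ {X X′} → h X S.≈ X′ → ∀ m → h (BR.B X m) S.≈ BS.B X′ m
  B-homo e zero    = h.1#-homo
  B-homo e (suc m) = S.trans (h.*-homo _ _) (S.*-cong (S.trans (h.*-homo _ _) (S.*-cong e (hr (suc m)))) (∏-homo e m))

-- r 0 is irrelevant.
record QNumbers (R : CommutativeRing 0ℓ 0ℓ) (q : CommutativeRing.Carrier R) : Set where
  open CommutativeRing R
  field
    ⟦_⟧ r     : ℕ → Carrier
    ⟦⟧-zero   : ⟦ 0 ⟧ ≈ 0#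
    ⟦⟧-suc    : ∀ n → ⟦ suc n ⟧ ≈ 1# + q * ⟦ n ⟧
    r-inverse : ∀ n → r (suc n) * ⟦ suc n ⟧ ≈ 1#

module NewtonSeries (R : CommutativeRing 0ℓ 0ℓ) (q : CommutativeRing.Carrier R) (numbers : QNumbers R q) where

  open CommutativeRing R
  open QNumbers numbers
  open SetoidReasoning setoid
  open SemiringExp semiring using (_^_)
  open RingProperties ring using (+-cancelʳ; -‿distribˡ-*; -‿distribʳ-*; -0#≈0#)
  open NaturalCoefficientsSolver commutativeSemiring using (solve; _:+_; _:*_; _:=_; con)
  open PartialSums R public
  open NewtonBasis R r public

  -⟦_⟧ : ℕ → Carrier
  -⟦ N ⟧ = - ⟦ N ⟧

  -- Since [j] - [N] = -q^j [N-j], for N ≥ 1 this is (-1)^m q^(m(m+1)/2) times the q-binomial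
  -- coefficient of N - 1 over m.
  P : ℕ → ℕ → Carrier
  P N = ∏ -⟦ N ⟧

  -⟦⟧-suc : ∀ N → 1# + -⟦ suc N ⟧ ≈ q * -⟦ N ⟧
  -⟦⟧-suc N = begin
    1# + - ⟦ suc N ⟧                 ≈⟨ +-congˡ (-‿cong (⟦⟧-suc N)) ⟩
    1# + - (1# + q * ⟦ N ⟧)          ≈⟨ +-congˡ (sym (-‿+-comm 1# (q * ⟦ N ⟧))) ⟩
    1# + (- 1# + - (q * ⟦ N ⟧))      ≈⟨ +-assoc _ _ _ ⟨
    (1# + - 1#) + - (q * ⟦ N ⟧)      ≈⟨ +-congʳ (-‿inverseʳ 1#) ⟩
    0# + - (q * ⟦ N ⟧)               ≈⟨ +-identityˡ _ ⟩
    - (q * ⟦ N ⟧)                    ≈⟨ -‿distribʳ-* q ⟦ N ⟧ ⟩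
    q * - ⟦ N ⟧                      ∎
    where open RingProperties ring using (-‿+-comm)

  q^+⟦⟧ : ∀ N → q ^ N + ⟦ N ⟧ ≈ 1# + q * ⟦ N ⟧
  q^+⟦⟧ zero    = +-congˡ (trans ⟦⟧-zero (trans (sym (zeroʳ q)) (*-congˡ (sym ⟦⟧-zero))))
  q^+⟦⟧ (suc N) = begin
    q * q ^ N + ⟦ suc N ⟧              ≈⟨ +-congˡ (⟦⟧-suc N) ⟩
    q * q ^ N + (1# + q * ⟦ N ⟧)       ≈⟨ solve 3 (λ q p n → q :* p :+ (con 1 :+ q :* n) := con 1 :+ q :* (p :+ n)) refl q (q ^ N) ⟦ N ⟧ ⟩
    1# + q * (q ^ N + ⟦ N ⟧)           ≈⟨ +-congˡ (*-congˡ (trans (q^+⟦⟧ N) (sym (⟦⟧-suc N)))) ⟩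
    1# + q * ⟦ suc N ⟧                 ∎

  q^+q-⟦⟧ : ∀ N → q ^ N + q * -⟦ N ⟧ ≈ 1# + -⟦ N ⟧
  q^+q-⟦⟧ N = +-cancelʳ (q * ⟦ N ⟧ + ⟦ N ⟧) _ _ (begin
    (q ^ N + q * x) + (q * n + n)   ≈⟨ solve 4 (λ q p x n → (p :+ q :* x) :+ (q :* n :+ n) := (p :+ n) :+ q :* (x :+ n)) refl q (q ^ N) x n ⟩
    (q ^ N + n) + q * (x + n)       ≈⟨ +-cong (q^+⟦⟧ N) (trans (*-congˡ (-‿inverseˡ n)) (zeroʳ q)) ⟩
    (1# + q * n) + 0#               ≈⟨ +-congˡ (-‿inverseˡ n) ⟨
    (1# + q * n) + (x + n)          ≈⟨ solve 3 (λ q x n → (con 1 :+ q :* n) :+ (x :+ n) := (con 1 :+ x) :+ (q :* n :+ n)) refl q x n ⟩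
    (1# + x) + (q * n + n)          ∎)
    where
    n x : Carrier
    n = ⟦ N ⟧
    x = -⟦ N ⟧

  q^≈1+[1-q]-⟦⟧ : ∀ N → q ^ N ≈ 1# + (1# + - q) * -⟦ N ⟧
  q^≈1+[1-q]-⟦⟧ N = +-cancelʳ (q * x) _ _ (begin
    q ^ N + q * x                       ≈⟨ q^+q-⟦⟧ N ⟩
    1# + x                              ≈⟨ +-identityʳ _ ⟨
    (1# + x) + 0#                       ≈⟨ +-congˡ (trans (*-congʳ (-‿inverseˡ q)) (zeroˡ x)) ⟨
    (1# + x) + (- q + q) * x            ≈⟨ solve 3 (λ x n q → (con 1 :+ x) :+ (n :+ q) :* x := (con 1 :+ (con 1 :+ n) :* x) :+ q :* x) refl x (- q) q ⟩
    (1# + (1# + - q) * x) + q * x       ∎)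
    where
    x : Carrier
    x = -⟦ N ⟧

  r-one : r 1 ≈ 1#
  r-one = begin
    r 1             ≈⟨ *-identityʳ _ ⟨
    r 1 * 1#        ≈⟨ *-congˡ (trans (⟦⟧-suc 0) (trans (+-congˡ (trans (*-congˡ ⟦⟧-zero) (zeroʳ q))) (+-identityʳ 1#))) ⟨
    r 1 * ⟦ 1 ⟧     ≈⟨ r-inverse 0 ⟩
    1#              ∎

  -- Factors at the two points correspond through [m+2] - [N+1] = q ([m+1] - [N]). So q^m B_m at
  -- -[N] is a product at the next point -[N+1]; this is the origin of `suc N` in the definition of
  -- `T`.
  P-suc-suc : ∀ N m → P (suc N) (suc m) ≈ q ^ suc m * B -⟦ N ⟧ (suc m)
  P-suc-suc N zero = begin
    1# * (1# + -⟦ suc N ⟧ * r 1)        ≈⟨ *-congˡ (+-congˡ (trans (*-congˡ r-one) (*-identityʳ _))) ⟩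
    1# * (1# + -⟦ suc N ⟧)              ≈⟨ *-congˡ (-⟦⟧-suc N) ⟩
    1# * (q * -⟦ N ⟧)                   ≈⟨ solve 2 (λ q x → con 1 :* (q :* x) := q :* con 1 :* (x :* con 1 :* con 1)) refl q -⟦ N ⟧ ⟩
    q * 1# * (-⟦ N ⟧ * 1# * 1#)         ≈⟨ *-congˡ (*-congʳ (*-congˡ r-one)) ⟨
    q * 1# * (-⟦ N ⟧ * r 1 * 1#)        ∎
  P-suc-suc N (suc m) = begin
    P (suc N) (suc m) * (1# + x′ * s)             ≈⟨ *-congʳ (P-suc-suc N m) ⟩
    q ^ suc m * (x * r₁ * p) * (1# + x′ * s)      ≈⟨ solve 6 (λ Q x r p x′ s → Q :* (x :* r :* p) :* (con 1 :+ x′ :* s) := Q :* x :* p :* (r :+ r :* x′ :* s)) refl (q ^ suc m) x r₁ p x′ s ⟩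
    q ^ suc m * x * p * (r₁ + r₁ * x′ * s)        ≈⟨ *-congˡ key ⟩
    q ^ suc m * x * p * (q * s * (1# + x * r₁))   ≈⟨ solve 6 (λ Q x r p q s → Q :* x :* p :* (q :* s :* (con 1 :+ x :* r)) := q :* Q :* (x :* s :* (p :* (con 1 :+ x :* r)))) refl (q ^ suc m) x r₁ p q s ⟩
    q ^ suc (suc m) * (x * s * (p * (1# + x * r₁))) ∎
    where
    x x′ r₁ s p k : Carrier
    x  = -⟦ N ⟧
    x′ = -⟦ suc N ⟧
    r₁ = r (suc m)
    s  = r (suc (suc m))
    p  = P N m
    k  = ⟦ suc m ⟧
    key : r₁ + r₁ * x′ * s ≈ q * s * (1# + x * r₁)
    key = begin
      r₁ + r₁ * x′ * s                         ≈⟨ +-congʳ (*-identityʳ r₁) ⟨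
      r₁ * 1# + r₁ * x′ * s                    ≈⟨ +-congʳ (*-congˡ (trans (sym (r-inverse (suc m))) (*-congˡ (⟦⟧-suc (suc m))))) ⟩
      r₁ * (s * (1# + q * k)) + r₁ * x′ * s    ≈⟨ solve 5 (λ r s q k x′ → r :* (s :* (con 1 :+ q :* k)) :+ r :* x′ :* s := q :* s :* (r :* k) :+ r :* s :* (con 1 :+ x′)) refl r₁ s q k x′ ⟩
      q * s * (r₁ * k) + r₁ * s * (1# + x′)    ≈⟨ +-cong (*-congˡ (r-inverse m)) (*-congˡ (-⟦⟧-suc N)) ⟩
      q * s * 1# + r₁ * s * (q * x)            ≈⟨ solve 4 (λ q s r x → q :* s :* con 1 :+ r :* s :* (q :* x) := q :* s :* (con 1 :+ x :* r)) refl q s r₁ x ⟩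
      q * s * (1# + x * r₁)                    ∎

  P-suc : ∀ N m → P (suc N) m ≈ q ^ m * B -⟦ N ⟧ m
  P-suc N zero    = sym (*-identityʳ 1#)
  P-suc N (suc m) = P-suc-suc N m

  -- The q-Pascal rule for signed q-binomial coefficients; it comes down to (1 - q^(m+1)) [N] = (1 -
  -- q^N) [m+1].
  P-difference : ∀ N m → P (suc N) (suc m) + q ^ N * P N m ≈ P N (suc m)
  P-difference N m = trans (+-congʳ (P-suc-suc N m)) (begin
    Q * (x * r₁ * p) + q ^ N * p    ≈⟨ solve 5 (λ Q x r p q → Q :* (x :* r :* p) :+ q :* p := p :* (Q :* (x :* r) :+ q)) refl Q x r₁ p (q ^ N) ⟩
    p * (Q * (x * r₁) + q ^ N)      ≈⟨ *-congˡ (+-cancelʳ (x + q * x) _ _ key) ⟩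
    p * (1# + x * r₁)               ∎)
    where
    x r₁ p Q k : Carrier
    x  = -⟦ N ⟧
    r₁ = r (suc m)
    p  = P N m
    Q  = q ^ suc m
    k  = ⟦ suc m ⟧
    absorb : ∀ y → y * (x * (r₁ * k)) ≈ y * x
    absorb y = *-congˡ (trans (*-congˡ (r-inverse m)) (*-identityʳ x))
    -- The common summand x + q x completes q^(m+1) to q^(m+1) + [m+1] and q^N to q^N + q x, to
    -- which `q^+⟦⟧` and `q^+q-⟦⟧` apply.
    key : (Q * (x * r₁) + q ^ N) + (x + q * x) ≈ (1# + x * r₁) + (x + q * x)
    key = begin
      (Q * (x * r₁) + q ^ N) + (x + q * x)                    ≈⟨ +-congˡ (+-congʳ (trans (absorb 1#) (*-identityˡ x))) ⟨
      (Q * (x * r₁) + q ^ N) + (1# * (x * (r₁ * k)) + q * x)  ≈⟨ solve 6 (λ Q x r q′ k q → (Q :* (x :* r) :+ q′) :+ (con 1 :* (x :* (r :* k)) :+ q :* x) := (Q :+ k) :* (x :* r) :+ (q′ :+ q :* x)) refl Q x r₁ (q ^ N) k q ⟩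
      (Q + k) * (x * r₁) + (q ^ N + q * x)                    ≈⟨ +-cong (*-congʳ (q^+⟦⟧ (suc m))) (q^+q-⟦⟧ N) ⟩
      (1# + q * k) * (x * r₁) + (1# + x)                      ≈⟨ solve 4 (λ q k x r → (con 1 :+ q :* k) :* (x :* r) :+ (con 1 :+ x) := (con 1 :+ x :* r) :+ (x :+ q :* (x :* (r :* k)))) refl q k x r₁ ⟩
      (1# + x * r₁) + (x + q * (x * (r₁ * k)))                ≈⟨ +-congˡ (+-congˡ (absorb q)) ⟩
      (1# + x * r₁) + (x + q * x)                             ∎

  r-cancel : ∀ N {a b} → a + -⟦ suc N ⟧ * b ≈ 0# → b ≈ r (suc N) * a
  r-cancel N {a} {b} e = begin
    b                                     ≈⟨ *-identityˡ b ⟨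
    1# * b                                ≈⟨ *-congʳ (r-inverse N) ⟨
    r (suc N) * n * b                     ≈⟨ *-assoc _ _ _ ⟩
    r (suc N) * (n * b)                   ≈⟨ *-congˡ (+-cancelʳ (-⟦ suc N ⟧ * b) _ _ (begin
      n * b + -⟦ suc N ⟧ * b                ≈⟨ distribʳ b n -⟦ suc N ⟧ ⟨
      (n + -⟦ suc N ⟧) * b                  ≈⟨ trans (*-congʳ (-‿inverseʳ n)) (zeroˡ b) ⟩
      0#                                    ≈⟨ e ⟨
      a + -⟦ suc N ⟧ * b                    ∎)) ⟩
    r (suc N) * a                         ∎
    where
    n : Carrier
    n = ⟦ suc N ⟧

  -- The factor with j = N + 1 is 1 - [N+1]/[N+1], and it persists in every longer product.
  P-vanish : ∀ N k → P (suc N) (k ℕ.+ suc N) ≈ 0#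
  P-vanish N zero    = trans (*-congˡ (begin
    1# + - ⟦ suc N ⟧ * r (suc N)        ≈⟨ +-congˡ (-‿distribˡ-* _ _) ⟨
    1# + - (⟦ suc N ⟧ * r (suc N))      ≈⟨ +-congˡ (-‿cong (trans (*-comm _ _) (r-inverse N))) ⟩
    1# + - 1#                           ≈⟨ -‿inverseʳ 1# ⟩
    0#                                  ∎)) (zeroʳ _)
  P-vanish N (suc k) = trans (*-congʳ (P-vanish N k)) (zeroˡ _)

  B-vanish : ∀ N k → B -⟦ N ⟧ (k ℕ.+ suc N) ≈ 0#
  B-vanish zero    k rewrite ℕ.+-suc k 0 = trans (*-congʳ (trans (*-congʳ (trans (-‿cong ⟦⟧-zero) -0#≈0#)) (zeroˡ _))) (zeroˡ _)
  B-vanish (suc N) k rewrite ℕ.+-suc k (suc N) = trans (*-congˡ (P-vanish N k)) (zeroʳ _)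

  -- The value of Σ aₘ qᵐ Bₘ at -[N].
  T : (ℕ → Carrier) → ℕ → Carrier
  T a N = ∑< (suc N) (λ m → P (suc N) m * a m)

  T-extend : ∀ a N k → ∑< (k ℕ.+ suc N) (λ m → P (suc N) m * a m) ≈ T a N
  T-extend a N zero    = refl
  T-extend a N (suc k) = trans (+-cong (T-extend a N k) (trans (*-congʳ (P-vanish N k)) (zeroˡ _))) (+-identityʳ _)

  T-zero : ∀ a → T a 0 ≈ a 0
  T-zero a = trans (+-identityˡ _) (*-identityˡ _)

  -- The q-Pascal rule, term by term. The sum for N is lengthened by its vanishing term m = N + 1,
  -- and the shift of m in the rule produces the values a (m + 1).
  T-difference : ∀ a N → T a (suc N) + q ^ suc N * ∑< (suc N) (λ m → P (suc N) m * a (suc m)) ≈ T a N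
  T-difference a N = begin
    ∑< (suc (suc N)) (λ m → P (suc (suc N)) m * a m) + c * ∑< (suc N) (λ m → P (suc N) m * a (suc m))
      ≈⟨ +-cong (∑<-front (suc N) _) (sym (∑<-* (suc N) c _)) ⟩
    (1# * a 0 + ∑< (suc N) (λ m → P (suc (suc N)) (suc m) * a (suc m))) + ∑< (suc N) (λ m → c * (P (suc N) m * a (suc m)))
      ≈⟨ trans (+-assoc _ _ _) (+-congˡ (sym (∑<-+ (suc N) _ _))) ⟩
    1# * a 0 + ∑< (suc N) (λ m → P (suc (suc N)) (suc m) * a (suc m) + c * (P (suc N) m * a (suc m)))
      ≈⟨ +-congˡ (∑<-cong (suc N) (λ m → trans
           (solve 4 (λ p c p′ a → p :* a :+ c :* (p′ :* a) := (p :+ c :* p′) :* a) refl (P (suc (suc N)) (suc m)) c (P (suc N) m) (a (suc m)))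
           (*-congʳ (P-difference (suc N) m)))) ⟩
    1# * a 0 + ∑< (suc N) (λ m → P (suc N) (suc m) * a (suc m))
      ≈⟨ ∑<-front (suc N) _ ⟨
    ∑< (suc (suc N)) (λ m → P (suc N) m * a m)
      ≈⟨ T-extend a N 1 ⟩
    T a N ∎
    where
    c : Carrier
    c = q ^ suc N

  -- The actions of the letters on terms: prefixing x multiplies the term with largest index m by
  -- q^m/[m]; prefixing y makes m a new largest index, with factor 1/[m].
  X· Y· : (ℕ → Carrier) → ℕ → Carrier
  X· a m = q ^ m * r m * a m
  Y· a m = r m * ∑< m a

  -- The terms of yⁱ. The empty word has its only term at m = 0, so that sums over smaller indices
  -- start correctly.
  Yδ : ℕ → ℕ → Carrier
  Yδ zero    zero    = 1#
  Yδ zero    (suc m) = 0#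
  Yδ (suc i) m       = Y· (Yδ i) m

  T-δ : ∀ N → T (Yδ 0) N ≈ 1#
  T-δ zero    = trans (+-identityˡ _) (*-identityˡ 1#)
  T-δ (suc N) = trans (+-cong (trans (T-extend-one N) (T-δ N)) (zeroʳ _)) (+-identityʳ 1#)
    where
    T-extend-one : ∀ N → ∑< (suc N) (λ m → P (suc (suc N)) m * Yδ 0 m) ≈ T (Yδ 0) N
    T-extend-one N = trans (∑<-front N _) (trans (+-congˡ (∑<-cong N (λ m → trans (zeroʳ _) (sym (zeroʳ _)))))
      (sym (∑<-front N _)))

  T-cong : ∀ {a b : ℕ → Carrier} → (∀ m → a m ≈ b m) → ∀ N → T a N ≈ T b N
  T-cong e N = ∑<-cong (suc N) (λ m → *-congˡ (e m))

  T-+ : ∀ (a b : ℕ → Carrier) N → T (λ m → a m + b m) N ≈ T a N + T b N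
  T-+ a b N = trans (∑<-cong (suc N) (λ m → distribˡ _ (a m) (b m))) (∑<-+ (suc N) _ _)

  T-* : ∀ c (a : ℕ → Carrier) N → T (λ m → c * a m) N ≈ c * T a N
  T-* c a N = trans (∑<-cong (suc N) (λ m → x∙yz≈y∙xz _ c (a m))) (∑<-* (suc N) c _)
    where open CommutativeSemigroupProperties *-commutativeSemigroup using (x∙yz≈y∙xz)

  -- The extra sum of `T-difference` is evaluated by summation by parts; the boundary term contains
  -- the product with the zero factor j = N + 1.
  T-Y : ∀ a N → T (Y· a) (suc N) + q ^ suc N * r (suc N) * T a N ≈ T (Y· a) N
  T-Y a N = trans (+-congˡ (trans (*-assoc _ _ _) (*-congˡ (sym (r-cancel N (trans (by-parts (suc N))
      (trans (*-congʳ (P-vanish N 0)) (zeroˡ _)))))))) (T-difference (Y· a) N)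
    where
    x : Carrier
    x = -⟦ suc N ⟧
    -- Abel summation: the difference of consecutive products is x P_m / [m+1], and that of the
    -- partial sums of a is a_m.
    by-parts : ∀ M → ∑< M (λ m → P (suc N) m * a m) + x * ∑< M (λ m → P (suc N) m * Y· a (suc m)) ≈ P (suc N) M * ∑< M a
    by-parts zero    = trans (+-identityˡ _) (trans (zeroʳ x) (sym (zeroʳ _)))
    by-parts (suc M) = begin
      (A + p * a M) + x * (C + p * (r (suc M) * (D + a M)))
        ≈⟨ solve 7 (λ A p a x C r D → (A :+ p :* a) :+ x :* (C :+ p :* (r :* (D :+ a))) := (A :+ x :* C) :+ (p :* a :+ x :* p :* r :* (D :+ a))) refl A p (a M) x C (r (suc M)) D ⟩
      (A + x * C) + (p * a M + x * p * r (suc M) * (D + a M))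
        ≈⟨ +-congʳ (by-parts M) ⟩
      p * D + (p * a M + x * p * r (suc M) * (D + a M))
        ≈⟨ solve 5 (λ p a x r D → p :* D :+ (p :* a :+ x :* p :* r :* (D :+ a)) := p :* (con 1 :+ x :* r) :* (D :+ a)) refl p (a M) x (r (suc M)) D ⟩
      p * (1# + x * r (suc M)) * (D + a M) ∎
      where
      A p C D : Carrier
      A = ∑< M (λ m → P (suc N) m * a m)
      p = P (suc N) M
      C = ∑< M (λ m → P (suc N) m * Y· a (suc m))
      D = ∑< M a

  -- By `P-suc-suc` the extra sum of `T-difference`, multiplied by -[N+1], is the value of a itself
  -- at -[N+1]. That identity covers the indices m ≥ 1, whence the condition on a 0.
  T-X : ∀ a N → a 0 ≈ 0# → T (X· a) (suc N) ≈ T (X· a) N + q ^ suc N * r (suc N) * T a (suc N)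
  T-X a N a₀ = begin
    T (X· a) (suc N)
      ≈⟨ trans (sym (+-identityʳ _)) (+-congˡ (sym (trans (sym (distribˡ c W (- W))) (trans (*-congˡ (-‿inverseʳ W)) (zeroʳ c))))) ⟩
    T (X· a) (suc N) + (c * W + c * - W)
      ≈⟨ trans (sym (+-assoc _ _ _)) (+-cong (T-difference (X· a) N) (trans (*-congˡ (r-cancel N eq)) (sym (*-assoc _ _ _)))) ⟩
    T (X· a) N + c * r (suc N) * T a (suc N) ∎
    where
    c W x : Carrier
    c = q ^ suc N
    W = ∑< (suc N) (λ m → P (suc N) m * X· a (suc m))
    x = -⟦ suc N ⟧
    value : T a (suc N) ≈ x * W
    value = begin
      T a (suc N)
        ≈⟨ ∑<-front (suc N) _ ⟩
      1# * a 0 + ∑< (suc N) (λ m → P (suc (suc N)) (suc m) * a (suc m))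
        ≈⟨ trans (+-congʳ (trans (*-identityˡ _) a₀)) (+-identityˡ _) ⟩
      ∑< (suc N) (λ m → P (suc (suc N)) (suc m) * a (suc m))
        ≈⟨ ∑<-cong (suc N) (λ m → trans (*-congʳ (P-suc-suc (suc N) m))
             (solve 5 (λ Q x r p a → Q :* (x :* r :* p) :* a := x :* (p :* (Q :* r :* a))) refl (q ^ suc m) x (r (suc m)) (P (suc N) m) (a (suc m)))) ⟩
      ∑< (suc N) (λ m → x * (P (suc N) m * X· a (suc m)))
        ≈⟨ ∑<-* (suc N) x _ ⟩
      x * W ∎
    eq : T a (suc N) + x * - W ≈ 0#
    eq = begin
      T a (suc N) + x * - W   ≈⟨ +-congʳ value ⟩
      x * W + x * - W         ≈⟨ distribˡ x W (- W) ⟨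
      x * (W + - W)           ≈⟨ trans (*-congˡ (-‿inverseʳ W)) (zeroʳ x) ⟩
      0#                      ∎

-- Substitution for U in A[U]⟦q⟧

module SeriesSubstitution (A L : CommutativeRing 0ℓ 0ℓ)
                          {κ : CommutativeRing.Carrier A → CommutativeRing.Carrier (series L)}
                          (κ-hom : IsHom A (series L) κ) (u : CommutativeRing.Carrier (series L)) where

  private
    module PL = PowerSeriesProperties L
  open CommutativeRing (series L)
  open SemiringExp semiring using (_^_)
  open SetoidReasoning setoid
  private
    A[U] : CommutativeRing 0ℓ 0ℓ
    A[U] = polynomials A
    module A  = CommutativeRing A
    module PE = PowerSeriesProperties A[U]
    module P² = PowerSeriesProperties PL.commutativeRing
    module E  = CommutativeRing PE.commutativeRing
    module A[U]⟦q⟧ = PowerSeries A[U]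
    module L⟦q⟧ = PowerSeries L
    module L⟦q⟧⟦Q⟧ = PowerSeries PL.commutativeRing
    module κ = IsHom {A} {PL.commutativeRing} κ-hom

  open Semilinear A PL.commutativeRing {κ} κ-hom using (eval; polynomial-hom)

  θ : CommutativeRing.Carrier A[U] → Carrier
  θ = eval (u ^_)

  θ-hom : IsHom A[U] PL.commutativeRing θ
  θ-hom = polynomial-hom u

  private
    module Mθ = SeriesMap A[U] PL.commutativeRing {θ} θ-hom

  -- The completion of θ : A[U] → L⟦q⟧, U ↦ u.
  subst : E.Carrier → Carrier
  subst D = PL.Σq (θ ∘ D)

  subst-hom : IsHom PE.commutativeRing PL.commutativeRing subst
  subst-hom = ∘-hom {PE.commutativeRing} {P².commutativeRing} {PL.commutativeRing} PL.Σq-hom Mθ.map-hom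

  module subst = IsHom {PE.commutativeRing} {PL.commutativeRing} subst-hom

  private
    Σq-Q : PL.Σq L⟦q⟧⟦Q⟧.q ≈ L⟦q⟧.q
    Σq-Q = begin
      PL.Σq L⟦q⟧⟦Q⟧.q                          ≈⟨ PL.Σq-unfold L⟦q⟧⟦Q⟧.q ⟩
      0# + L⟦q⟧.q * PL.Σq (L⟦q⟧⟦Q⟧.q ∘ suc)    ≈⟨ +-identityˡ (L⟦q⟧.q * PL.Σq (L⟦q⟧⟦Q⟧.q ∘ suc)) ⟩
      L⟦q⟧.q * PL.Σq (L⟦q⟧⟦Q⟧.q ∘ suc)         ≈⟨ *-congˡ {L⟦q⟧.q} (PL.Σq-cong {L⟦q⟧⟦Q⟧.q ∘ suc} {L⟦q⟧⟦Q⟧.const 1#}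
                                                    (λ { zero → refl {1#} ; (suc _) → refl {0#} })) ⟩
      L⟦q⟧.q * PL.Σq (L⟦q⟧⟦Q⟧.const 1#)        ≈⟨ *-congˡ {L⟦q⟧.q} (PL.Σq-const 1#) ⟩
      L⟦q⟧.q * 1#                              ≈⟨ *-identityʳ L⟦q⟧.q ⟩
      L⟦q⟧.q                                   ∎

    module P²R = CommutativeRing P².commutativeRing

    -- The substitution Q = q commutes with infinite sums in Q; both sides satisfy the same
    -- recursion.
    Σq-Σq : ∀ s → PL.Σq (P².Σq s) ≈ PL.Σq (PL.Σq ∘ s)
    Σq-Σq = PL.q-unique (PL.Σq ∘ P².Σq) (λ s → PL.Σq (PL.Σq ∘ s)) (λ s → PL.Σq (s 0)) (_∘ suc)
      (λ s → begin
        PL.Σq (P².Σq s)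
          ≈⟨ PL.Σq-cong {P².Σq s} {s 0 P²R.+ L⟦q⟧⟦Q⟧.q P²R.* P².Σq (s ∘ suc)} (P².Σq-unfold s) ⟩
        PL.Σq (s 0 P²R.+ L⟦q⟧⟦Q⟧.q P²R.* P².Σq (s ∘ suc))
          ≈⟨ PL.Σq-+ (s 0) (L⟦q⟧⟦Q⟧.q P²R.* P².Σq (s ∘ suc)) ⟩
        PL.Σq (s 0) + PL.Σq (L⟦q⟧⟦Q⟧.q P²R.* P².Σq (s ∘ suc))
          ≈⟨ +-congˡ {PL.Σq (s 0)} (PL.Σq-* L⟦q⟧⟦Q⟧.q (P².Σq (s ∘ suc))) ⟩
        PL.Σq (s 0) + PL.Σq L⟦q⟧⟦Q⟧.q * PL.Σq (P².Σq (s ∘ suc))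
          ≈⟨ +-congˡ {PL.Σq (s 0)} (*-congʳ {PL.Σq (P².Σq (s ∘ suc))} {PL.Σq L⟦q⟧⟦Q⟧.q} Σq-Q) ⟩
        PL.Σq (s 0) + L⟦q⟧.q * PL.Σq (P².Σq (s ∘ suc)) ∎)
      (λ s → PL.Σq-unfold (PL.Σq ∘ s))

  subst-Σq : ∀ s → subst (PE.Σq s) ≈ PL.Σq (subst ∘ s)
  subst-Σq s = trans {subst (PE.Σq s)} {PL.Σq (P².Σq (λ m → θ ∘ s m))}
    (PL.Σq-cong {θ ∘ PE.Σq s} {P².Σq (λ m → θ ∘ s m)} (Mθ.map-Σq s)) (Σq-Σq (λ m → θ ∘ s m))

  subst-const : ∀ p → subst (A[U]⟦q⟧.const p) ≈ θ p
  subst-const p = trans {subst (A[U]⟦q⟧.const p)} {PL.Σq (L⟦q⟧⟦Q⟧.const (θ p))}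
    (PL.Σq-cong {θ ∘ A[U]⟦q⟧.const p} {L⟦q⟧⟦Q⟧.const (θ p)} (Mθ.map-const p)) (PL.Σq-const (θ p))

  scalar : A.Carrier → CommutativeRing.Carrier A[U]
  scalar c = (c , 0) ∷ []

  subst-scalar : ∀ a → subst (scalar ∘ a) ≈ PL.Σq (κ ∘ a)
  subst-scalar a = PL.Σq-cong {θ ∘ scalar ∘ a} {κ ∘ a}
    (λ n → trans {κ (a n) * 1# + 0#} {κ (a n) * 1#} (+-identityʳ (κ (a n) * 1#)) (*-identityʳ (κ (a n))))

scalar-hom : ∀ (A : CommutativeRing 0ℓ 0ℓ) → IsHom A (polynomials A) (λ c → (c , 0) ∷ [])
scalar-hom A = mkHom A (polynomials A)
  (λ e → mk≋ λ x → A.+-congʳ (A.*-congʳ e))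
  (λ a b → ≋-sym (mk≋ λ x → A.trans (A.+-congˡ (A.+-identityʳ _))
    (A.trans (A.sym (A.distribʳ _ _ _)) (A.sym (A.+-identityʳ _)))))
  (λ a b → mk≋ λ x → A.refl)
  (mk≋ λ x → A.refl)
  where
  module A = CommutativeRing A
  open FreeModule.Equality A ℕ._≟_

Σq-const∘ : ∀ (L : CommutativeRing 0ℓ 0ℓ) a →
            CommutativeRing._≈_ (series L) (PowerSeriesProperties.Σq L (PowerSeries.const L ∘ a)) a
Σq-const∘ L = PL.q-unique (λ a → PL.Σq (L⟦q⟧.const ∘ a)) id (λ a → L⟦q⟧.const (a 0)) (_∘ suc)
  (λ a → PL.Σq-unfold (L⟦q⟧.const ∘ a))
  (λ { a zero → L.sym (L.trans (L.+-congˡ (PL.q-zero (a ∘ suc))) (L.+-identityʳ (a 0)))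
     ; a (suc n) → L.sym (L.trans (L.+-identityˡ _) (PL.q-suc (a ∘ suc) n)) })
  where
  module L = CommutativeRing L
  module L⟦q⟧ = PowerSeries L
  module PL = PowerSeriesProperties L

-- Modulo q^N the value at U = q^N is the part of degree 0 in U. If all values vanish,
-- so does this part, and one can divide by U.
module Determination (A : CommutativeRing 0ℓ 0ℓ) where

  private
    module A  = CommutativeRing A
    module FA = FreeModule A
    module PA = PowerSeriesProperties A
    A[U] : CommutativeRing 0ℓ 0ℓ
    A[U] = polynomials A
    module A[U] = CommutativeRing A[U]
    module PE = PowerSeriesProperties A[U]
    module E  = CommutativeRing PE.commutativeRing
    module A⟦q⟧ = PowerSeries A
  open A⟦q⟧ using (q; const)
  open CommutativeRing PA.commutativeRing
  open SemiringExp semiring using (_^_)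
  open SetoidReasoning setoid
  open FA.Equality ℕ._≟_ using (coeff; δ; mk≋)
  open Semilinear A PA.commutativeRing {const} PA.const-hom
    using (eval; eval-cong; eval-+; eval-*; eval-image; eval-extend; eval-basis)

  module At (u : Carrier) = SeriesSubstitution A A {const} PA.const-hom u

  at : ℕ → E.Carrier → Carrier
  at N = At.subst (q ^ N)

  private
    dropU : ℕ → FA.Lin ℕ
    dropU zero    = []
    dropU (suc a) = FA.basis a

    _/U : A[U].Carrier → A[U].Carrier
    _/U = FA.extend dropU

    coeff-/U : ∀ a p → coeff p (suc a) A.≈ coeff (p /U) a
    coeff-/U a p = A.sym (A.trans (FA.eval-extend (δ a) dropU p)
      (FA.eval-cong (λ { zero → A.refl ; (suc b) → FA.eval-basis (δ a) b }) p))

    θ-split : ∀ u p → At.θ u p ≈ const (coeff p 0) + u * At.θ u (p /U)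
    θ-split u p = sym {const (coeff p 0) + u * At.θ u (p /U)} {At.θ u p} (begin
      const (coeff p 0) + u * eval (u ^_) (p /U)
        ≈⟨ +-cong {const (coeff p 0)} (eval-image (δ 0) p) (*-congˡ {u} (eval-extend (u ^_) dropU p)) ⟩
      eval (const ∘ δ 0) p + u * eval (λ a → eval (u ^_) (dropU a)) p
        ≈⟨ +-congˡ {eval (const ∘ δ 0) p} (eval-* u (λ a → eval (u ^_) (dropU a)) p) ⟨
      eval (const ∘ δ 0) p + eval (λ a → u * eval (u ^_) (dropU a)) p
        ≈⟨ eval-+ (const ∘ δ 0) (λ a → u * eval (u ^_) (dropU a)) p ⟨
      eval (λ a → const (δ 0 a) + u * eval (u ^_) (dropU a)) p
        ≈⟨ eval-cong {f = λ a → const (δ 0 a) + u * eval (u ^_) (dropU a)} {g = u ^_} pointwise p ⟩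
      eval (u ^_) p ∎)
      where
      pointwise : ∀ a → const (δ 0 a) + u * eval (u ^_) (dropU a) ≈ u ^ a
      pointwise zero = trans {1# + u * 0#} (+-congˡ {1#} (zeroʳ u)) (+-identityʳ 1#)
      pointwise (suc a) = trans {const A.0# + u * eval (u ^_) (FA.basis a)} {0# + u * u ^ a}
        (+-cong {const A.0#} {0#} (λ { zero → A.refl ; (suc _) → A.refl }) (*-congˡ {u} (eval-basis (u ^_) a)))
        (+-identityˡ (u * u ^ a))

    at-split : ∀ N D → at N D ≈ (λ n → coeff (D n) 0) + q ^ N * at N (_/U ∘ D)
    at-split N D = begin
      PA.Σq (λ n → At.θ u (D n))
        ≈⟨ PA.Σq-cong {λ n → At.θ u (D n)} {λ n → const (c n) + u * At.θ u (D n /U)} (λ n → θ-split u (D n)) ⟩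
      PA.Σq (λ n → const (c n) + u * At.θ u (D n /U))
        ≈⟨ PA.Σq-+ (const ∘ c) (λ n → u * At.θ u (D n /U)) ⟩
      PA.Σq (const ∘ c) + PA.Σq (λ n → u * At.θ u (D n /U))
        ≈⟨ +-cong {PA.Σq (const ∘ c)} {c} (Σq-const∘ A c) (PA.Σq-scaleˡ u (λ n → At.θ u (D n /U))) ⟩
      c + u * at N (_/U ∘ D) ∎
      where
      u c : Carrier
      u = q ^ N
      c n = coeff (D n) 0

    coeff-vanish : ∀ D → (∀ N → at N D ≈ 0#) → ∀ a n → coeff (D n) a A.≈ A.0#
    -- The choice N = n + 1 removes the part divisible by U from the coefficient of qⁿ.
    coeff-vanish D e zero n = A.sym (A.trans (A.sym (e (suc n) n)) (A.trans (at-split (suc n) D n)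
      (A.trans (A.+-congˡ (PA.q^-zero (suc n) (at (suc n) (_/U ∘ D)) (ℕ.n<1+n n))) (A.+-identityʳ _))))
    coeff-vanish D e (suc a) n = A.trans (coeff-/U a (D n)) (coeff-vanish (_/U ∘ D) e′ a n)
      where
      e′ : ∀ N → at N (_/U ∘ D) ≈ 0#
      e′ N = PA.q^-cancel N (at N (_/U ∘ D)) λ m → A.trans (A.sym (A.+-identityˡ _))
        (A.trans (A.+-congʳ (A.sym (coeff-vanish D e 0 m))) (A.trans (A.sym (at-split N D m)) (e N m)))

  at-injective : ∀ D D′ → (∀ N → at N D ≈ at N D′) → D E.≈ D′
  at-injective D D′ e n = x∙y⁻¹≈ε⇒x≈y (D n) (D′ n) (mk≋ λ a →
    coeff-vanish (D E.+ E.- D′) (λ N → begin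
      at N (D E.+ E.- D′)        ≈⟨ At.subst.+-homo (q ^ N) D (E.- D′) ⟩
      at N D + at N (E.- D′)     ≈⟨ +-cong {at N D} (e N) (At.subst.-‿homo (q ^ N) D′) ⟩
      at N D′ + - at N D′        ≈⟨ -‿inverseʳ (at N D′) ⟩
      0#                         ∎) a n)
    where open RingProperties A[U].ring using (x∙y⁻¹≈ε⇒x≈y)

module _ {R S : CommutativeRing 0ℓ 0ℓ} {h : CommutativeRing.Carrier R → CommutativeRing.Carrier S}
         (h-hom : IsHom R S h) where

  private
    module R = CommutativeRing R
    module h = IsHom {R} {S} h-hom
  open CommutativeRing S
  open SetoidReasoning setoid

  -- Solves U = 1 + c X for X. With c = 1 - q it serves both the evaluation at U = q^N and the
  -- substitution into A⟦X⟧⟦q⟧.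
  affine-inverse : ∀ {U W c X} → h U ≈ 1# + c * X → h W * c ≈ 1# → h ((U R.+ R.- R.1#) R.* W) ≈ X
  affine-inverse {U} {W} {c} {X} hU hW = begin
    h ((U R.+ R.- R.1#) R.* W)           ≈⟨ trans (h.*-homo _ _) (*-congʳ (h.+-homo U (R.- R.1#))) ⟩
    (h U + h (R.- R.1#)) * h W           ≈⟨ *-congʳ (+-cong hU (trans (h.-‿homo R.1#) (-‿cong h.1#-homo))) ⟩
    ((1# + c * X) + - 1#) * h W          ≈⟨ *-congʳ (trans (+-congʳ (+-comm 1# (c * X))) (trans (+-assoc _ _ _) (trans (+-congˡ (-‿inverseʳ 1#)) (+-identityʳ _)))) ⟩
    c * X * h W                          ≈⟨ trans (*-congʳ (*-comm c X)) (*-assoc X c (h W)) ⟩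
    X * (c * h W)                        ≈⟨ *-congˡ (trans (*-comm c (h W)) hW) ⟩
    X * 1#                               ≈⟨ *-identityʳ X ⟩
    X                                    ∎

-- X is the inner variable of A⟦X⟧⟦q⟧.
module InnerCoefficients (A : CommutativeRing 0ℓ 0ℓ) where

  private
    module A  = CommutativeRing A
    module AS = SemiringSum A.semiring
    module PA = PowerSeriesProperties A
    module PF = PowerSeriesProperties PA.commutativeRing
    module F  = CommutativeRing PF.commutativeRing
    module A⟦X⟧ = CommutativeRing PA.commutativeRing
    module A⟦X⟧S = SemiringSum A⟦X⟧.semiring
    module A⟦q⟧ = PowerSeries A
    module A⟦X⟧⟦q⟧ = PowerSeries PA.commutativeRing
  open CommutativeRing PA.commutativeRing
  open PartialSums using (∑<)

  inner : ℕ → F.Carrier → Carrier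
  inner i D n = D n i

  X : F.Carrier
  X = A⟦X⟧⟦q⟧.const A⟦q⟧.q

  sum-at : ∀ n (v : Fin.Fin n → A⟦X⟧.Carrier) i → A⟦X⟧S.sum {n} v i A.≈ AS.sum {n} (λ j → v j i)
  sum-at zero    v i = A.refl
  sum-at (suc n) v i = A.+-congˡ (sum-at n (v ∘ Fin.suc) i)

  inner-Σq : ∀ i s → inner i (PF.Σq s) ≈ PA.Σq (inner i ∘ s)
  inner-Σq i s n = sum-at (suc n) (λ j → s (toℕ j) (n ∸ toℕ j)) i

  inner-scale : ∀ i a D → inner i ((A⟦q⟧.const ∘ a) F.* D) ≈ a * inner i D
  inner-scale i a D n = A.trans (sum-at (suc n) (λ j → A⟦q⟧.const (a (toℕ j)) A⟦X⟧.* D (n ∸ toℕ j)) i)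
    (AS.sum-cong-≋ {suc n} λ j → PA.const-⊗ (a (toℕ j)) (D (n ∸ toℕ j)) i)

  -- The Cauchy products in q and in X are finite sums that may be interchanged.
  inner-* : ∀ i D D′ → inner i (D F.* D′) ≈ A⟦X⟧S.sum {suc i} (λ j → inner (toℕ j) D * inner (i ∸ toℕ j) D′)
  inner-* i D D′ n = A.trans (sum-at (suc n) (λ k → D (toℕ k) A⟦X⟧.* D′ (n ∸ toℕ k)) i)
    (A.trans (AS.∑-comm {suc n} {suc i} (λ k j → D (toℕ k) (toℕ j) A.* D′ (n ∸ toℕ k) (i ∸ toℕ j)))
      (A.sym (sum-at (suc i) (λ j → inner (toℕ j) D * inner (i ∸ toℕ j) D′) n)))

  inner-∑< : ∀ i M s → inner i (∑< PF.commutativeRing M s) ≈ ∑< PA.commutativeRing M (inner i ∘ s)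
  inner-∑< i zero    s n = A.refl
  inner-∑< i (suc M) s n = A.+-congʳ (inner-∑< i M s n)

  inner-X-suc : ∀ i D → inner (suc i) (X F.* D) ≈ inner i D
  inner-X-suc i D n = A.trans (PF.const-⊗ A⟦q⟧.q D n (suc i)) (PA.q-suc (D n) i)

  inner-X-zero : ∀ D → inner 0 (X F.* D) ≈ 0#
  inner-X-zero D n = A.trans (PF.const-⊗ A⟦q⟧.q D n 0) (PA.q-zero (D n))

-- The product formula for coefficients of Newton series

module NewtonProduct (A : CommutativeRing 0ℓ 0ℓ) (numbers : QNumbers (series A) (PowerSeries.q A)) where

  open CommutativeRing (series A)
  open QNumbers numbers
  private
    module PA = PowerSeriesProperties A
    module A⟦q⟧ = PowerSeries A
    A[U] : CommutativeRing 0ℓ 0ℓ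
    A[U] = polynomials A
    module A  = CommutativeRing A
    module FA = FreeModule A
    module PE = PowerSeriesProperties A[U]
    module E  = CommutativeRing PE.commutativeRing
    module PF = PowerSeriesProperties PA.commutativeRing
    module F  = CommutativeRing PF.commutativeRing
    module A[U]⟦q⟧ = PowerSeries A[U]
    module A⟦X⟧⟦q⟧ = PowerSeries PA.commutativeRing
    module RS = SemiringSum semiring
    w : Carrier
    w = A⟦q⟧.inv (1# + - A⟦q⟧.q)
  open SetoidReasoning setoid
  open SemiringExp semiring using (_^_)
  open A⟦q⟧ using (q; const)
  open NewtonSeries PA.commutativeRing q numbers public
  open InnerCoefficients A
  open Determination A

  liftE : Carrier → E.Carrier
  liftE a n = (a n , 0) ∷ []

  liftF : Carrier → F.Carrier
  liftF a = const ∘ a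

  private
    liftF-hom : IsHom PA.commutativeRing PF.commutativeRing liftF
    liftF-hom = SeriesMap.map-hom A PA.commutativeRing {const} PA.const-hom

    U Xᴱ : E.Carrier
    U  = A[U]⟦q⟧.const (FA.basis 1)
    Xᴱ = (U E.+ E.- E.1#) E.* liftE w

    rE : ℕ → E.Carrier
    rE = liftE ∘ r

    rF : ℕ → F.Carrier
    rF = liftF ∘ r

    module BE = NewtonBasis PE.commutativeRing rE
    module BF = NewtonBasis PF.commutativeRing rF

    w-inverse : w * (1# + - q) ≈ 1#
    w-inverse = QIntegers.inv-1-q A

    -- Only the indices m ≤ n reach the coefficient of qⁿ, so it is a polynomial in U although the
    -- degrees of the B_m are unbounded.
    G : (ℕ → Carrier) → E.Carrier
    G a = PE.Σq (λ m → liftE (a m) E.* BE.B Xᴱ m)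

    at-lift : ∀ N a → at N (liftE a) ≈ a
    at-lift N a = trans {at N (liftE a)} {PA.Σq (const ∘ a)} {a} (At.subst-scalar (q ^ N) a) (Σq-const∘ A a)

    at-U : ∀ N → at N U ≈ q ^ N
    at-U N = trans {at N U} (At.subst-const (q ^ N) (FA.basis 1))
      (trans (Semilinear.eval-basis A PA.commutativeRing {const} PA.const-hom ((q ^ N) ^_) 1)
             (*-identityʳ (q ^ N)))

    module at N = IsHom {PE.commutativeRing} {PA.commutativeRing} (At.subst-hom (q ^ N))

    at-X : ∀ N → at N Xᴱ ≈ -⟦ N ⟧
    at-X N = affine-inverse {PE.commutativeRing} {PA.commutativeRing} (At.subst-hom (q ^ N)) {U} {liftE w} {1# + - q} {x}
      (trans {at N U} {q ^ N} {1# + (1# + - q) * x} (at-U N) (q^≈1+[1-q]-⟦⟧ N))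
      (trans {at N (liftE w) * (1# + - q)} {w * (1# + - q)} {1#} (*-congʳ {1# + - q} {at N (liftE w)} {w} (at-lift N w)) w-inverse)
      where
      x : Carrier
      x = -⟦ N ⟧

    B-at : ∀ N m → at N (BE.B Xᴱ m) ≈ B -⟦ N ⟧ m
    B-at N m = B-homo {PE.commutativeRing} {PA.commutativeRing} (At.subst-hom (q ^ N)) {rE} {r}
      (λ m → at-lift N (r m)) {Xᴱ} (at-X N) m

    finite : ∀ M s → (∀ k → s (k ℕ.+ M) ≈ 0#) → PA.Σq s ≈ ∑< M (λ m → q ^ m * s m)
    finite zero    s e = trans {PA.Σq s} {PA.Σq (λ _ → 0#)}
      (PA.Σq-cong {s} (λ m → ≡.subst (λ j → s j ≈ 0#) (ℕ.+-identityʳ m) (e m))) PA.Σq-0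
    finite (suc M) s e = begin
      PA.Σq s
        ≈⟨ PA.Σq-unfold s ⟩
      s 0 + q * PA.Σq (s ∘ suc)
        ≈⟨ +-cong {s 0} (sym {1# * s 0} (*-identityˡ (s 0)))
             (*-congˡ {q} (finite M (s ∘ suc) (λ k → ≡.subst (λ j → s j ≈ 0#) (ℕ.+-suc k M) (e k)))) ⟩
      1# * s 0 + q * ∑< M (λ m → q ^ m * s (suc m))
        ≈⟨ +-congˡ {1# * s 0} (∑<-* M q (λ m → q ^ m * s (suc m))) ⟨
      1# * s 0 + ∑< M (λ m → q * (q ^ m * s (suc m)))
        ≈⟨ +-congˡ {1# * s 0} (∑<-cong M {λ m → q * (q ^ m * s (suc m))} (λ m → sym {q * q ^ m * s (suc m)} (*-assoc q (q ^ m) (s (suc m))))) ⟩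
      1# * s 0 + ∑< M (λ m → q ^ suc m * s (suc m))
        ≈⟨ ∑<-front M (λ m → q ^ m * s m) ⟨
      ∑< (suc M) (λ m → q ^ m * s m) ∎

    -- As B_m vanishes at -[N] for m > N, the value is a finite sum, and `P-suc` rewrites its terms.
    at-G : ∀ N a → at N (G a) ≈ T a N
    at-G N a = begin
      at N (G a)
        ≈⟨ At.subst-Σq (q ^ N) (λ m → liftE (a m) E.* BE.B Xᴱ m) ⟩
      PA.Σq (λ m → at N (liftE (a m) E.* BE.B Xᴱ m))
        ≈⟨ PA.Σq-cong {λ m → at N (liftE (a m) E.* BE.B Xᴱ m)} (λ m → trans {at N (liftE (a m) E.* BE.B Xᴱ m)}
             (at.*-homo N (liftE (a m)) (BE.B Xᴱ m)) (*-cong {at N (liftE (a m))} (at-lift N (a m)) (B-at N m))) ⟩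
      PA.Σq (λ m → a m * B -⟦ N ⟧ m)
        ≈⟨ finite (suc N) (λ m → a m * B -⟦ N ⟧ m) (λ k → trans {a (k ℕ.+ suc N) * B -⟦ N ⟧ (k ℕ.+ suc N)}
             (*-congˡ {a (k ℕ.+ suc N)} (B-vanish N k)) (zeroʳ (a (k ℕ.+ suc N)))) ⟩
      ∑< (suc N) (λ m → q ^ m * (a m * B -⟦ N ⟧ m))
        ≈⟨ ∑<-cong (suc N) {λ m → q ^ m * (a m * B -⟦ N ⟧ m)} (λ m → begin
             q ^ m * (a m * B -⟦ N ⟧ m)   ≈⟨ *-congˡ {q ^ m} (*-comm (a m) (B -⟦ N ⟧ m)) ⟩
             q ^ m * (B -⟦ N ⟧ m * a m)   ≈⟨ *-assoc (q ^ m) (B -⟦ N ⟧ m) (a m) ⟨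
             q ^ m * B -⟦ N ⟧ m * a m     ≈⟨ *-congʳ {a m} {P (suc N) m} (P-suc N m) ⟨
             P (suc N) m * a m            ∎) ⟩
      T a N ∎

    u : F.Carrier
    u = F.1# F.+ liftF (1# + - q) F.* X

    κF-hom : IsHom A PF.commutativeRing (A⟦X⟧⟦q⟧.const ∘ const)
    κF-hom = ∘-hom {A} {PA.commutativeRing} {PF.commutativeRing} PF.const-hom PA.const-hom

    module Ψ = SeriesSubstitution A PA.commutativeRing {A⟦X⟧⟦q⟧.const ∘ const} κF-hom u

    Ψ-lift : ∀ a → Ψ.subst (liftE a) F.≈ liftF a
    Ψ-lift a = F.trans {Ψ.subst (liftE a)} {PF.Σq (A⟦X⟧⟦q⟧.const ∘ (const ∘ a))} {liftF a}
      (Ψ.subst-scalar a) (Σq-const∘ PA.commutativeRing (const ∘ a))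

    Ψ-U : Ψ.subst U F.≈ u
    Ψ-U = F.trans {Ψ.subst U} {Ψ.θ (FA.basis 1)} {u} (Ψ.subst-const (FA.basis 1))
      (F.trans {Ψ.θ (FA.basis 1)} {u F.* F.1#} {u} (Semilinear.eval-basis A PF.commutativeRing {A⟦X⟧⟦q⟧.const ∘ const} κF-hom
        (SemiringExp._^_ F.semiring u) 1) (F.*-identityʳ u))

    Ψ-X : Ψ.subst Xᴱ F.≈ X
    Ψ-X = affine-inverse {PE.commutativeRing} {PF.commutativeRing} Ψ.subst-hom {U} {liftE w} {c} {X} Ψ-U
      (F.trans {Ψ.subst (liftE w) F.* c} {liftF (w * (1# + - q))} {F.1#}
        (F.trans {Ψ.subst (liftE w) F.* c} {liftF w F.* c} {liftF (w * (1# + - q))}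
          (F.*-congʳ {c} {Ψ.subst (liftE w)} {liftF w} (Ψ-lift w))
          (F.sym {liftF (w * (1# + - q))} {liftF w F.* c} (liftF.*-homo w (1# + - q))))
        (F.trans {liftF (w * (1# + - q))} {liftF 1#} {F.1#}
          (liftF.⟦⟧-cong {w * (1# + - q)} {1#} w-inverse) liftF.1#-homo))
      where
      module liftF = IsHom {PA.commutativeRing} {PF.commutativeRing} liftF-hom
      c : F.Carrier
      c = liftF (1# + - q)

    Ψ-B : ∀ m → Ψ.subst (BE.B Xᴱ m) F.≈ BF.B X m
    Ψ-B m = B-homo {PE.commutativeRing} {PF.commutativeRing} Ψ.subst-hom {rE} {rF}
      (λ m → Ψ-lift (r m)) {Xᴱ} {X} Ψ-X m

  pair : (ℕ → Carrier) → (ℕ → Carrier) → Carrier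
  pair a b = PA.Σq (λ m → a m * b m)

  private
    -- In B_(m+1) = X r_(m+1) (B_0 + ⋯ + B_m) the factor X lowers the degree by one, and what
    -- remains is the operator `Y·`.
    inner-B : ∀ i m → inner i (BF.B X m) ≈ Yδ i m
    inner-B zero    zero    = λ { zero → A.refl ; (suc n) → A.refl }
    inner-B (suc i) zero    = λ { zero → A.sym (zeroʳ (r 0) 0) ; (suc n) → A.sym (zeroʳ (r 0) (suc n)) }
    inner-B zero    (suc m) = trans {inner 0 (X F.* rF (suc m) F.* BF.∏ X m)} {inner 0 (X F.* (rF (suc m) F.* BF.∏ X m))}
      (λ n → F.*-assoc X (rF (suc m)) (BF.∏ X m) n 0) (inner-X-zero (rF (suc m) F.* BF.∏ X m))
    inner-B (suc i) (suc m) = begin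
      inner (suc i) (X F.* rF (suc m) F.* BF.∏ X m)
        ≈⟨ (λ n → F.*-assoc X (rF (suc m)) (BF.∏ X m) n (suc i)) ⟩
      inner (suc i) (X F.* (rF (suc m) F.* BF.∏ X m))
        ≈⟨ inner-X-suc i (rF (suc m) F.* BF.∏ X m) ⟩
      inner i (rF (suc m) F.* BF.∏ X m)
        ≈⟨ inner-scale i (r (suc m)) (BF.∏ X m) ⟩
      r (suc m) * inner i (BF.∏ X m)
        ≈⟨ *-congˡ {r (suc m)} (λ n → BF.∑<-B X m n i) ⟨
      r (suc m) * inner i (PartialSums.∑< PF.commutativeRing (suc m) (BF.B X))
        ≈⟨ *-congˡ {r (suc m)} (inner-∑< i (suc m) (BF.B X)) ⟩
      r (suc m) * ∑< (suc m) (λ j → inner i (BF.B X j))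
        ≈⟨ *-congˡ {r (suc m)} (∑<-cong (suc m) {λ j → inner i (BF.B X j)} (inner-B i)) ⟩
      r (suc m) * ∑< (suc m) (Yδ i) ∎

    inner-Ψ-G : ∀ i a → inner i (Ψ.subst (G a)) ≈ pair a (Yδ i)
    inner-Ψ-G i a = begin
      inner i (Ψ.subst (G a))
        ≈⟨ (λ n → Ψ.subst-Σq (λ m → liftE (a m) E.* BE.B Xᴱ m) n i) ⟩
      inner i (PF.Σq (λ m → Ψ.subst (liftE (a m) E.* BE.B Xᴱ m)))
        ≈⟨ inner-Σq i (λ m → Ψ.subst (liftE (a m) E.* BE.B Xᴱ m)) ⟩
      PA.Σq (λ m → inner i (Ψ.subst (liftE (a m) E.* BE.B Xᴱ m)))
        ≈⟨ PA.Σq-cong {λ m → inner i (Ψ.subst (liftE (a m) E.* BE.B Xᴱ m))} (λ m → begin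
             inner i (Ψ.subst (liftE (a m) E.* BE.B Xᴱ m))
               ≈⟨ (λ n → Ψ.subst.*-homo (liftE (a m)) (BE.B Xᴱ m) n i) ⟩
             inner i (Ψ.subst (liftE (a m)) F.* Ψ.subst (BE.B Xᴱ m))
               ≈⟨ (λ n → F.*-cong {Ψ.subst (liftE (a m))} {liftF (a m)} {Ψ.subst (BE.B Xᴱ m)} {BF.B X m}
                           (Ψ-lift (a m)) (Ψ-B m) n i) ⟩
             inner i (liftF (a m) F.* BF.B X m)
               ≈⟨ inner-scale i (a m) (BF.B X m) ⟩
             a m * inner i (BF.B X m)
               ≈⟨ *-congˡ {a m} (inner-B i m) ⟩
             a m * Yδ i m ∎) ⟩
      pair a (Yδ i) ∎

  -- Values at all points determine an element of A[U]⟦q⟧, so the hypothesis gives G_a G_b = G_c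
  -- there; the conclusion compares coefficients of Xⁱ.
  pair-product : ∀ {a b c} → (∀ N → T a N * T b N ≈ T c N) →
                 ∀ i → RS.sum {suc i} (λ j → pair a (Yδ (toℕ j)) * pair b (Yδ (i ∸ toℕ j))) ≈ pair c (Yδ i)
  pair-product {a} {b} {c} e i = begin
    RS.sum {suc i} (λ j → pair a (Yδ (toℕ j)) * pair b (Yδ (i ∸ toℕ j)))
      ≈⟨ RS.sum-cong-≋ {suc i} {λ j → inner (toℕ j) (Ψ.subst (G a)) * inner (i ∸ toℕ j) (Ψ.subst (G b))}
           (λ j → *-cong {inner (toℕ j) (Ψ.subst (G a))} (inner-Ψ-G (toℕ j) a) (inner-Ψ-G (i ∸ toℕ j) b)) ⟨
    RS.sum {suc i} (λ j → inner (toℕ j) (Ψ.subst (G a)) * inner (i ∸ toℕ j) (Ψ.subst (G b)))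
      ≈⟨ inner-* i (Ψ.subst (G a)) (Ψ.subst (G b)) ⟨
    inner i (Ψ.subst (G a) F.* Ψ.subst (G b))
      ≈⟨ (λ n → Ψ.subst.*-homo (G a) (G b) n i) ⟨
    inner i (Ψ.subst (G a E.* G b))
      ≈⟨ (λ n → Ψ.subst.⟦⟧-cong {G a E.* G b} {G c} G-product n i) ⟩
    inner i (Ψ.subst (G c))
      ≈⟨ inner-Ψ-G i c ⟩
    pair c (Yδ i) ∎
    where
    G-product : G a E.* G b E.≈ G c
    G-product = at-injective (G a E.* G b) (G c) λ N → begin
      at N (G a E.* G b)        ≈⟨ at.*-homo N (G a) (G b) ⟩
      at N (G a) * at N (G b)   ≈⟨ *-cong {at N (G a)} (at-G N a) (at-G N b) ⟩
      T a N * T b N             ≈⟨ e N ⟩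
      T c N                     ≈⟨ at-G N c ⟨
      at N (G c)                ∎

-- Sums attached to words

module HoffmanSums (K : CommutativeRing 0ℓ 0ℓ) (ħ t : CommutativeRing.Carrier K)
                   (R : CommutativeRing 0ℓ 0ℓ) {κ : CommutativeRing.Carrier K → CommutativeRing.Carrier R}
                   (κ-hom : IsHom K R κ) (q : CommutativeRing.Carrier R) (numbers : QNumbers R q)
                   (κħ : CommutativeRing._≈_ R (CommutativeRing._+_ R (κ ħ) q) (CommutativeRing.1# R)) where

  open CommutativeRing R
  open QNumbers numbers
  open NewtonSeries R q numbers
  open Hoffman K ħ t
  open Semilinear K R {κ} κ-hom
  private
    module K = CommutativeRing K
    module κ = IsHom {K} {R} κ-hom
    module FK = FreeModule K
  open SemiringExp semiring using (_^_; ^-homo-*)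
  open RingProperties ring using (+-cancelʳ; -1*x≈-x)
  open NaturalCoefficientsSolver commutativeSemiring using (solve; _:+_; _:*_; _:=_; con)
  open SetoidReasoning setoid

  eval-*ᴴ : ∀ (f : Word → Carrier) p p′ → eval f (p 𝔥.* p′) ≈ eval (λ u → eval (λ v → f (u ++ v)) p′) p
  eval-*ᴴ = eval-⋆ (List.≡-dec _≟ᴸ_) _++_ {[]}

  eval-*¹ : ∀ (f : Word¹ → Carrier) p p′ → eval f (p 𝔥¹.* p′) ≈ eval (λ u → eval (λ v → f (u ++ v)) p′) p
  eval-*¹ = eval-⋆ (List.≡-dec ℕ._≟_) _++_ {[]}

  eval-letter : ∀ (f : Word¹ → Carrier) i p → eval f (z⁺ i 𝔥¹.* p) ≈ eval (f ∘ (i ∷_)) p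
  eval-letter f i p = trans (eval-*¹ f (z⁺ i) p) (eval-basis (λ u → eval (λ v → f (u ++ v)) p) (i ∷ []))

  eval-∘₊ : ∀ (f : Word¹ → Carrier) i j p → eval f ((i ∘₊ j) 𝔥¹.* p)
          ≈ eval f (z⁺ (suc (i ℕ.+ j)) 𝔥¹.* p) + κ ħ * eval f (z⁺ (i ℕ.+ j) 𝔥¹.* p)
  eval-∘₊ f i j p = trans (eval-resp (List.≡-dec ℕ._≟_) f (∘₊-* i j p))
    (trans (eval-++ f (z⁺ (suc (i ℕ.+ j)) 𝔥¹.* p) _) (+-congˡ (eval-• f ħ (z⁺ (i ℕ.+ j) 𝔥¹.* p))))

  module TruncatedSums (g : ℕ → ℕ → Carrier) where

    -- The sum over N ≥ m₁ > ⋯ > m_l ≥ 1, where g i N is the weight of the letter i at N + 1.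
    Q : ℕ → Word¹ → Carrier
    Q N       []      = 1#
    Q zero    (i ∷ w) = 0#
    Q (suc N) (i ∷ w) = Q N (i ∷ w) + g i N * Q N w

    eval-Q-zero : ∀ i p → eval (Q 0) (z⁺ i 𝔥¹.* p) ≈ 0#
    eval-Q-zero i p = trans (eval-letter (Q 0) i p) (eval-0 p)

    eval-Q-suc : ∀ N i p → eval (Q (suc N)) (z⁺ i 𝔥¹.* p) ≈ eval (Q N) (z⁺ i 𝔥¹.* p) + g i N * eval (Q N) p
    eval-Q-suc N i p = begin
      eval (Q (suc N)) (z⁺ i 𝔥¹.* p)                              ≈⟨ eval-letter (Q (suc N)) i p ⟩
      eval (λ w → Q N (i ∷ w) + g i N * Q N w) p                  ≈⟨ eval-+ _ _ p ⟩
      eval (Q N ∘ (i ∷_)) p + eval (λ w → g i N * Q N w) p        ≈⟨ +-cong (sym (eval-letter (Q N) i p)) (eval-* (g i N) (Q N) p) ⟩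
      eval (Q N) (z⁺ i 𝔥¹.* p) + g i N * eval (Q N) p             ∎

    module _ (_◇_ : ℕ → ℕ → 𝔥¹)
             (◇-zero : ∀ i j p → eval (Q 0) ((i ◇ j) 𝔥¹.* p) ≈ 0#)
             (◇-suc : ∀ N i j p → eval (Q (suc N)) ((i ◇ j) 𝔥¹.* p)
                                ≈ eval (Q N) ((i ◇ j) 𝔥¹.* p) + g i N * g j N * eval (Q N) p) where

      private
        split : ∀ N a b c → eval (Q N) ((a ++ b) ++ c) ≈ eval (Q N) a + (eval (Q N) b + eval (Q N) c)
        split N a b c = trans (eval-++ (Q N) (a ++ b) c) (trans (+-congʳ (eval-++ (Q N) a b)) (+-assoc _ _ _))

      -- The three summands correspond to a largest index that comes from u only, from v only, or
      -- from both. In the last case `◇-suc` says that i ◇ j has the product of the weights of i and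
      -- j.
      Q-quasiShuffle : ∀ N u v → eval (Q N) (quasiShuffle _◇_ u v) ≈ Q N u * Q N v
      Q-quasiShuffle N []      v  = trans (eval-basis (Q N) v) (sym (*-identityˡ _))
      Q-quasiShuffle N (i ∷ u) [] = trans (eval-basis (Q N) (i ∷ u)) (sym (*-identityʳ _))
      Q-quasiShuffle zero (i ∷ u) (j ∷ v) = begin
        eval (Q 0) ((a ++ b) ++ c)                   ≈⟨ split 0 a b c ⟩
        eval (Q 0) a + (eval (Q 0) b + eval (Q 0) c)  ≈⟨ +-cong (eval-Q-zero i u′) (+-cong (eval-Q-zero j v′) (◇-zero i j w′)) ⟩
        0# + (0# + 0#)                               ≈⟨ trans (+-identityˡ _) (trans (+-identityˡ _) (sym (zeroˡ 0#))) ⟩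
        0# * 0#                                      ∎
        where
        u′ v′ w′ a b c : 𝔥¹
        u′ = quasiShuffle _◇_ u (j ∷ v)
        v′ = quasiShuffle _◇_ (i ∷ u) v
        w′ = quasiShuffle _◇_ u v
        a = z⁺ i 𝔥¹.* u′
        b = z⁺ j 𝔥¹.* v′
        c = (i ◇ j) 𝔥¹.* w′
      Q-quasiShuffle (suc N) (i ∷ u) (j ∷ v) = begin
        eval (Q (suc N)) ((a ++ b) ++ c)
          ≈⟨ split (suc N) a b c ⟩
        eval (Q (suc N)) a + (eval (Q (suc N)) b + eval (Q (suc N)) c)
          ≈⟨ +-cong (trans (eval-Q-suc N i u′) (+-congˡ (*-congˡ (Q-quasiShuffle N u (j ∷ v)))))
               (+-cong (trans (eval-Q-suc N j v′) (+-congˡ (*-congˡ (Q-quasiShuffle N (i ∷ u) v))))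
                       (trans (◇-suc N i j w′) (+-congˡ (*-congˡ (Q-quasiShuffle N u v))))) ⟩
        (eval (Q N) a + gᵢ * (U * jV)) + ((eval (Q N) b + gⱼ * (iU * V)) + (eval (Q N) c + gᵢ * gⱼ * (U * V)))
          ≈⟨ solve 9 (λ a b c gᵢ gⱼ U V iU jV → (a :+ gᵢ :* (U :* jV)) :+ ((b :+ gⱼ :* (iU :* V)) :+ (c :+ gᵢ :* gⱼ :* (U :* V)))
               := (a :+ (b :+ c)) :+ (gᵢ :* (U :* jV) :+ gⱼ :* (iU :* V) :+ gᵢ :* gⱼ :* (U :* V))) refl
               (eval (Q N) a) (eval (Q N) b) (eval (Q N) c) gᵢ gⱼ U V iU jV ⟩
        (eval (Q N) a + (eval (Q N) b + eval (Q N) c)) + (gᵢ * (U * jV) + gⱼ * (iU * V) + gᵢ * gⱼ * (U * V))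
          ≈⟨ +-congʳ (split N a b c) ⟨
        eval (Q N) ((a ++ b) ++ c) + (gᵢ * (U * jV) + gⱼ * (iU * V) + gᵢ * gⱼ * (U * V))
          ≈⟨ +-congʳ (Q-quasiShuffle N (i ∷ u) (j ∷ v)) ⟩
        iU * jV + (gᵢ * (U * jV) + gⱼ * (iU * V) + gᵢ * gⱼ * (U * V))
          ≈⟨ solve 6 (λ gᵢ gⱼ U V iU jV → iU :* jV :+ (gᵢ :* (U :* jV) :+ gⱼ :* (iU :* V) :+ gᵢ :* gⱼ :* (U :* V))
               := (iU :+ gᵢ :* U) :* (jV :+ gⱼ :* V)) refl gᵢ gⱼ U V iU jV ⟩
        (iU + gᵢ * U) * (jV + gⱼ * V) ∎
        where
        u′ v′ w′ a b c : 𝔥¹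
        u′ = quasiShuffle _◇_ u (j ∷ v)
        v′ = quasiShuffle _◇_ (i ∷ u) v
        w′ = quasiShuffle _◇_ u v
        a = z⁺ i 𝔥¹.* u′
        b = z⁺ j 𝔥¹.* v′
        c = (i ◇ j) 𝔥¹.* w′
        gᵢ gⱼ U V iU jV : Carrier
        gᵢ = g i N
        gⱼ = g j N
        U  = Q N u
        V  = Q N v
        iU = Q N (i ∷ u)
        jV = Q N (j ∷ v)

      eval-Q-bilinear : ∀ N p p′ → eval (Q N) (bilinear (quasiShuffle _◇_) p p′) ≈ eval (Q N) p * eval (Q N) p′
      eval-Q-bilinear N p p′ = begin
        eval (Q N) (bilinear (quasiShuffle _◇_) p p′)
          ≈⟨ trans (eval-extend (Q N) _ p) (eval-cong (λ u → trans (eval-extend (Q N) _ p′) (eval-cong (Q-quasiShuffle N u) p′)) p) ⟩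
        eval (λ u → eval (λ v → Q N u * Q N v) p′) p
          ≈⟨ eval-cong (λ u → trans (eval-* (Q N u) (Q N) p′) (*-comm _ _)) p ⟩
        eval (λ u → eval (Q N) p′ * Q N u) p
          ≈⟨ trans (eval-* _ (Q N) p) (*-comm _ _) ⟩
        eval (Q N) p * eval (Q N) p′ ∎

  private
    c : ℕ → Carrier
    c N = q ^ suc N * r (suc N)

  -- At m = N + 1 and k = i + 1 the weights are (q^m/[m])^k here, and the weights q^((k-1)m) / [m]^k
  -- of ζ_q in `∗₊-sums`.
  module ∗-sums = TruncatedSums (λ i N → c N ^ suc i)
  module ∗₊-sums = TruncatedSums (λ i N → c N ^ i * r (suc N))

  eval-∗ : ∀ N p p′ → eval (∗-sums.Q N) (p ∗ p′) ≈ eval (∗-sums.Q N) p * eval (∗-sums.Q N) p′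
  eval-∗ = eval-Q-bilinear (λ i j → z⁺ (suc (i ℕ.+ j))) (λ i j → eval-Q-zero (suc (i ℕ.+ j)))
    (λ N i j p → trans (eval-Q-suc N (suc (i ℕ.+ j)) p) (+-congˡ (*-congʳ
      (trans (*-congˡ (trans (*-congˡ (^-homo-* (c N) i j)) (sym (x∙yz≈y∙xz _ _ _)))) (sym (*-assoc _ _ _))))))
    where
    open ∗-sums
    open CommutativeSemigroupProperties *-commutativeSemigroup using (x∙yz≈y∙xz)

  -- This is (1 - q^m)/[m] = 1 - q at m = N + 1. It accounts for the extra ħ z_(i+j-1) in z_i ∘₊
  -- z_j, which makes the weights of ζ_q multiplicative.
  r-split : ∀ N → r (suc N) ≈ c N + κ ħ
  r-split N = +-cancelʳ q _ _ (begin
    ρ + q                              ≈⟨ +-congˡ (trans (*-congˡ (r-inverse N)) (*-identityʳ q)) ⟨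
    ρ + q * (ρ * k)                    ≈⟨ solve 3 (λ r q k → r :+ q :* (r :* k) := (con 1 :+ q :* k) :* r) refl ρ q k ⟩
    (1# + q * k) * ρ                   ≈⟨ *-congʳ (q^+⟦⟧ (suc N)) ⟨
    (q ^ suc N + k) * ρ                ≈⟨ trans (distribʳ _ _ _) (+-congˡ (trans (*-comm k ρ) (r-inverse N))) ⟩
    q ^ suc N * ρ + 1#                 ≈⟨ +-congˡ κħ ⟨
    q ^ suc N * ρ + (κ ħ + q)          ≈⟨ +-assoc _ _ _ ⟨
    (q ^ suc N * ρ + κ ħ) + q          ∎)
    where
    ρ k : Carrier
    ρ = r (suc N)
    k = ⟦ suc N ⟧

  eval-∗₊ : ∀ N p p′ → eval (∗₊-sums.Q N) (p ∗₊ p′) ≈ eval (∗₊-sums.Q N) p * eval (∗₊-sums.Q N) p′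
  eval-∗₊ = eval-Q-bilinear _∘₊_
    (λ i j p → trans (eval-∘₊ (Q 0) i j p) (trans (+-cong (eval-Q-zero (suc (i ℕ.+ j)) p)
      (trans (*-congˡ (eval-Q-zero (i ℕ.+ j) p)) (zeroʳ (κ ħ)))) (+-identityˡ 0#)))
    (λ N i j p → let ρ = r (suc N); n = i ℕ.+ j; e = eval (Q N) p in begin
      eval (Q (suc N)) ((i ∘₊ j) 𝔥¹.* p)
        ≈⟨ trans (eval-∘₊ (Q (suc N)) i j p) (+-cong (eval-Q-suc N (suc n) p) (*-congˡ (eval-Q-suc N n p))) ⟩
      (eval (Q N) (z⁺ (suc n) 𝔥¹.* p) + c N * c N ^ n * ρ * e) + κ ħ * (eval (Q N) (z⁺ n 𝔥¹.* p) + c N ^ n * ρ * e)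
        ≈⟨ solve 7 (λ A B c cⁿ r h e → (A :+ c :* cⁿ :* r :* e) :+ h :* (B :+ cⁿ :* r :* e)
                 := (A :+ h :* B) :+ (c :+ h) :* (cⁿ :* r :* e)) refl _ _ (c N) (c N ^ n) ρ (κ ħ) e ⟩
      (eval (Q N) (z⁺ (suc n) 𝔥¹.* p) + κ ħ * eval (Q N) (z⁺ n 𝔥¹.* p)) + (c N + κ ħ) * (c N ^ n * ρ * e)
        ≈⟨ +-cong (sym (eval-∘₊ (Q N) i j p)) (*-cong (sym (r-split N)) (*-congʳ (*-congʳ (^-homo-* (c N) i j)))) ⟩
      eval (Q N) ((i ∘₊ j) 𝔥¹.* p) + ρ * (c N ^ i * c N ^ j * ρ * e)
        ≈⟨ +-congˡ (solve 4 (λ r cⁱ cʲ e → r :* (cⁱ :* cʲ :* r :* e) := cⁱ :* r :* (cʲ :* r) :* e) refl ρ (c N ^ i) (c N ^ j) e) ⟩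
      eval (Q N) ((i ∘₊ j) 𝔥¹.* p) + c N ^ i * ρ * (c N ^ j * ρ) * e ∎)
    where
    open ∗₊-sums

  -- A (ιʷ w) m is the term of the truncated sum of w with largest index m.
  A : Word → ℕ → Carrier
  A []      = Yδ 0
  A (X ∷ w) = X· (A w)
  A (Y ∷ w) = Y· (A w)

  A-letters : ∀ a w m → A (replicate a X ++ Y ∷ w) m ≈ (q ^ m * r m) ^ a * (r m * ∑< m (A w))
  A-letters zero    w m = sym (*-identityˡ _)
  A-letters (suc a) w m = trans (*-congˡ (A-letters a w m)) (sym (*-assoc _ _ _))

  A-zero : ∀ i w → A (ιʷ (i ∷ w)) 0 ≈ 0#
  A-zero i w = trans (A-letters i (ιʷ w) 0) (trans (*-congˡ (zeroʳ _)) (zeroʳ _))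

  -- The letters x of z_k contribute (q^m/[m])^(k-1), and y contributes 1/[m] with the sum over the
  -- smaller indices; together they give the weight of ζ_q and the truncated sum of the rest of the
  -- word.
  ∑<-A : ∀ w N → ∑< (suc N) (A (ιʷ w)) ≈ ∗₊-sums.Q N w
  A-suc : ∀ i w N → A (ιʷ (i ∷ w)) (suc N) ≈ c N ^ i * r (suc N) * ∗₊-sums.Q N w
  ∑<-A []      zero    = +-identityˡ 1#
  ∑<-A []      (suc N) = trans (+-identityʳ _) (∑<-A [] N)
  ∑<-A (i ∷ w) zero    = trans (+-identityˡ _) (A-zero i w)
  ∑<-A (i ∷ w) (suc N) = +-cong (∑<-A (i ∷ w) N) (A-suc i w N)
  A-suc i w N = trans (A-letters i (ιʷ w) (suc N)) (trans (*-congˡ (*-congˡ (∑<-A w N))) (sym (*-assoc _ _ _)))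

  𝔸 : 𝔥 → ℕ → Carrier
  𝔸 p m = eval (λ w → A w m) p

  eval-∑< : ∀ {W : Set} (f : W → ℕ → Carrier) m p → eval (λ w → ∑< m (f w)) p ≈ ∑< m (λ j → eval (λ w → f w j) p)
  eval-∑< f zero    p = eval-0 p
  eval-∑< f (suc m) p = trans (eval-+ _ _ p) (+-congʳ (eval-∑< f m p))

  𝔸-x : ∀ p m → eval (λ w → A (X ∷ w) m) p ≈ X· (𝔸 p) m
  𝔸-x p m = eval-* _ _ p

  𝔸-y : ∀ p m → eval (λ w → A (Y ∷ w) m) p ≈ Y· (𝔸 p) m
  𝔸-y p m = trans (eval-* _ _ p) (*-congˡ (eval-∑< A m p))

  𝔸φ : Word → ℕ → Carrier
  𝔸φ w = 𝔸 (φʷ w)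

  𝔸φ-X : ∀ w m → 𝔸φ (X ∷ w) m ≈ X· (𝔸φ w) m + Y· (𝔸φ w) m
  𝔸φ-X w m = trans (eval-*ᴴ (λ w → A w m) (x 𝔥.+ y) p) (trans (eval-++ after x y)
    (+-cong (trans (eval-basis after (X ∷ [])) (𝔸-x p m)) (trans (eval-basis after (Y ∷ [])) (𝔸-y p m))))
    where
    p : 𝔥
    p = φʷ w
    after : Word → Carrier
    after u = eval (λ v → A (u ++ v) m) p

  𝔸φ-Y : ∀ w m → 𝔸φ (Y ∷ w) m ≈ - 1# * Y· (𝔸φ w) m
  𝔸φ-Y w m = trans (eval-*ᴴ (λ w → A w m) (𝔥.- y) p) (trans (eval-• after (K.- K.1#) y)
    (*-cong (trans (κ.-‿homo K.1#) (-‿cong κ.1#-homo)) (trans (eval-basis after (Y ∷ [])) (𝔸-y p m))))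
    where
    p : 𝔥
    p = φʷ w
    after : Word → Carrier
    after u = eval (λ v → A (u ++ v) m) p

  𝔸φ-zero : ∀ a w → 𝔸φ (replicate a X ++ Y ∷ w) 0 ≈ 0#
  𝔸φ-zero zero    w = trans (𝔸φ-Y w 0) (trans (*-congˡ (zeroʳ _)) (zeroʳ _))
  𝔸φ-zero (suc a) w = trans (𝔸φ-X (replicate a X ++ Y ∷ w) 0) (trans (+-cong (trans (*-congˡ (𝔸φ-zero a w)) (zeroʳ _)) (zeroʳ _)) (+-identityˡ 0#))

  -- Since φ(y) = -y, this is `T-Y` with the sign reversed.
  T-𝔸φ-Y : ∀ w N → T (𝔸φ (Y ∷ w)) (suc N) ≈ T (𝔸φ (Y ∷ w)) N + c N * T (𝔸φ w) N
  T-𝔸φ-Y w N = +-cancelʳ (T y′ (suc N)) _ _ (begin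
    T (𝔸φ (Y ∷ w)) (suc N) + T y′ (suc N)                     ≈⟨ cancel (suc N) ⟩
    0#                                                        ≈⟨ cancel N ⟨
    T (𝔸φ (Y ∷ w)) N + T y′ N                                 ≈⟨ +-congˡ (T-Y (𝔸φ w) N) ⟨
    T (𝔸φ (Y ∷ w)) N + (T y′ (suc N) + c N * T (𝔸φ w) N)      ≈⟨ trans (+-congˡ (+-comm _ _)) (sym (+-assoc _ _ _)) ⟩
    (T (𝔸φ (Y ∷ w)) N + c N * T (𝔸φ w) N) + T y′ (suc N)      ∎)
    where
    y′ : ℕ → Carrier
    y′ = Y· (𝔸φ w)
    cancel : ∀ N → T (𝔸φ (Y ∷ w)) N + T y′ N ≈ 0#
    cancel N = trans (+-congʳ (trans (T-cong (𝔸φ-Y w) N) (trans (T-* (- 1#) y′ N) (-1*x≈-x _)))) (-‿inverseˡ _)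

  -- Since φ(x) = x + y, the relations `T-X` and `T-Y` add up: prefixing x multiplies the increment
  -- from N to N + 1 by c N.
  T-𝔸φ-X : ∀ w N → 𝔸φ w 0 ≈ 0# →
           T (𝔸φ (X ∷ w)) (suc N) + c N * T (𝔸φ w) N ≈ T (𝔸φ (X ∷ w)) N + c N * T (𝔸φ w) (suc N)
  T-𝔸φ-X w N e = begin
    T (𝔸φ (X ∷ w)) (suc N) + c N * T (𝔸φ w) N
      ≈⟨ +-congʳ (split (suc N)) ⟩
    (T (X· a) (suc N) + T (Y· a) (suc N)) + c N * T a N
      ≈⟨ trans (+-assoc _ _ _) (+-cong (T-X a N e) (T-Y a N)) ⟩
    (T (X· a) N + c N * T a (suc N)) + T (Y· a) N
      ≈⟨ solve 3 (λ x c y → (x :+ c) :+ y := (x :+ y) :+ c) refl (T (X· a) N) (c N * T a (suc N)) (T (Y· a) N) ⟩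
    (T (X· a) N + T (Y· a) N) + c N * T a (suc N)
      ≈⟨ +-congʳ (split N) ⟨
    T (𝔸φ (X ∷ w)) N + c N * T a (suc N) ∎
    where
    a : ℕ → Carrier
    a = 𝔸φ w
    split : ∀ N → T (𝔸φ (X ∷ w)) N ≈ T (X· a) N + T (Y· a) N
    split N = trans (T-cong (𝔸φ-X w) N) (T-+ (X· a) (Y· a) N)

  -- The image of y gives an increment with factor c N, and every x in front multiplies it by c N
  -- again. So x^a y yields c N ^ (a + 1), the weight that defines the sums for ∗; both sides start
  -- with the same value at N = 0.
  T-𝔸φ : ∀ w N → T (𝔸φ (ιʷ w)) N ≈ ∗-sums.Q N w
  T-𝔸φ []      N = trans (T-cong (λ m → eval-basis (λ w → A w m) []) N) (T-δ N)
  T-𝔸φ (a ∷ w) N = go N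
    where
    D : ℕ → ℕ → Carrier
    D a = T (𝔸φ (replicate a X ++ Y ∷ ιʷ w))
    D-suc : ∀ a N → D a (suc N) ≈ D a N + c N ^ suc a * ∗-sums.Q N w
    D-suc zero    N = trans (T-𝔸φ-Y (ιʷ w) N) (+-congˡ (*-cong (sym (*-identityʳ _)) (T-𝔸φ w N)))
    D-suc (suc a) N = +-cancelʳ (c N * D a N) _ _ (begin
      D (suc a) (suc N) + c N * D a N
        ≈⟨ T-𝔸φ-X (replicate a X ++ Y ∷ ιʷ w) N (𝔸φ-zero a (ιʷ w)) ⟩
      D (suc a) N + c N * D a (suc N)
        ≈⟨ +-congˡ (*-congˡ (D-suc a N)) ⟩
      D (suc a) N + c N * (D a N + c N ^ suc a * ∗-sums.Q N w)
        ≈⟨ solve 5 (λ E c D C Q → E :+ c :* (D :+ C :* Q) := (E :+ c :* C :* Q) :+ c :* D) refl _ (c N) _ (c N ^ suc a) _ ⟩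
      (D (suc a) N + c N ^ suc (suc a) * ∗-sums.Q N w) + c N * D a N ∎)
    go : ∀ N → D a N ≈ ∗-sums.Q N (a ∷ w)
    go zero    = trans (T-zero (𝔸φ (replicate a X ++ Y ∷ ιʷ w))) (𝔸φ-zero a (ιʷ w))
    go (suc N) = trans (D-suc a N) (+-congʳ (go N))

  -- The terms φ(p)_m, computed in 𝔥, where φ acts letter by letter; `dual-φ¹` returns to 𝔥¹.
  dual : 𝔥¹ → ℕ → Carrier
  dual p m = eval (λ w → 𝔸φ (ιʷ w) m) p

  dual-φ¹ : ∀ p m → eval (λ w → A (ιʷ w) m) (φ¹ p) ≈ dual p m
  dual-φ¹ p m = begin
    eval (λ w → A (ιʷ w) m) (φ¹ p)     ≈⟨ eval-rename (λ w → A w m) ιʷ (φ¹ p) ⟨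
    eval (λ w → A w m) (ι (φ¹ p))      ≈⟨ reflexive (≡.cong (eval (λ w → A w m)) (ι-φ¹ p)) ⟩
    eval (λ w → A w m) (φ (ι p))       ≈⟨ eval-extend (λ w → A w m) φʷ (ι p) ⟩
    eval (λ w → 𝔸φ w m) (ι p)          ≈⟨ eval-rename (λ w → 𝔸φ w m) ιʷ p ⟩
    dual p m                           ∎

  dual-resp : ∀ {p p′} → p 𝔥¹.≈ p′ → ∀ m → dual p m ≈ dual p′ m
  dual-resp e m = eval-resp (List.≡-dec ℕ._≟_) (λ w → 𝔸φ (ιʷ w) m) e

  T-dual : ∀ p N → T (dual p) N ≈ eval (∗-sums.Q N) p
  T-dual p N = begin
    T (dual p) N
      ≈⟨ ∑<-cong (suc N) (λ m → sym (eval-* (P (suc N) m) (λ w → 𝔸φ (ιʷ w) m) p)) ⟩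
    ∑< (suc N) (λ m → eval (λ w → P (suc N) m * 𝔸φ (ιʷ w) m) p)
      ≈⟨ eval-∑< (λ w m → P (suc N) m * 𝔸φ (ιʷ w) m) (suc N) p ⟨
    eval (λ w → T (𝔸φ (ιʷ w)) N) p
      ≈⟨ eval-cong (λ w → T-𝔸φ w N) p ⟩
    eval (∗-sums.Q N) p ∎

  T-dual-∗ : ∀ p p′ N → T (dual p) N * T (dual p′) N ≈ T (dual (p ∗ p′)) N
  T-dual-∗ p p′ N = trans (*-cong (T-dual p N) (T-dual p′ N))
    (trans (sym (eval-∗ N p p′)) (sym (T-dual (p ∗ p′) N)))

  -- At the point -[0] = 0 only the term m = 0 survives, and `Q 0` reads off the coefficient of the
  -- empty word. S preserves this coefficient (`Q-S`), and it vanishes on 𝔥y (`Q-𝔥y`).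
  dual-zero : ∀ p → dual p 0 ≈ eval (∗-sums.Q 0) p
  dual-zero p = trans (sym (T-zero (dual p))) (T-dual p 0)

  Q-S : ∀ p → eval (∗-sums.Q 0) (S p) ≈ eval (∗-sums.Q 0) p
  Q-S p = trans (eval-extend Q₀ (Sʷ t) p) (eval-cong on-words p)
    where
    Q₀ : Word¹ → Carrier
    Q₀ = ∗-sums.Q 0
    Q₀-act : ∀ i w → eval Q₀ (act i w) ≈ 0#
    Q₀-act i []      = refl
    Q₀-act i (j ∷ w) = trans (eval-∘₊ Q₀ i j (FK.basis w)) (trans (+-cong (∗-sums.eval-Q-zero (suc (i ℕ.+ j)) (FK.basis w))
      (trans (*-congˡ (∗-sums.eval-Q-zero (i ℕ.+ j) (FK.basis w))) (zeroʳ _))) (+-identityˡ 0#))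
    on-words : ∀ w → eval Q₀ (Sʷ t w) ≈ Q₀ w
    on-words []      = eval-basis Q₀ []
    on-words (i ∷ w) = trans (eval-++ Q₀ (z⁺ i 𝔥¹.* Sʷ t w) _) (trans (+-cong (∗-sums.eval-Q-zero i (Sʷ t w))
      (trans (eval-• Q₀ t (i ▷ Sʷ t w)) (trans (*-congˡ (trans (eval-extend Q₀ (act i) (Sʷ t w))
        (trans (eval-cong (Q₀-act i) (Sʷ t w)) (eval-0 (Sʷ t w))))) (zeroʳ _)))) (+-identityˡ 0#))

  Q-𝔥y : ∀ p → ι p ∈𝔥y → eval (∗-sums.Q 0) p ≈ 0#
  Q-𝔥y p (u , e) = begin
    eval (∗-sums.Q 0) p                ≈⟨ eval-cong empty-ιʷ p ⟨
    eval (empty ∘ ιʷ) p                ≈⟨ eval-rename empty ιʷ p ⟨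
    eval empty (ι p)                   ≈⟨ eval-resp (List.≡-dec _≟ᴸ_) empty e ⟩
    eval empty (u 𝔥.* y)               ≈⟨ eval-*ᴴ empty u y ⟩
    eval (λ w → eval (λ v → empty (w ++ v)) y) u
      ≈⟨ eval-cong (λ w → trans (eval-basis (λ v → empty (w ++ v)) (Y ∷ [])) (empty-++ w)) u ⟩
    eval (λ _ → 0#) u                  ≈⟨ eval-0 u ⟩
    0#                                 ∎
    where
    empty : Word → Carrier
    empty []      = 1#
    empty (_ ∷ _) = 0#
    empty-++ : ∀ w → empty (w ++ Y ∷ []) ≈ 0#
    empty-++ []      = refl
    empty-++ (_ ∷ _) = refl
    empty-ιʷ : ∀ w → empty (ιʷ w) ≈ ∗-sums.Q 0 w
    empty-ιʷ []          = refl
    empty-ιʷ (zero ∷ w)  = refl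
    empty-ιʷ (suc i ∷ w) = refl

  A-y^ : ∀ n m → A (ιʷ (replicate n 0)) m ≈ Yδ n m
  A-y^ zero    m = refl
  A-y^ (suc n) m = *-congˡ (∑<-cong m (A-y^ n))

-- The elements b[ n ]

module PowersOfY (K : CommutativeRing 0ℓ 0ℓ) (ħ t : CommutativeRing.Carrier K) where

  open Hoffman K ħ t
  open FreeModule K
  open FreeModule.Equality K {Word¹} (List.≡-dec ℕ._≟_) hiding (coeff; δ)
  private
    module ≋ᴴ = FreeModule.Equality K {Word} (List.≡-dec _≟ᴸ_)
    module K = CommutativeRing K
  open RawSemiringDefinitions (Semiring.rawSemiring 𝔥.semiring) using (_^_)

  -- Left multiplication by x on 𝔥y.
  raiseʷ : Word¹ → 𝔥¹
  raiseʷ []      = []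
  raiseʷ (a ∷ w) = basis (suc a ∷ w)

  raise : 𝔥¹ → 𝔥¹
  raise = extend raiseʷ

  raise-linear : IsLinear raise
  raise-linear = extend-linear raiseʷ

  raise-∷ : ∀ a w → raise (basis (a ∷ w)) ≋ basis (suc a ∷ w)
  raise-∷ a w = extend-basis raiseʷ (a ∷ w)

  raise-z : ∀ a p → raise (z⁺ a 𝔥¹.* p) ≋ z⁺ (suc a) 𝔥¹.* p
  raise-z a = linear-ext (∘-linear raise-linear (z-linear a)) (z-linear (suc a)) λ w →
    ≋-trans (cong raise-linear (basis-∷ a w)) (≋-trans (raise-∷ a w) (≋-sym (basis-∷ (suc a) w)))

  raise-▷ : ∀ a p → raise (a ▷ p) ≋ suc a ▷ p
  raise-▷ a = linear-ext (∘-linear raise-linear (▷-linear a)) (▷-linear (suc a)) on-basis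
    where
    open SetoidReasoning setoid≋
    on-basis : ∀ w → raise (a ▷ basis w) ≋ suc a ▷ basis w
    on-basis []      = ≋-trans (cong raise-linear (▷-1 a)) (≋-sym (▷-1 (suc a)))
    on-basis (j ∷ w) = begin
      raise (a ▷ basis (j ∷ w))
        ≈⟨ cong raise-linear (≋-trans (▷-∷ a j w) (∘₊-* a j (basis w))) ⟩
      raise (z⁺ (suc (a ℕ.+ j)) 𝔥¹.* basis w ++ ħ • (z⁺ (a ℕ.+ j) 𝔥¹.* basis w))
        ≈⟨ ≋-trans (add raise-linear (z⁺ (suc (a ℕ.+ j)) 𝔥¹.* basis w) (ħ • (z⁺ (a ℕ.+ j) 𝔥¹.* basis w)))
             (++-cong (raise-z (suc (a ℕ.+ j)) (basis w))
               (≋-trans (scale raise-linear ħ (z⁺ (a ℕ.+ j) 𝔥¹.* basis w)) (•-cong (K.refl {ħ}) (raise-z (a ℕ.+ j) (basis w))))) ⟩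
      z⁺ (suc (suc a ℕ.+ j)) 𝔥¹.* basis w ++ ħ • (z⁺ (suc a ℕ.+ j) 𝔥¹.* basis w)
        ≈⟨ ≋-trans (▷-∷ (suc a) j w) (∘₊-* (suc a) j (basis w)) ⟨
      suc a ▷ basis (j ∷ w) ∎

  -- S treats all z_k alike, and raising the first index commutes both with prefixing and with ∘₊.
  S-raise : ∀ p → S (raise p) ≋ raise (S p)
  S-raise = linear-ext (∘-linear (S-linear t) raise-linear) (∘-linear raise-linear (S-linear t)) on-basis
    where
    open SetoidReasoning setoid≋
    on-basis : ∀ w → S (raise (basis w)) ≋ raise (S (basis w))
    on-basis []      = ≋-trans (cong (S-linear t) (extend-basis raiseʷ []))
      (≋-sym (≋-trans (cong raise-linear (S-basis t [])) (extend-basis raiseʷ [])))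
    on-basis (a ∷ w) = begin
      S (raise (basis (a ∷ w)))
        ≈⟨ cong (S-linear t) (raise-∷ a w) ⟩
      S (basis (suc a ∷ w))
        ≈⟨ S-basis t (suc a ∷ w) ⟩
      z⁺ (suc a) 𝔥¹.* Sʷ t w ++ t • suc a ▷ Sʷ t w
        ≈⟨ ++-cong (raise-z a (Sʷ t w)) (≋-trans (scale raise-linear t (a ▷ Sʷ t w)) (•-cong (K.refl {t}) (raise-▷ a (Sʷ t w)))) ⟨
      raise (z⁺ a 𝔥¹.* Sʷ t w) ++ raise (t • a ▷ Sʷ t w)
        ≈⟨ add raise-linear (z⁺ a 𝔥¹.* Sʷ t w) (t • a ▷ Sʷ t w) ⟨
      raise (z⁺ a 𝔥¹.* Sʷ t w ++ t • a ▷ Sʷ t w)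
        ≈⟨ cong raise-linear (S-basis t (a ∷ w)) ⟨
      raise (S (basis (a ∷ w))) ∎

  private
    raiseᴹ : Word¹ → Maybe Word¹
    raiseᴹ []      = nothing
    raiseᴹ (a ∷ w) = just (suc a ∷ w)

    parse-suc : ∀ a w → parse (suc a) w ≡ (parse a w >>= raiseᴹ)
    parse-suc zero    []      = ≡.refl
    parse-suc (suc a) []      = ≡.refl
    parse-suc zero    (X ∷ w) = parse-suc 1 w
    parse-suc (suc a) (X ∷ w) = parse-suc (suc (suc a)) w
    parse-suc zero    (Y ∷ w) with parse 0 w
    ... | nothing = ≡.refl
    ... | just _  = ≡.refl
    parse-suc (suc a) (Y ∷ w) with parse 0 w
    ... | nothing = ≡.refl
    ... | just _  = ≡.refl

  πʷ : Word → 𝔥¹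
  πʷ w = maybe basis [] (parse 0 w)

  -- π is defined on lists of terms; in this form it is visibly linear, which makes it respect
  -- equality of formal sums.
  eval-π : ∀ (g : Word¹ → K.Carrier) p → eval g (π p) K.≈ eval (eval g ∘ πʷ) p
  eval-π g []            = K.refl
  eval-π g ((c , w) ∷ p) with parse 0 w
  ... | nothing = K.trans (eval-π g p) (K.sym (K.trans (K.+-congʳ (K.zeroʳ c)) (K.+-identityˡ _)))
  ... | just u  = K.+-cong (K.*-congˡ (K.sym (eval-basis g u))) (eval-π g p)

  π-cong : ∀ {p p′} → p 𝔥.≈ p′ → π p ≋ π p′
  π-cong {p} {p′} e = ≋-by-eval λ g → K.trans (eval-π g p) (K.trans (≋ᴴ.eval-resp (eval g ∘ πʷ) e) (K.sym (eval-π g p′)))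

  eval-letterᴴ : ∀ (f : Word → K.Carrier) l p → eval f (basis (l ∷ []) 𝔥.* p) K.≈ eval (f ∘ (l ∷_)) p
  eval-letterᴴ f l p = K.trans (MonoidAlgebra.eval-⋆ K (List.≡-dec _≟ᴸ_) {_++_} {[]} f (basis (l ∷ [])) p)
    (eval-basis (λ u → eval (λ v → f (u ++ v)) p) (l ∷ []))

  π-Y : ∀ p → π (y 𝔥.* p) ≋ z⁺ 0 𝔥¹.* π p
  π-Y p = ≋-by-eval λ g → begin
    eval g (π (y 𝔥.* p))                        ≈⟨ K.trans (eval-π g (y 𝔥.* p)) (eval-letterᴴ (eval g ∘ πʷ) Y p) ⟩
    eval (λ w → eval g (πʷ (Y ∷ w))) p           ≈⟨ eval-cong (λ w → pointwise g w) p ⟩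
    eval (λ w → eval (g ∘ (0 ∷_)) (πʷ w)) p      ≈⟨ eval-π (g ∘ (0 ∷_)) p ⟨
    eval (g ∘ (0 ∷_)) (π p)                      ≈⟨ K.trans (MonoidAlgebra.eval-⋆ K (List.≡-dec ℕ._≟_) {_++_} {[]} g (z⁺ 0) (π p)) (eval-basis (λ u → eval (λ v → g (u ++ v)) (π p)) (0 ∷ [])) ⟨
    eval g (z⁺ 0 𝔥¹.* π p)                       ∎
    where
    open SetoidReasoning K.setoid
    pointwise : ∀ g w → eval g (πʷ (Y ∷ w)) K.≈ eval (g ∘ (0 ∷_)) (πʷ w)
    pointwise g w with parse 0 w
    ... | nothing = K.refl
    ... | just _  = K.refl

  π-X : ∀ p → π (x 𝔥.* p) ≋ raise (π p)
  π-X p = ≋-by-eval λ g → begin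
    eval g (π (x 𝔥.* p))                        ≈⟨ K.trans (eval-π g (x 𝔥.* p)) (eval-letterᴴ (eval g ∘ πʷ) X p) ⟩
    eval (λ w → eval g (πʷ (X ∷ w))) p           ≈⟨ eval-cong (λ w → pointwise g w) p ⟩
    eval (λ w → eval (eval g ∘ raiseʷ) (πʷ w)) p ≈⟨ eval-π (eval g ∘ raiseʷ) p ⟨
    eval (eval g ∘ raiseʷ) (π p)                 ≈⟨ eval-extend g raiseʷ (π p) ⟨
    eval g (raise (π p))                         ∎
    where
    open SetoidReasoning K.setoid
    pointwise : ∀ g w → eval g (πʷ (X ∷ w)) K.≈ eval (eval g ∘ raiseʷ) (πʷ w)
    pointwise g w rewrite parse-suc 0 w with parse 0 w
    ... | nothing      = K.refl
    ... | just []      = K.sym (eval-basis (eval g ∘ raiseʷ) [])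
    ... | just (a ∷ u) = K.sym (eval-basis (eval g ∘ raiseʷ) (a ∷ u))

  y^_ : ℕ → 𝔥¹
  y^ n = basis (replicate n 0)

  π-++ : ∀ p p′ → π (p ++ p′) ≋ π p ++ π p′
  π-++ p p′ = ≋-by-eval λ g → K.trans (eval-π g (p ++ p′)) (K.trans (eval-++ (eval g ∘ πʷ) p p′)
    (K.sym (K.trans (eval-++ g (π p) (π p′)) (K.+-cong (eval-π g p) (eval-π g p′)))))

  π-• : ∀ c p → π (c • p) ≋ c • π p
  π-• c p = ≋-by-eval λ g → K.trans (eval-π g (c • p)) (K.trans (eval-• (eval g ∘ πʷ) c p)
    (K.sym (K.trans (eval-• g c (π p)) (K.*-congˡ (eval-π g p)))))

  b-zero : b[ 0 ] ≋ y^ 1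
  b-zero = begin
    π (𝔥.1# 𝔥.* y)            ≈⟨ π-cong (𝔥.trans (𝔥.*-identityˡ y) (𝔥.sym (𝔥.*-identityʳ y))) ⟩
    π (y 𝔥.* 𝔥.1#)            ≈⟨ π-Y 𝔥.1# ⟩
    z⁺ 0 𝔥¹.* basis []        ≈⟨ basis-∷ 0 [] ⟩
    basis (0 ∷ [])            ∎
    where open SetoidReasoning setoid≋

  b-suc : ∀ n → b[ suc n ] ≋ ((K.- t) • raise b[ n ] ++ z⁺ 0 𝔥¹.* b[ n ]) ++ (K.- K.1#) • (ħ K.* t) • b[ n ]
  b-suc n = begin
    π ((β 𝔥.* β ^ n) 𝔥.* y)
      ≈⟨ π-cong (𝔥.trans (𝔥.*-assoc β (β ^ n) y) expand) ⟩
    π (((K.- t) • (x 𝔥.* p) ++ y 𝔥.* p) ++ (K.- K.1#) • (ħ K.* t) • p)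
      ≈⟨ ≋-trans (π-++ ((K.- t) • (x 𝔥.* p) ++ y 𝔥.* p) _) (++-cong
           (≋-trans (π-++ ((K.- t) • (x 𝔥.* p)) (y 𝔥.* p))
             (++-cong (≋-trans (π-• (K.- t) (x 𝔥.* p)) (•-cong (K.refl {K.- t}) (π-X p))) (π-Y p)))
           (≋-trans (π-• (K.- K.1#) ((ħ K.* t) • p)) (•-cong (K.refl {K.- K.1#}) (π-• (ħ K.* t) p)))) ⟩
    ((K.- t) • raise (π p) ++ z⁺ 0 𝔥¹.* π p) ++ (K.- K.1#) • (ħ K.* t) • π p ∎
    where
    open SetoidReasoning setoid≋
    β p : 𝔥
    β = (K.- t) • x 𝔥.+ y 𝔥.- (ħ K.* t) • 𝔥.1#
    p = β ^ n 𝔥.* y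
    •-⋆ : ∀ c p′ → (c • p′) 𝔥.* p 𝔥.≈ c • (p′ 𝔥.* p)
    •-⋆ c p′ = MonoidAlgebra.•-⋆ K (List.≡-dec _≟ᴸ_) List.++-isMonoid c p′ p
    expand : β 𝔥.* p 𝔥.≈ ((K.- t) • (x 𝔥.* p) ++ y 𝔥.* p) ++ (K.- K.1#) • (ħ K.* t) • p
    expand = 𝔥.trans (𝔥.distribʳ p ((K.- t) • x 𝔥.+ y) (𝔥.- ((ħ K.* t) • 𝔥.1#))) (𝔥.+-cong
      (𝔥.trans (𝔥.distribʳ p ((K.- t) • x) y) (𝔥.+-cong (•-⋆ (K.- t) x) 𝔥.refl))
      (𝔥.trans (•-⋆ (K.- K.1#) ((ħ K.* t) • 𝔥.1#)) (≋ᴴ.•-cong (K.refl {K.- K.1#})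
        (𝔥.trans (•-⋆ (ħ K.* t) 𝔥.1#) (≋ᴴ.•-cong (K.refl {ħ K.* t}) (𝔥.*-identityˡ p))))))

  -- On 𝔥y the action of z_1 is multiplication by x + ħ, so S(y p) = (y + t x + ħ t) S(p), while S
  -- commutes with x and with scalars. Hence S(β p) = y S(p) for β = -t x + y - ħ t, which explains
  -- the form of β.
  S-b : ∀ n → S b[ n ] ≋ y^ (suc n)
  S-b zero = begin
    S b[ 0 ]                                          ≈⟨ cong (S-linear t) b-zero ⟩
    S (basis (0 ∷ []))                                ≈⟨ S-basis t (0 ∷ []) ⟩
    z⁺ 0 𝔥¹.* basis [] ++ t • 0 ▷ basis []            ≈⟨ ++-cong (basis-∷ 0 []) (•-cong (K.refl {t}) (▷-1 0)) ⟩
    basis (0 ∷ []) ++ []                              ≡⟨⟩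
    basis (0 ∷ [])                                    ∎
    where open SetoidReasoning setoid≋
  S-b (suc n) = begin
    S b[ suc n ]
      ≈⟨ cong (S-linear t) (b-suc n) ⟩
    S (((K.- t) • raise b ++ z⁺ 0 𝔥¹.* b) ++ (K.- K.1#) • (ħ K.* t) • b)
      ≈⟨ ≋-trans (add (S-linear t) ((K.- t) • raise b ++ z⁺ 0 𝔥¹.* b) _) (++-cong
           (≋-trans (add (S-linear t) ((K.- t) • raise b) _)
             (++-cong (≋-trans (scale (S-linear t) (K.- t) (raise b)) (•-cong (K.refl {K.- t}) (S-raise b))) (S-z t 0 b)))
           (≋-trans (scale (S-linear t) (K.- K.1#) ((ħ K.* t) • b)) (•-cong (K.refl {K.- K.1#}) (scale (S-linear t) (ħ K.* t) b)))) ⟩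
    ((K.- t) • raise (S b) ++ (z⁺ 0 𝔥¹.* S b ++ t • 0 ▷ S b)) ++ (K.- K.1#) • (ħ K.* t) • S b
      ≈⟨ ++-cong (++-cong (•-cong (K.refl {K.- t}) (≋-trans (cong raise-linear (S-b n)) (raise-∷ 0 u)))
           (++-cong (≋-trans (cong (z-linear 0) (S-b n)) (basis-∷ 0 (0 ∷ u)))
             (•-cong (K.refl {t}) (≋-trans (cong (▷-linear 0) (S-b n)) (≋-trans (▷-∷ 0 0 u) (≋-trans (∘₊-* 0 0 (basis u))
               (++-cong (basis-∷ 1 u) (•-cong (K.refl {ħ}) (basis-∷ 0 u)))))))))
           (•-cong (K.refl {K.- K.1#}) (•-cong (K.refl {ħ K.* t}) (S-b n))) ⟩
    ((K.- t) • basis (1 ∷ u) ++ (y^ suc (suc n) ++ t • (basis (1 ∷ u) ++ ħ • basis (0 ∷ u)))) ++ (K.- K.1#) • (ħ K.* t) • basis (0 ∷ u)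
      ≈⟨ ≋-by-eval collect ⟩
    y^ (suc (suc n)) ∎
    where
    open SetoidReasoning setoid≋
    b : 𝔥¹
    b = b[ n ]
    u : Word¹
    u = replicate n 0
    collect : ∀ g → eval g (((K.- t) • basis (1 ∷ u) ++ (y^ suc (suc n) ++ t • (basis (1 ∷ u) ++ ħ • basis (0 ∷ u))))
                            ++ (K.- K.1#) • (ħ K.* t) • basis (0 ∷ u)) K.≈ eval g (y^ suc (suc n))
    collect g = K.trans
      (solve 7 (λ n t ħ m G₁ G₂ G₀ → n :* con 1 :* G₁ :+ (con 1 :* G₂ :+ (t :* con 1 :* G₁ :+ (t :* (ħ :* con 1) :* G₀ :+ (m :* (ħ :* t :* con 1) :* G₀ :+ con 0))))
        := (con 1 :* G₂ :+ con 0) :+ ((n :+ t) :* G₁ :+ (m :+ con 1) :* (ħ :* t :* G₀))) K.refl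
        (K.- t) t ħ (K.- K.1#) (g (1 ∷ u)) (g (0 ∷ 0 ∷ u)) (g (0 ∷ u)))
      (K.trans (K.+-congˡ (K.trans (K.+-cong
        (K.trans (K.*-congʳ (K.-‿inverseˡ t)) (K.zeroˡ _)) (K.trans (K.*-congʳ (K.-‿inverseˡ K.1#)) (K.zeroˡ _))) (K.+-identityˡ K.0#)))
      (K.+-identityʳ _))
      where open NaturalCoefficientsSolver K.commutativeSemiring using (solve; _:+_; _:*_; _:=_; con)

-- The relation for a functional with the expansion of ζ_q

module _ (R : CommutativeRing 0ℓ 0ℓ) where
  open CommutativeRing R
  open PartialSums R
  private
    module RS = SemiringSum semiring

  sum≈∑< : ∀ M (a : ℕ → Carrier) → RS.sum {M} (a ∘ toℕ) ≈ ∑< M a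
  sum≈∑< zero    a = refl
  sum≈∑< (suc M) a = trans (+-congˡ (sum≈∑< M (a ∘ suc))) (sym (∑<-front M a))

  regroup : ∀ a b r u v → a * b * r * r * (u * v) ≈ a * r * u * (b * r * v)
  regroup = solve 5 (λ a b r u v → a :* b :* r :* r :* (u :* v) := a :* r :* u :* (b :* r :* v)) refl
    where open NaturalCoefficientsSolver commutativeSemiring using (solve; _:*_; _:=_)

  sum-trim : ∀ M (a : ℕ → Carrier) → a 0 ≈ 0# → a (suc M) ≈ 0# →
             RS.sum {suc (suc M)} (a ∘ toℕ) ≈ RS.sum {M} (a ∘ suc ∘ toℕ)
  sum-trim M a first last = trans (+-cong first (trans (sum≈∑< (suc M) (a ∘ suc))
    (trans (+-cong (sym (sum≈∑< M (a ∘ suc))) last) (+-identityʳ _)))) (+-identityˡ _)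

module Kawashima (A K : CommutativeRing 0ℓ 0ℓ) (ħ t : CommutativeRing.Carrier K)
                 {κ : CommutativeRing.Carrier K → CommutativeRing.Carrier (series A)} (κ-hom : IsHom K (series A) κ)
                 (numbers : QNumbers (series A) (PowerSeries.q A))
                 (κħ : CommutativeRing._≈_ (series A) (CommutativeRing._+_ (series A) (κ ħ) (PowerSeries.q A))
                                           (CommutativeRing.1# (series A))) where

  open CommutativeRing (series A)
  open QNumbers numbers
  private
    module PA = PowerSeriesProperties A
    module A⟦q⟧ = PowerSeries A
  open Hoffman K ħ t
  open Semilinear K PA.commutativeRing {κ} κ-hom
  open NewtonProduct A numbers using (pair; pair-product)
  open NewtonSeries PA.commutativeRing A⟦q⟧.q numbers using (Yδ)
  open HoffmanSums K ħ t PA.commutativeRing {κ} κ-hom A⟦q⟧.q numbers κħ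
    using (module ∗₊-sums; module ∗-sums; eval-letter; eval-∗₊; A-zero; A-suc; dual; dual-φ¹; dual-resp; A-y^; T-dual-∗; dual-zero; Q-S; Q-𝔥y)
    renaming (A to term)
  open PowersOfY K ħ t using (y^_; S-b)
  open SemiringExp semiring using (_^_; ^-homo-*)
  open SetoidReasoning setoid
  private
    module K = CommutativeRing K
    module κ = IsHom {K} {PA.commutativeRing} κ-hom
    module FK = FreeModule K
    module RS = SemiringSum semiring
    open FK.Equality {Word¹} (List.≡-dec ℕ._≟_) using (_≋_; ≋-trans; •-cong; cong; scale)
    ρ c : ℕ → Carrier
    ρ N = r (suc N)
    c N = A⟦q⟧.q ^ suc N * ρ N

  pair-cong : ∀ {a a′ b b′} → (∀ m → a m ≈ a′ m) → (∀ m → b m ≈ b′ m) → pair a b ≈ pair a′ b′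
  pair-cong {a} {a′} {b} {b′} d e = PA.Σq-cong {λ m → a m * b m} {λ m → a′ m * b′ m} (λ m → *-cong {a m} (d m) (e m))

  pair-Yδ0 : ∀ a → pair a (Yδ 0) ≈ a 0
  pair-Yδ0 a = begin
    pair a (Yδ 0)                                ≈⟨ PA.Σq-unfold (λ m → a m * Yδ 0 m) ⟩
    a 0 * 1# + A⟦q⟧.q * PA.Σq (λ m → a (suc m) * 0#)
      ≈⟨ +-cong {a 0 * 1#} (*-identityʳ (a 0)) (*-congˡ {A⟦q⟧.q} (trans {PA.Σq (λ m → a (suc m) * 0#)} {PA.Σq (λ _ → 0#)}
           (PA.Σq-cong {λ m → a (suc m) * 0#} (λ m → zeroʳ (a (suc m)))) PA.Σq-0)) ⟩
    a 0 + A⟦q⟧.q * 0#                            ≈⟨ +-congˡ {a 0} (zeroʳ A⟦q⟧.q) ⟩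
    a 0 + 0#                                     ≈⟨ +-identityʳ (a 0) ⟩
    a 0                                          ∎

  eval-Σq : ∀ {W : Set} (s : W → ℕ → Carrier) p → eval (λ w → PA.Σq (s w)) p ≈ PA.Σq (λ m → eval (λ w → s w m) p)
  eval-Σq s []            = sym {PA.Σq (λ _ → 0#)} PA.Σq-0
  eval-Σq s ((k , w) ∷ p) = begin
    κ k * PA.Σq (s w) + eval (λ w → PA.Σq (s w)) p
      ≈⟨ +-cong {κ k * PA.Σq (s w)} (sym {PA.Σq (λ m → κ k * s w m)} (PA.Σq-scaleˡ (κ k) (s w))) (eval-Σq s p) ⟩
    PA.Σq (λ m → κ k * s w m) + PA.Σq (λ m → eval (λ w → s w m) p)
      ≈⟨ PA.Σq-+ (λ m → κ k * s w m) (λ m → eval (λ w → s w m) p) ⟨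
    PA.Σq (λ m → eval (λ w → s w m) ((k , w) ∷ p)) ∎

  -- m ↦ q^{-m} times the term with largest index m in ζ_q of z_{a+2} w.
  admissible : ℕ → Word¹ → ℕ → Carrier
  admissible a w zero    = 0#
  admissible a w (suc N) = c N ^ a * ρ N * ρ N * ∗₊-sums.Q N w

  module _ (z : Word¹ → Carrier) (z-admissible : ∀ a w → z (suc a ∷ w) ≈ PA.Σq (admissible a w)) where

    -- The weight of ζ_q for z_(i+j+2) is q^m times the weights for z_(i+1) and z_(j+1), and the
    -- truncated sums of the remaining words multiply under ∗₊. For u empty both sides are zero: its
    -- only term is at m = 0, where a nonempty word has none.
    eval-⊛ʷ : ∀ u j v → eval z (⊛ʷ u (j ∷ v)) ≈ pair (term (ιʷ u)) (term (ιʷ (j ∷ v)))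
    eval-⊛ʷ [] j v = sym {pair (Yδ 0) b} (begin
      pair (Yδ 0) b   ≈⟨ PA.Σq-cong {λ m → Yδ 0 m * b m} (λ m → *-comm (Yδ 0 m) (b m)) ⟩
      pair b (Yδ 0)   ≈⟨ pair-Yδ0 b ⟩
      b 0             ≈⟨ A-zero j v ⟩
      0#              ∎)
      where
      b : ℕ → Carrier
      b = term (ιʷ (j ∷ v))
    eval-⊛ʷ (i ∷ u) j v = begin
      eval z (z⁺ (suc (i ℕ.+ j)) 𝔥¹.* p)
        ≈⟨ eval-letter z (suc (i ℕ.+ j)) p ⟩
      eval (λ w → z (suc (i ℕ.+ j) ∷ w)) p
        ≈⟨ eval-cong {f = λ w → z (suc (i ℕ.+ j) ∷ w)} {g = λ w → PA.Σq (admissible (i ℕ.+ j) w)} (z-admissible (i ℕ.+ j)) p ⟩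
      eval (λ w → PA.Σq (admissible (i ℕ.+ j) w)) p
        ≈⟨ eval-Σq (admissible (i ℕ.+ j)) p ⟩
      PA.Σq (λ m → eval (λ w → admissible (i ℕ.+ j) w m) p)
        ≈⟨ PA.Σq-cong {λ m → eval (λ w → admissible (i ℕ.+ j) w m) p} {λ m → term (ιʷ (i ∷ u)) m * term (ιʷ (j ∷ v)) m} termwise ⟩
      pair (term (ιʷ (i ∷ u))) (term (ιʷ (j ∷ v))) ∎
      where
      p : 𝔥¹
      p = FK.basis u ∗₊ FK.basis v
      termwise : ∀ m → eval (λ w → admissible (i ℕ.+ j) w m) p ≈ term (ιʷ (i ∷ u)) m * term (ιʷ (j ∷ v)) m
      termwise zero = trans {eval (λ _ → 0#) p} {0#} (eval-0 p)
        (sym {term (ιʷ (i ∷ u)) 0 * term (ιʷ (j ∷ v)) 0} {0#}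
          (trans {term (ιʷ (i ∷ u)) 0 * term (ιʷ (j ∷ v)) 0} {0# * term (ιʷ (j ∷ v)) 0} {0#}
            (*-congʳ {term (ιʷ (j ∷ v)) 0} {term (ιʷ (i ∷ u)) 0} {0#} (A-zero i u)) (zeroˡ (term (ιʷ (j ∷ v)) 0))))
      termwise (suc N) = begin
        eval (λ w → k * Q w) p
          ≈⟨ eval-* k Q p ⟩
        k * eval Q p
          ≈⟨ *-congˡ {k} (trans {eval Q p} {eval Q (FK.basis u) * eval Q (FK.basis v)} (eval-∗₊ N (FK.basis u) (FK.basis v))
               (*-cong {eval Q (FK.basis u)} (eval-basis Q u) (eval-basis Q v))) ⟩
        k * (Q u * Q v)
          ≈⟨ *-congʳ {Q u * Q v} {k} (*-congʳ {ρ N} {c N ^ (i ℕ.+ j) * ρ N} (*-congʳ {ρ N} {c N ^ (i ℕ.+ j)} (^-homo-* (c N) i j))) ⟩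
        c N ^ i * c N ^ j * ρ N * ρ N * (Q u * Q v)
          ≈⟨ regroup PA.commutativeRing (c N ^ i) (c N ^ j) (ρ N) (Q u) (Q v) ⟩
        c N ^ i * ρ N * Q u * (c N ^ j * ρ N * Q v)
          ≈⟨ *-cong {term (ιʷ (i ∷ u)) (suc N)} (A-suc i u N) (A-suc j v N) ⟨
        term (ιʷ (i ∷ u)) (suc N) * term (ιʷ (j ∷ v)) (suc N) ∎
        where
        Q : Word¹ → Carrier
        Q = ∗₊-sums.Q N
        k : Carrier
        k = c N ^ (i ℕ.+ j) * ρ N * ρ N

    eval-⊛ : ∀ {p p′ p″} j v → p ≋ p″ → p′ ≋ FK.basis (j ∷ v) →
             eval z (p ⊛ p′) ≈ pair (λ m → eval (λ w → term (ιʷ w) m) p″) (term (ιʷ (j ∷ v)))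
    eval-⊛ {p} {p′} {p″} j v e e′ = begin
      eval z (p ⊛ p′)
        ≈⟨ eval-extend z (λ u → FK.extend (⊛ʷ u) p′) p ⟩
      eval (λ u → eval z (FK.extend (⊛ʷ u) p′)) p
        ≈⟨ eval-cong {f = λ u → eval z (FK.extend (⊛ʷ u) p′)} {g = λ u → pair (term (ιʷ u)) b} (λ u → begin
             eval z (FK.extend (⊛ʷ u) p′)                           ≈⟨ eval-extend z (⊛ʷ u) p′ ⟩
             eval (eval z ∘ ⊛ʷ u) p′                                ≈⟨ eval-resp (List.≡-dec ℕ._≟_) (eval z ∘ ⊛ʷ u) e′ ⟩
             eval (eval z ∘ ⊛ʷ u) (FK.basis (j ∷ v))                ≈⟨ eval-basis (eval z ∘ ⊛ʷ u) (j ∷ v) ⟩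
             eval z (⊛ʷ u (j ∷ v))                                  ≈⟨ eval-⊛ʷ u j v ⟩
             pair (term (ιʷ u)) b                                   ∎) p ⟩
      eval (λ u → pair (term (ιʷ u)) b) p
        ≈⟨ eval-resp (List.≡-dec ℕ._≟_) (λ u → pair (term (ιʷ u)) b) e ⟩
      eval (λ u → pair (term (ιʷ u)) b) p″
        ≈⟨ eval-Σq (λ u m → term (ιʷ u) m * b m) p″ ⟩
      PA.Σq (λ m → eval (λ u → term (ιʷ u) m * b m) p″)
        ≈⟨ PA.Σq-cong {λ m → eval (λ u → term (ιʷ u) m * b m) p″} {λ m → eval (λ u → term (ιʷ u) m) p″ * b m} (λ m → begin
             eval (λ u → term (ιʷ u) m * b m) p″    ≈⟨ eval-cong {f = λ u → term (ιʷ u) m * b m} {g = λ u → b m * term (ιʷ u) m} (λ u → *-comm (term (ιʷ u) m) (b m)) p″ ⟩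
             eval (λ u → b m * term (ιʷ u) m) p″    ≈⟨ eval-* (b m) (λ u → term (ιʷ u) m) p″ ⟩
             b m * eval (λ u → term (ιʷ u) m) p″    ≈⟨ *-comm (b m) (eval (λ u → term (ιʷ u) m) p″) ⟩
             eval (λ u → term (ιʷ u) m) p″ * b m    ∎) ⟩
      pair (λ m → eval (λ w → term (ιʷ w) m) p″) b ∎
      where
      b : ℕ → Carrier
      b = term (ιʷ (j ∷ v))

    S∘S⁻¹ : ∀ p → S (S⁻¹ p) ≋ p
    S∘S⁻¹ = S-inverse t (K.- t) (K.-‿inverseʳ t)

    pair-negˡ : ∀ a b → pair (λ m → - a m) b ≈ - pair a b
    pair-negˡ a b = begin
      PA.Σq (λ m → - a m * b m)          ≈⟨ PA.Σq-cong {λ m → - a m * b m} {λ m → - 1# * (a m * b m)} (λ m → begin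
        - a m * b m                        ≈⟨ -‿distribˡ-* (a m) (b m) ⟨
        - (a m * b m)                      ≈⟨ -1*x≈-x (a m * b m) ⟨
        - 1# * (a m * b m)                 ∎) ⟩
      PA.Σq (λ m → - 1# * (a m * b m))   ≈⟨ PA.Σq-scaleˡ (- 1#) (λ m → a m * b m) ⟩
      - 1# * pair a b                    ≈⟨ -1*x≈-x (pair a b) ⟩
      - pair a b                         ∎
      where open RingProperties ring using (-1*x≈-x; -‿distribˡ-*)

    -- All S and S⁻¹ around the product cancel and leave -φ(S p) ⊛ yⁿ⁺¹.
    eval-⊛ᵗ : ∀ p n → eval z (S (φᵗ p ⊛ᵗ b[ n ])) ≈ - pair (dual (S p)) (Yδ (suc n))
    eval-⊛ᵗ p n = begin
      eval z (S (φᵗ p ⊛ᵗ b[ n ]))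
        ≈⟨ eval-resp (List.≡-dec ℕ._≟_) z (S∘S⁻¹ (S (φᵗ p) ⊛ S b[ n ])) ⟩
      eval z (S (φᵗ p) ⊛ S b[ n ])
        ≈⟨ eval-⊛ 0 (replicate n 0) Sφᵗ (S-b n) ⟩
      pair (λ m → eval (λ w → term (ιʷ w) m) ((K.- K.1#) FK.• φ¹ (S p))) (term (ιʷ (0 ∷ replicate n 0)))
        ≈⟨ pair-cong {b = term (ιʷ (0 ∷ replicate n 0))} negated (A-y^ (suc n)) ⟩
      pair (λ m → - dual (S p) m) (Yδ (suc n))
        ≈⟨ pair-negˡ (dual (S p)) (Yδ (suc n)) ⟩
      - pair (dual (S p)) (Yδ (suc n)) ∎
      where
      Sφᵗ : S (φᵗ p) ≋ (K.- K.1#) FK.• φ¹ (S p)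
      Sφᵗ = ≋-trans (scale (S-linear t) (K.- K.1#) (S⁻¹ (φ¹ (S p)))) (•-cong (K.refl {K.- K.1#}) (S∘S⁻¹ (φ¹ (S p))))
      negated : ∀ m → eval (λ w → term (ιʷ w) m) ((K.- K.1#) FK.• φ¹ (S p)) ≈ - dual (S p) m
      negated m = begin
        eval (λ w → term (ιʷ w) m) ((K.- K.1#) FK.• φ¹ (S p))
          ≈⟨ eval-• (λ w → term (ιʷ w) m) (K.- K.1#) (φ¹ (S p)) ⟩
        κ (K.- K.1#) * eval (λ w → term (ιʷ w) m) (φ¹ (S p))
          ≈⟨ *-cong {κ (K.- K.1#)} (trans {κ (K.- K.1#)} (κ.-‿homo K.1#) (-‿cong {κ K.1#} κ.1#-homo)) (dual-φ¹ (S p) m) ⟩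
        - 1# * dual (S p) m
          ≈⟨ -1*x≈-x (dual (S p) m) ⟩
        - dual (S p) m ∎
        where open RingProperties ring using (-1*x≈-x)

    kawashima : ∀ m → m ≥ 1 → (v w : 𝔥¹) → ι v ∈𝔥y → ι w ∈𝔥y →
      RS.sum {m ∸ 1} (λ i → eval z (S (φᵗ v ⊛ᵗ b[ toℕ i ])) * eval z (S (φᵗ w ⊛ᵗ b[ m ∸ suc (toℕ i) ∸ 1 ])))
        ≈ - eval z (S (φᵗ (S⁻¹ (S v ∗ S w)) ⊛ᵗ b[ m ∸ 1 ]))
    kawashima (suc m) _ v w v∈ w∈ = begin
      RS.sum {m} (λ i → eval z (S (φᵗ v ⊛ᵗ b[ toℕ i ])) * eval z (S (φᵗ w ⊛ᵗ b[ m ∸ toℕ i ∸ 1 ])))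
        ≈⟨ RS.sum-cong-≋ {m} {λ i → eval z (S (φᵗ v ⊛ᵗ b[ toℕ i ])) * eval z (S (φᵗ w ⊛ᵗ b[ m ∸ toℕ i ∸ 1 ]))} {λ i → F (suc (toℕ i))} term≈ ⟩
      RS.sum {m} (F ∘ suc ∘ toℕ)
        -- The coefficient of X^(m+1) in a product is a sum over j from 0 to m + 1. Its two end
        -- terms contain a coefficient of X⁰, which is zero on 𝔥y.
        ≈⟨ sum-trim PA.commutativeRing m F first last ⟨
      RS.sum {suc (suc m)} (F ∘ toℕ)
        ≈⟨ pair-product {dual (S v)} {dual (S w)} {dual (S v ∗ S w)} (T-dual-∗ (S v) (S w)) (suc m) ⟩
      pair (dual (S v ∗ S w)) (Yδ (suc m))
        ≈⟨ pair-cong {b = Yδ (suc m)} (λ k → dual-resp′ k) (λ k → refl {Yδ (suc m) k}) ⟨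
      pair (dual (S (S⁻¹ (S v ∗ S w)))) (Yδ (suc m))
        ≈⟨ -‿involutive (pair (dual (S (S⁻¹ (S v ∗ S w)))) (Yδ (suc m))) ⟨
      - - pair (dual (S (S⁻¹ (S v ∗ S w)))) (Yδ (suc m))
        ≈⟨ -‿cong {eval z (S (φᵗ (S⁻¹ (S v ∗ S w)) ⊛ᵗ b[ m ]))} (eval-⊛ᵗ (S⁻¹ (S v ∗ S w)) m) ⟨
      - eval z (S (φᵗ (S⁻¹ (S v ∗ S w)) ⊛ᵗ b[ m ])) ∎
      where
      open RingProperties ring using (-‿involutive; -‿distribˡ-*; -‿distribʳ-*)
      F : ℕ → Carrier
      F j = pair (dual (S v)) (Yδ j) * pair (dual (S w)) (Yδ (suc m ∸ j))
      dual-resp′ : ∀ k → dual (S (S⁻¹ (S v ∗ S w))) k ≈ dual (S v ∗ S w) k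
      dual-resp′ = dual-resp (S∘S⁻¹ (S v ∗ S w))
      vanish : ∀ p → ι p ∈𝔥y → pair (dual (S p)) (Yδ 0) ≈ 0#
      vanish p p∈ = begin
        pair (dual (S p)) (Yδ 0)      ≈⟨ pair-Yδ0 (dual (S p)) ⟩
        dual (S p) 0                  ≈⟨ dual-zero (S p) ⟩
        eval (∗-sums.Q 0) (S p)       ≈⟨ Q-S p ⟩
        eval (∗-sums.Q 0) p           ≈⟨ Q-𝔥y p p∈ ⟩
        0#                            ∎
      first : F 0 ≈ 0#
      first = trans {F 0} {0# * pair (dual (S w)) (Yδ (suc m))} (*-congʳ {pair (dual (S w)) (Yδ (suc m))} {pair (dual (S v)) (Yδ 0)} (vanish v v∈))
        (zeroˡ (pair (dual (S w)) (Yδ (suc m))))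
      last : F (suc m) ≈ 0#
      last = trans {F (suc m)} {pair (dual (S v)) (Yδ (suc m)) * 0#}
        (*-congˡ {pair (dual (S v)) (Yδ (suc m))} {pair (dual (S w)) (Yδ (m ∸ m))} (≡.subst (λ k → pair (dual (S w)) (Yδ k) ≈ 0#) (≡.sym (ℕ.n∸n≡0 m)) (vanish w w∈)))
        (zeroʳ (pair (dual (S v)) (Yδ (suc m))))
      neg*neg : ∀ a b → - a * - b ≈ a * b
      neg*neg a b = begin
        - a * - b     ≈⟨ -‿distribˡ-* a (- b) ⟨
        - (a * - b)   ≈⟨ -‿cong {a * - b} (sym { - (a * b)} (-‿distribʳ-* a b)) ⟩
        - - (a * b)   ≈⟨ -‿involutive (a * b) ⟩
        a * b         ∎
      term≈ : ∀ i → eval z (S (φᵗ v ⊛ᵗ b[ toℕ i ])) * eval z (S (φᵗ w ⊛ᵗ b[ m ∸ toℕ i ∸ 1 ])) ≈ F (suc (toℕ i))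
      term≈ i = begin
        eval z (S (φᵗ v ⊛ᵗ b[ toℕ i ])) * eval z (S (φᵗ w ⊛ᵗ b[ k ]))
          ≈⟨ *-cong {eval z (S (φᵗ v ⊛ᵗ b[ toℕ i ]))} (eval-⊛ᵗ v (toℕ i)) (eval-⊛ᵗ w k) ⟩
        - pair (dual (S v)) (Yδ (suc (toℕ i))) * - pair (dual (S w)) (Yδ (suc k))
          ≈⟨ neg*neg (pair (dual (S v)) (Yδ (suc (toℕ i)))) (pair (dual (S w)) (Yδ (suc k))) ⟩
        pair (dual (S v)) (Yδ (suc (toℕ i))) * pair (dual (S w)) (Yδ (suc k))
          ≡⟨ ≡.cong (λ k → pair (dual (S v)) (Yδ (suc (toℕ i))) * pair (dual (S w)) (Yδ k)) suc-k ⟩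
        F (suc (toℕ i)) ∎
        where
        k : ℕ
        k = m ∸ toℕ i ∸ 1
        -- As i < m, the difference m - i is positive and the subtraction of 1 is not truncated.
        suc-k : suc k ≡ m ∸ toℕ i
        suc-k = ℕ.m+[n∸m]≡n (ℕ.m<n⇒0<n∸m (Fin.toℕ<n i))

-- Interpolated values and the map S

sum-fillings : ∀ k ks → All (λ p → sum p ≤ k ℕ.+ sum ks) (fillings k ks)
sum-fillings k []        = ℕ.≤-refl ∷ []
sum-fillings k (k′ ∷ ks) = All.++⁺
  (All.map⁺ (All.map (ℕ.+-monoʳ-≤ k) (sum-fillings k′ ks)))
  (All.++⁺ (All.map (λ le → ℕ.≤-trans le (ℕ.≤-reflexive (ℕ.+-assoc k k′ (sum ks)))) (sum-fillings (k ℕ.+ k′) ks))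
           (All.map (λ le → ℕ.≤-trans le (ℕ.≤-trans (ℕ.+-monoˡ-≤ (sum ks) (ℕ.m∸n≤m (k ℕ.+ k′) 1)) (ℕ.≤-reflexive (ℕ.+-assoc k k′ (sum ks)))))
             (sum-fillings (k ℕ.+ k′ ∸ 1) ks)))

length-fillings : ∀ k ks → All (λ p → length p ≤ suc (length ks)) (fillings k ks)
length-fillings k []        = ℕ.≤-refl ∷ []
length-fillings k (k′ ∷ ks) = All.++⁺
  (All.map⁺ (All.map s≤s (length-fillings k′ ks)))
  (All.++⁺ (All.map ℕ.m≤n⇒m≤1+n (length-fillings (k ℕ.+ k′) ks))
           (All.map ℕ.m≤n⇒m≤1+n (length-fillings (k ℕ.+ k′ ∸ 1) ks)))

module Interpolation (K : CommutativeRing 0ℓ 0ℓ) (ħ t : CommutativeRing.Carrier K)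
                     (R : CommutativeRing 0ℓ 0ℓ) {κ : CommutativeRing.Carrier K → CommutativeRing.Carrier R}
                     (κ-hom : IsHom K R κ) where

  open CommutativeRing R
  open Hoffman K ħ t
  open Semilinear K R {κ} κ-hom
  open FreeModule K using (basis; _•_)
  open FreeModule.Equality K {Word¹} (List.≡-dec ℕ._≟_) hiding (coeff; δ; eval-resp)
  open SemiringExp semiring using (_^_)
  open SetoidReasoning setoid
  open NaturalCoefficientsSolver commutativeSemiring using (solve; _:+_; _:*_; _:=_; con)
  private
    module K = CommutativeRing K

  -- The sum defining ζ_q^t for weight s and depth l, with a general h in place of ζ_q so that an
  -- induction can pass to h ∘ (k ∷_).
  interpolate : (Index → Carrier) → ℕ → ℕ → List Index → Carrier
  interpolate h s l []      = 0#
  interpolate h s l (p ∷ L) = κ ħ ^ (s ∸ sum p) * h p * κ t ^ (l ∸ length p) + interpolate h s l L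

  interpolate-++ : ∀ h s l L L′ → interpolate h s l (L ++ L′) ≈ interpolate h s l L + interpolate h s l L′
  interpolate-++ h s l []      L′ = sym (+-identityˡ _)
  interpolate-++ h s l (p ∷ L) L′ = trans (+-congˡ (interpolate-++ h s l L L′)) (sym (+-assoc _ _ _))

  interpolate-∷ : ∀ h k s l L → interpolate h (k ℕ.+ s) (suc l) (map (k ∷_) L) ≈ interpolate (h ∘ (k ∷_)) s l L
  interpolate-∷ h k s l []      = refl
  interpolate-∷ h k s l (p ∷ L) = +-cong (*-congʳ (*-congʳ (reflexive (≡.cong (κ ħ ^_) (ℕ.[m+n]∸[m+o]≡n∸o k s (sum p))))))
                                         (interpolate-∷ h k s l L)

  -- The exponents are truncated differences; the bound, supplied by `length-fillings`, ensures that
  -- replacing l by l + 1 raises each of them by exactly one.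
  interpolate-t : ∀ h s l {L} → All (λ p → length p ≤ l) L → interpolate h s (suc l) L ≈ κ t * interpolate h s l L
  interpolate-t h s l []                 = sym (zeroʳ _)
  interpolate-t h s l {p ∷ L} (le ∷ les) = trans (+-cong
    (trans (*-congˡ (reflexive (≡.cong (κ t ^_) (ℕ.+-∸-assoc 1 le)))) (x∙yz≈y∙xz _ _ _)) (interpolate-t h s l les)) (sym (distribˡ _ _ _))
    where open CommutativeSemigroupProperties *-commutativeSemigroup using (x∙yz≈y∙xz)

  interpolate-ħ : ∀ h s l {L} → All (λ p → sum p ≤ s) L → interpolate h (suc s) l L ≈ κ ħ * interpolate h s l L
  interpolate-ħ h s l []                 = sym (zeroʳ _)
  interpolate-ħ h s l {p ∷ L} (le ∷ les) = trans (+-cong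
    (trans (*-congʳ (*-congʳ (reflexive (≡.cong (κ ħ ^_) (ℕ.+-∸-assoc 1 le)))))
      (solve 4 (λ a b c d → a :* b :* c :* d := a :* (b :* c :* d)) refl (κ ħ) _ _ _)) (interpolate-ħ h s l les)) (sym (distribˡ _ _ _))

  private
    S-▷-∷ : ∀ a b w → a ▷ Sʷ t (b ∷ w) ≋ Sʷ t (suc (a ℕ.+ b) ∷ w) ++ ħ • Sʷ t (a ℕ.+ b ∷ w)
    S-▷-∷ a b w = ≋-trans (cong (▷-linear a) (≋-sym (S-basis t (b ∷ w)))) (≋-trans (≋-sym (S-▷ t a (basis (b ∷ w))))
      (≋-trans (cong (S-linear t) (≋-trans (▷-∷ a b w) (≋-trans (∘₊-* a b (basis w))
        (++-cong (basis-∷ (suc (a ℕ.+ b)) w) (•-cong (K.refl {ħ}) (basis-∷ (a ℕ.+ b) w))))))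
      (≋-trans (add (S-linear t) (basis (suc (a ℕ.+ b) ∷ w)) (ħ • basis (a ℕ.+ b ∷ w)))
        (++-cong (S-basis t (suc (a ℕ.+ b) ∷ w)) (≋-trans (scale (S-linear t) ħ (basis (a ℕ.+ b ∷ w)))
          (•-cong (K.refl {ħ}) (S-basis t (a ℕ.+ b ∷ w))))))))

  -- The recursion of S matches that of `fillings`. The summand z_k S(w) gives the comma. As S
  -- commutes with ∘₊, the summand with t gives S of the words that begin with z_(k+k′), the filling
  -- +, and with ħ z_(k+k′-1), the filling -1+.
  eval-Sʷ : ∀ w a (h : Index → Carrier) → eval (h ∘ map suc) (Sʷ t (a ∷ w))
          ≈ interpolate h (sum (suc a ∷ map suc w)) (length (suc a ∷ map suc w)) (fillings (suc a) (map suc w))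
  eval-Sʷ-▷ : ∀ b w a (h : Index → Carrier) → eval (h ∘ map suc) (a ▷ Sʷ t (b ∷ w))
            ≈ interpolate h (suc a ℕ.+ (suc b ℕ.+ sum (map suc w))) (suc (length (map suc w))) (fillings (suc a ℕ.+ suc b) (map suc w))
            + interpolate h (suc a ℕ.+ (suc b ℕ.+ sum (map suc w))) (suc (length (map suc w))) (fillings (suc a ℕ.+ suc b ∸ 1) (map suc w))

  eval-Sʷ [] a h = begin
    eval h′ (z⁺ a 𝔥¹.* basis [] ++ t • a ▷ basis [])
      ≈⟨ eval-resp (List.≡-dec ℕ._≟_) h′ (++-cong (basis-∷ a []) (•-cong (K.refl {t}) (▷-1 a))) ⟩
    eval h′ (basis (a ∷ []) ++ [])
      ≈⟨ eval-basis h′ (a ∷ []) ⟩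
    h (suc a ∷ [])
      ≈⟨ trans (*-identityʳ _) (*-identityˡ _) ⟨
    κ ħ ^ 0 * h (suc a ∷ []) * κ t ^ 0
      ≈⟨ *-congʳ (*-congʳ (reflexive (≡.cong (κ ħ ^_) (ℕ.n∸n≡0 (suc a ℕ.+ 0))))) ⟨
    κ ħ ^ (suc a ℕ.+ 0 ∸ (suc a ℕ.+ 0)) * h (suc a ∷ []) * κ t ^ 0
      ≈⟨ +-identityʳ _ ⟨
    interpolate h (suc a ℕ.+ 0) 1 ((suc a ∷ []) ∷ []) ∎
    where
    h′ : Word¹ → Carrier
    h′ = h ∘ map suc
  eval-Sʷ (b ∷ w) a h = begin
    eval h′ (z⁺ a 𝔥¹.* Sʷ t (b ∷ w) ++ t • a ▷ Sʷ t (b ∷ w))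
      ≈⟨ trans (eval-++ h′ (z⁺ a 𝔥¹.* Sʷ t (b ∷ w)) _) (+-cong eval-letter (eval-• h′ t (a ▷ Sʷ t (b ∷ w)))) ⟩
    eval (h ∘ (suc a ∷_) ∘ map suc) (Sʷ t (b ∷ w)) + κ t * eval h′ (a ▷ Sʷ t (b ∷ w))
      ≈⟨ +-cong (trans (eval-Sʷ w b (h ∘ (suc a ∷_))) (sym (interpolate-∷ h (suc a) s l L₁)))
           (*-congˡ (trans (eval-Sʷ-▷ b w a h) (sym (interpolate-++ h (suc a ℕ.+ s) l L₂ L₃)))) ⟩
    interpolate h (suc a ℕ.+ s) (suc l) (map (suc a ∷_) L₁) + κ t * interpolate h (suc a ℕ.+ s) l (L₂ ++ L₃)
      ≈⟨ +-congˡ (interpolate-t h (suc a ℕ.+ s) l (All.++⁺ (length-fillings (suc a ℕ.+ suc b) ks) (length-fillings (suc a ℕ.+ suc b ∸ 1) ks))) ⟨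
    interpolate h (suc a ℕ.+ s) (suc l) (map (suc a ∷_) L₁) + interpolate h (suc a ℕ.+ s) (suc l) (L₂ ++ L₃)
      ≈⟨ interpolate-++ h (suc a ℕ.+ s) (suc l) (map (suc a ∷_) L₁) (L₂ ++ L₃) ⟨
    interpolate h (suc a ℕ.+ s) (suc l) (map (suc a ∷_) L₁ ++ L₂ ++ L₃) ∎
    where
    h′ : Word¹ → Carrier
    h′ = h ∘ map suc
    ks : Index
    ks = map suc w
    s l : ℕ
    s = suc b ℕ.+ sum ks
    l = suc (length ks)
    L₁ L₂ L₃ : List Index
    L₁ = fillings (suc b) ks
    L₂ = fillings (suc a ℕ.+ suc b) ks
    L₃ = fillings (suc a ℕ.+ suc b ∸ 1) ks
    eval-letter : eval h′ (z⁺ a 𝔥¹.* Sʷ t (b ∷ w)) ≈ eval (h ∘ (suc a ∷_) ∘ map suc) (Sʷ t (b ∷ w))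
    eval-letter = trans (eval-⋆ (List.≡-dec ℕ._≟_) _++_ {[]} h′ (z⁺ a) (Sʷ t (b ∷ w)))
      (eval-basis (λ u → eval (λ v → h′ (u ++ v)) (Sʷ t (b ∷ w))) (a ∷ []))

  eval-Sʷ-▷ b w a h = begin
    eval h′ (a ▷ Sʷ t (b ∷ w))
      ≈⟨ eval-resp (List.≡-dec ℕ._≟_) h′ (S-▷-∷ a b w) ⟩
    eval h′ (Sʷ t (suc (a ℕ.+ b) ∷ w) ++ ħ • Sʷ t (a ℕ.+ b ∷ w))
      ≈⟨ trans (eval-++ h′ (Sʷ t (suc (a ℕ.+ b) ∷ w)) _) (+-congˡ (eval-• h′ ħ (Sʷ t (a ℕ.+ b ∷ w)))) ⟩
    eval h′ (Sʷ t (suc (a ℕ.+ b) ∷ w)) + κ ħ * eval h′ (Sʷ t (a ℕ.+ b ∷ w))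
      ≈⟨ +-cong (eval-Sʷ w (suc (a ℕ.+ b)) h) (*-congˡ (eval-Sʷ w (a ℕ.+ b) h)) ⟩
    interpolate h (suc (suc (a ℕ.+ b)) ℕ.+ sum ks) l (fillings (suc (suc (a ℕ.+ b))) ks)
      + κ ħ * interpolate h (suc (a ℕ.+ b) ℕ.+ sum ks) l (fillings (suc (a ℕ.+ b)) ks)
      ≈⟨ +-congˡ (interpolate-ħ h (suc (a ℕ.+ b) ℕ.+ sum ks) l (sum-fillings (suc (a ℕ.+ b)) ks)) ⟨
    interpolate h (suc (suc (a ℕ.+ b)) ℕ.+ sum ks) l (fillings (suc (suc (a ℕ.+ b))) ks)
      + interpolate h (suc (suc (a ℕ.+ b)) ℕ.+ sum ks) l (fillings (suc (a ℕ.+ b)) ks)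
      ≡⟨ ≡.cong₂ (λ s k → interpolate h s l (fillings (suc k) ks) + interpolate h s l (fillings k ks)) s≡ (≡.sym (ℕ.+-suc a b)) ⟩
    interpolate h s l (fillings (suc a ℕ.+ suc b) ks) + interpolate h s l (fillings (suc a ℕ.+ suc b ∸ 1) ks) ∎
    where
    h′ : Word¹ → Carrier
    h′ = h ∘ map suc
    ks : Index
    ks = map suc w
    s l : ℕ
    s = suc a ℕ.+ (suc b ℕ.+ sum ks)
    l = suc (length ks)
    s≡ : suc (suc (a ℕ.+ b)) ℕ.+ sum ks ≡ s
    s≡ = ≡.cong suc (≡.trans (≡.cong suc (ℕ.+-assoc a b (sum ks))) (≡.sym (ℕ.+-suc a (b ℕ.+ sum ks))))

-- Specialisation to ℚ[t]⟦q⟧ and ħ = 1 - q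

open Defs

module _ (R : CommutativeRing 0ℓ 0ℓ) where

  open CommutativeRing R using (semiring; commutativeSemiring; *-congˡ; *-congʳ; *-assoc; *-comm; setoid; trans; sym)
                         renaming (_*_ to _·_; _≈_ to _≃_)
  open SemiringExp semiring using (_^_; ^-homo-*; ^-assocʳ)
  open CommutativeSemiringExp commutativeSemiring using (^-distrib-*)
  open SetoidReasoning setoid

  weight-split : ∀ x y m a → x ^ (a ℕ.* m) · y ^ suc a ≃ (x ^ m · y) ^ a · y
  weight-split x y m a = begin
    x ^ (a ℕ.* m) · (y · y ^ a)   ≈⟨ *-congˡ (*-comm y (y ^ a)) ⟩
    x ^ (a ℕ.* m) · (y ^ a · y)   ≈⟨ *-assoc _ _ _ ⟨
    x ^ (a ℕ.* m) · y ^ a · y     ≡⟨ ≡.cong (λ k → x ^ k · y ^ a · y) (ℕ.*-comm a m) ⟩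
    x ^ (m ℕ.* a) · y ^ a · y     ≈⟨ *-congʳ (*-congʳ (^-assocʳ x m a)) ⟨
    (x ^ m) ^ a · y ^ a · y       ≈⟨ *-congʳ (^-distrib-* (x ^ m) y a) ⟨
    (x ^ m · y) ^ a · y           ∎

  -- For k = a + 2 a factor q^m splits off the weight q^((k-1)m) / [m]^k. This is how k₁ ≥ 2 makes
  -- the sum over m converge.
  weight-factor : ∀ x y m a z → x ^ (suc a ℕ.* m) · y ^ suc (suc a) · z ≃ x ^ m · ((x ^ m · y) ^ a · y · y · z)
  weight-factor x y m a z = begin
    x ^ (m ℕ.+ a ℕ.* m) · (y · y ^ suc a) · z             ≈⟨ *-congʳ (*-congʳ (^-homo-* x m (a ℕ.* m))) ⟩
    x ^ m · x ^ (a ℕ.* m) · (y · y ^ suc a) · z           ≈⟨ *-congʳ (trans (*-assoc _ _ _) (*-congˡ (trans (*-congˡ (*-comm _ _)) (sym (*-assoc _ _ _))))) ⟩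
    x ^ m · (x ^ (a ℕ.* m) · y ^ suc a · y) · z           ≈⟨ *-congʳ (*-congˡ (*-congʳ (weight-split x y m a))) ⟩
    x ^ m · ((x ^ m · y) ^ a · y · y) · z                 ≈⟨ *-assoc _ _ _ ⟩
    x ^ m · ((x ^ m · y) ^ a · y · y · z)                 ∎

private
  module ℚP  = PowerSeriesProperties ℚ-ring
  module ℚR  = CommutativeRing ℚP.commutativeRing
  module ℚI  = QIntegers ℚ-ring
  module ℚS  = SeriesInverse ℚ-ring
  module ℚ   = CommutativeRing ℚ-ring
  module P   = PowerSeriesProperties ℚ[t]
  module R   = CommutativeRing P.commutativeRing
  module RE  = SemiringExp R.semiring
  module ℚE  = SemiringExp ℚR.semiring

scalar : ℚ.Carrier → ℚ[t].Carrier
scalar c = (c , 0) ∷ []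

lift : ℚR.Carrier → R.Carrier
lift = scalar ∘_

lift-hom : IsHom ℚP.commutativeRing P.commutativeRing lift
lift-hom = SeriesMap.map-hom ℚ-ring ℚ[t] {scalar} (scalar-hom ℚ-ring)

private
  module lift = IsHom {ℚP.commutativeRing} {P.commutativeRing} lift-hom

lift-q : lift ℚ⟦q⟧.q R.≈ ℚ[t]⟦q⟧.q
lift-q = SeriesMap.map-q ℚ-ring ℚ[t] {scalar} (scalar-hom ℚ-ring)

⟦_⟧ r : ℕ → R.Carrier
⟦ n ⟧ = lift [ n ]q
r n   = lift (ℚ⟦q⟧.inv [ n ]q)

⟦⟧-zero : ⟦ 0 ⟧ R.≈ R.0#
⟦⟧-zero = R.trans {⟦ 0 ⟧} {lift ℚR.0#} {R.0#} (lift.⟦⟧-cong {[ 0 ]q} {ℚR.0#} ℚI.⟦⟧-zero) lift.0#-homo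

⟦⟧-suc : ∀ n → ⟦ suc n ⟧ R.≈ R.1# R.+ ℚ[t]⟦q⟧.q R.* ⟦ n ⟧
⟦⟧-suc n = begin
  lift [ suc n ]q                                 ≈⟨ lift.⟦⟧-cong {[ suc n ]q} {ℚR.1# ℚR.+ ℚ⟦q⟧.q ℚR.* [ n ]q} (ℚI.⟦⟧-suc n) ⟩
  lift (ℚR.1# ℚR.+ ℚ⟦q⟧.q ℚR.* [ n ]q)            ≈⟨ lift.+-homo ℚR.1# (ℚ⟦q⟧.q ℚR.* [ n ]q) ⟩
  lift ℚR.1# R.+ lift (ℚ⟦q⟧.q ℚR.* [ n ]q)        ≈⟨ R.+-cong {lift ℚR.1#} {R.1#} lift.1#-homo (lift.*-homo ℚ⟦q⟧.q [ n ]q) ⟩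
  R.1# R.+ lift ℚ⟦q⟧.q R.* ⟦ n ⟧                  ≈⟨ R.+-congˡ {R.1#} (R.*-congʳ {⟦ n ⟧} {lift ℚ⟦q⟧.q} {ℚ[t]⟦q⟧.q} lift-q) ⟩
  R.1# R.+ ℚ[t]⟦q⟧.q R.* ⟦ n ⟧                    ∎
  where open SetoidReasoning R.setoid

r-inverse : ∀ n → r (suc n) R.* ⟦ suc n ⟧ R.≈ R.1#
r-inverse n = R.trans {r (suc n) R.* ⟦ suc n ⟧} {lift (ℚ⟦q⟧.inv [ suc n ]q ℚR.* [ suc n ]q)} {R.1#}
  (R.sym {lift (ℚ⟦q⟧.inv [ suc n ]q ℚR.* [ suc n ]q)} (lift.*-homo (ℚ⟦q⟧.inv [ suc n ]q) [ suc n ]q))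
  (R.trans {lift (ℚ⟦q⟧.inv [ suc n ]q ℚR.* [ suc n ]q)} {lift ℚR.1#} {R.1#}
    (lift.⟦⟧-cong {ℚ⟦q⟧.inv [ suc n ]q ℚR.* [ suc n ]q} {ℚR.1#} (ℚI.inv-⟦⟧ n)) lift.1#-homo)

numbers : QNumbers (series ℚ[t]) ℚ[t]⟦q⟧.q
numbers = record { ⟦_⟧ = ⟦_⟧ ; r = r ; ⟦⟧-zero = ⟦⟧-zero ; ⟦⟧-suc = ⟦⟧-suc ; r-inverse = r-inverse }

1-q : R.Carrier
1-q = R.1# R.+ R.- ℚ[t]⟦q⟧.q

private
  module Sub = SeriesSubstitution ℚ[t] ℚ[t] {ℚ[t]⟦q⟧.const} P.const-hom 1-q

-- The general substitution for U is reused with ħ as the polynomial variable U and with u = 1 - q.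
κ : ℚ[ħ,t].Carrier → R.Carrier
κ = Sub.θ

κ-hom : IsHom ℚ[ħ,t] P.commutativeRing κ
κ-hom = Sub.θ-hom

κ-ħ : κ ħ R.≈ 1-q
κ-ħ = R.trans {κ ħ} {1-q R.* R.1#} {1-q}
  (Semilinear.eval-basis ℚ[t] P.commutativeRing {ℚ[t]⟦q⟧.const} P.const-hom (1-q RE.^_) 1) (R.*-identityʳ 1-q)

κ-ħ+q : κ ħ R.+ ℚ[t]⟦q⟧.q R.≈ R.1#
κ-ħ+q = begin
  κ ħ R.+ q                       ≈⟨ R.+-congʳ {q} {κ ħ} {1-q} κ-ħ ⟩
  (R.1# R.+ R.- q) R.+ q          ≈⟨ R.+-assoc R.1# (R.- q) q ⟩
  R.1# R.+ (R.- q R.+ q)          ≈⟨ R.+-congˡ {R.1#} {R.- q R.+ q} (R.-‿inverseˡ q) ⟩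
  R.1# R.+ R.0#                   ≈⟨ R.+-identityʳ R.1# ⟩
  R.1#                            ∎
  where
  open SetoidReasoning R.setoid
  open ℚ[t]⟦q⟧ using (q)

private
  module Sums = HoffmanSums ℚ[ħ,t] ħ t P.commutativeRing {κ} κ-hom ℚ[t]⟦q⟧.q numbers κ-ħ+q
  module Kaw = Kawashima ℚ[t] ℚ[ħ,t] ħ t {κ} κ-hom numbers κ-ħ+q
  module Ev = Semilinear ℚ[ħ,t] P.commutativeRing {κ} κ-hom
  module Int = Interpolation ℚ[ħ,t] ħ t P.commutativeRing {κ} κ-hom

z : Word¹ → R.Carrier
z w = lift (ζ (map suc w))

private
  c : ℕ → R.Carrier
  c N = ℚ[t]⟦q⟧.q RE.^ suc N R.* r (suc N)

  cℚ ρℚ : ℕ → ℚR.Carrier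
  ρℚ N = ℚ⟦q⟧.inv [ suc N ]q
  cℚ N = ℚ⟦q⟧.q ℚE.^ suc N ℚR.* ρℚ N

  lift-c^ : ∀ N a → lift (cℚ N ℚE.^ a) R.≈ c N RE.^ a
  lift-c^ N a = R.trans {lift (cℚ N ℚE.^ a)} {lift (cℚ N) RE.^ a} {c N RE.^ a} (lift.^-homo (cℚ N) a)
    (RE.^-congˡ a {lift (cℚ N)} {c N} (R.trans {lift (cℚ N)} {lift (ℚ⟦q⟧.q ℚE.^ suc N) R.* r (suc N)} {c N}
      (lift.*-homo (ℚ⟦q⟧.q ℚE.^ suc N) (ρℚ N))
      (R.*-congʳ {r (suc N)} {lift (ℚ⟦q⟧.q ℚE.^ suc N)} {ℚ[t]⟦q⟧.q RE.^ suc N}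
        (R.trans {lift (ℚ⟦q⟧.q ℚE.^ suc N)} {lift ℚ⟦q⟧.q RE.^ suc N} {ℚ[t]⟦q⟧.q RE.^ suc N}
          (lift.^-homo ℚ⟦q⟧.q (suc N)) (RE.^-congˡ (suc N) {lift ℚ⟦q⟧.q} {ℚ[t]⟦q⟧.q} lift-q)))))

  -- The bounds m₁ < N + 1 and N ≥ m₁ agree, and `weight-split` brings the summands of ζ_q to the
  -- weights of `∗₊-sums`.
  lift-ζ< : ∀ w N → lift (ζ< (suc N) (map suc w)) R.≈ Sums.∗₊-sums.Q N w
  lift-ζ< []      zero    = lift.1#-homo
  lift-ζ< []      (suc N) = lift.1#-homo
  lift-ζ< (a ∷ w) N = R.trans {lift (ζ< (suc N) (map suc (a ∷ w)))} {lift (∑ℚ N summand)} {Sums.∗₊-sums.Q N (a ∷ w)}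
    (lift.⟦⟧-cong {ζ< (suc N) (map suc (a ∷ w))} {∑ℚ N summand} (sum≈∑< ℚP.commutativeRing N summand)) (go N)
    where
    ∑ℚ : ℕ → (ℕ → ℚR.Carrier) → ℚR.Carrier
    ∑ℚ = PartialSums.∑< ℚP.commutativeRing
    summand : ℕ → ℚR.Carrier
    summand N = ℚ⟦q⟧.q ℚE.^ (a ℕ.* suc N) ℚR.* ρℚ N ℚE.^ suc a ℚR.* ζ< (suc N) (map suc w)
    lift-summand : ∀ N → lift (summand N) R.≈ c N RE.^ a R.* r (suc N) R.* Sums.∗₊-sums.Q N w
    lift-summand N = begin
      lift (summand N)
        ≈⟨ lift.⟦⟧-cong {summand N} {cℚ N ℚE.^ a ℚR.* ρℚ N ℚR.* ζ< (suc N) (map suc w)}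
             (ℚR.*-congʳ {ζ< (suc N) (map suc w)} {ℚ⟦q⟧.q ℚE.^ (a ℕ.* suc N) ℚR.* ρℚ N ℚE.^ suc a} {cℚ N ℚE.^ a ℚR.* ρℚ N}
               (weight-split ℚP.commutativeRing ℚ⟦q⟧.q (ρℚ N) (suc N) a)) ⟩
      lift (cℚ N ℚE.^ a ℚR.* ρℚ N ℚR.* ζ< (suc N) (map suc w))
        ≈⟨ lift.*-homo (cℚ N ℚE.^ a ℚR.* ρℚ N) (ζ< (suc N) (map suc w)) ⟩
      lift (cℚ N ℚE.^ a ℚR.* ρℚ N) R.* lift (ζ< (suc N) (map suc w))
        ≈⟨ R.*-cong {lift (cℚ N ℚE.^ a ℚR.* ρℚ N)} {c N RE.^ a R.* r (suc N)} {lift (ζ< (suc N) (map suc w))} {Sums.∗₊-sums.Q N w}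
             (R.trans {lift (cℚ N ℚE.^ a ℚR.* ρℚ N)} {lift (cℚ N ℚE.^ a) R.* r (suc N)} {c N RE.^ a R.* r (suc N)}
               (lift.*-homo (cℚ N ℚE.^ a) (ρℚ N)) (R.*-congʳ {r (suc N)} {lift (cℚ N ℚE.^ a)} {c N RE.^ a} (lift-c^ N a)))
             (lift-ζ< w N) ⟩
      c N RE.^ a R.* r (suc N) R.* Sums.∗₊-sums.Q N w ∎
      where open SetoidReasoning R.setoid
    go : ∀ N → lift (∑ℚ N summand) R.≈ Sums.∗₊-sums.Q N (a ∷ w)
    go zero    = lift.0#-homo
    go (suc N) = R.trans {lift (∑ℚ N summand ℚR.+ summand N)} {lift (∑ℚ N summand) R.+ lift (summand N)} {Sums.∗₊-sums.Q (suc N) (a ∷ w)}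
      (lift.+-homo (∑ℚ N summand) (summand N))
      (R.+-cong {lift (∑ℚ N summand)} {Sums.∗₊-sums.Q N (a ∷ w)} (go N) (lift-summand N))

  -- The terms of ζ_q(a + 2, …), divided by q^m.
  terms : ℕ → Index → ℕ → ℚR.Carrier
  terms a ks zero    = ℚR.0#
  terms a ks (suc N) = cℚ N ℚE.^ a ℚR.* ρℚ N ℚR.* ρℚ N ℚR.* ζ< (suc N) ks

  -- The coefficient of qⁿ involves m = 1, ..., n on both sides: on the left by the truncation in
  -- `ζ`, on the right because q^m shifts exponents. The term m = 0 of `Σq` is set to zero.
  ζ-Σq : ∀ a ks → ζ (suc (suc a) ∷ ks) ℚR.≈ ℚP.Σq (terms a ks)
  ζ-Σq a ks n = ℚ.trans (InnerCoefficients.sum-at ℚ-ring n (λ i → summand (toℕ i)) n)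
    (ℚ.trans (SemiringSum.sum-cong-≋ ℚ.semiring {n} (λ i → ℚ.trans (weight-factor ℚP.commutativeRing ℚ⟦q⟧.q (ρℚ (toℕ i)) (suc (toℕ i)) a (ζ< (suc (toℕ i)) ks) n)
      (ℚS.q^-shift (suc (toℕ i)) (terms a ks (suc (toℕ i))) (Fin.toℕ<n i))))
    (ℚ.sym (ℚ.+-identityˡ _)))
    where
    summand : ℕ → ℚR.Carrier
    summand N = ℚ⟦q⟧.q ℚE.^ (suc a ℕ.* suc N) ℚR.* ρℚ N ℚE.^ suc (suc a) ℚR.* ζ< (suc N) ks

  z-admissible : ∀ a w → z (suc a ∷ w) R.≈ P.Σq (Kaw.admissible a w)
  z-admissible a w = begin
    lift (ζ (suc (suc a) ∷ map suc w))     ≈⟨ lift.⟦⟧-cong {ζ (suc (suc a) ∷ map suc w)} {ℚP.Σq s} (ζ-Σq a (map suc w)) ⟩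
    lift (ℚP.Σq s)                         ≈⟨ SeriesMap.map-Σq ℚ-ring ℚ[t] {scalar} (scalar-hom ℚ-ring) s ⟩
    P.Σq (λ m → lift (s m))                ≈⟨ P.Σq-cong {λ m → lift (s m)} {Kaw.admissible a w} lift-term ⟩
    P.Σq (Kaw.admissible a w)              ∎
    where
    open SetoidReasoning R.setoid
    s : ℕ → ℚR.Carrier
    s = terms a (map suc w)
    lift-term : ∀ m → lift (s m) R.≈ Kaw.admissible a w m
    lift-term zero    = lift.0#-homo
    lift-term (suc N) = begin
      lift (C ℚR.* ρℚ N ℚR.* ρℚ N ℚR.* Z<)
        ≈⟨ lift.*-homo (C ℚR.* ρℚ N ℚR.* ρℚ N) Z< ⟩
      lift (C ℚR.* ρℚ N ℚR.* ρℚ N) R.* lift Z<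
        ≈⟨ R.*-cong {lift (C ℚR.* ρℚ N ℚR.* ρℚ N)} {lift C R.* r (suc N) R.* r (suc N)} {lift Z<} {Sums.∗₊-sums.Q N w}
             (R.trans {lift (C ℚR.* ρℚ N ℚR.* ρℚ N)} {lift (C ℚR.* ρℚ N) R.* r (suc N)} {lift C R.* r (suc N) R.* r (suc N)}
               (lift.*-homo (C ℚR.* ρℚ N) (ρℚ N))
               (R.*-congʳ {r (suc N)} {lift (C ℚR.* ρℚ N)} {lift C R.* r (suc N)} (lift.*-homo C (ρℚ N))))
             (lift-ζ< w N) ⟩
      lift C R.* r (suc N) R.* r (suc N) R.* Sums.∗₊-sums.Q N w
        ≈⟨ R.*-congʳ {Sums.∗₊-sums.Q N w} {lift C R.* r (suc N) R.* r (suc N)} {c N RE.^ a R.* r (suc N) R.* r (suc N)}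
             (R.*-congʳ {r (suc N)} {lift C R.* r (suc N)} {c N RE.^ a R.* r (suc N)}
               (R.*-congʳ {r (suc N)} {lift C} {c N RE.^ a} (lift-c^ N a))) ⟩
      c N RE.^ a R.* r (suc N) R.* r (suc N) R.* Sums.∗₊-sums.Q N w ∎
      where
      C Z< : ℚR.Carrier
      C  = cℚ N ℚE.^ a
      Z< = ζ< (suc N) (map suc w)

  subst-ħ≡κ : ∀ p → subst-ħ p ≡ κ p
  subst-ħ≡κ []            = ≡.refl
  subst-ħ≡κ ((a , n) ∷ p) = ≡.cong (λ s → ℚ[t]⟦q⟧.const a R.* 1-q RE.^ n R.+ s) (subst-ħ≡κ p)

  -- The diagonal sum in `f` is `Σq` after substitution in each coefficient, so `f` inherits that
  -- `subst` is a ring homomorphism.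
  f≈subst : ∀ F → f F R.≈ Sub.subst F
  f≈subst F n = SemiringSum.sum-cong-≋ ℚ[t].semiring {suc n}
    (λ i → ℚ[t].reflexive (≡.cong (λ s → s (n ∸ toℕ i)) (subst-ħ≡κ (F (toℕ i)))))

  -- An element of ℚ⟦q⟧[t] as an element of ℚ[t]⟦q⟧.
  poly : List (ℚR.Carrier × ℕ) → R.Carrier
  poly L n = map (map₁ (λ a → a n)) L

  subst-embed : ∀ L → Sub.subst (embed L) R.≈ poly L
  subst-embed L = R.trans {Sub.subst (embed L)} {P.Σq (ℚ[t]⟦q⟧.const ∘ poly L)} {poly L}
    (Sub.subst-scalar (poly L)) (Σq-const∘ ℚ[t] (poly L))

  zᵗ : Word¹ → R.Carrier
  zᵗ w = Sub.subst (embed (ζᵗ (map suc w)))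

  subst-Ẑ : ∀ p → Sub.subst (Ẑ p) R.≈ Ev.eval zᵗ p
  subst-Ẑ []            = Sub.subst.0#-homo
  subst-Ẑ ((k , w) ∷ p) = begin
    Sub.subst (ℚ[ħ,t]⟦q⟧.const k ℚ[ħ,t]⟦q⟧.* e ℚ[ħ,t]⟦q⟧.+ Ẑ p)
      ≈⟨ Sub.subst.+-homo (ℚ[ħ,t]⟦q⟧.const k ℚ[ħ,t]⟦q⟧.* e) (Ẑ p) ⟩
    Sub.subst (ℚ[ħ,t]⟦q⟧.const k ℚ[ħ,t]⟦q⟧.* e) R.+ Sub.subst (Ẑ p)
      ≈⟨ R.+-cong {Sub.subst (ℚ[ħ,t]⟦q⟧.const k ℚ[ħ,t]⟦q⟧.* e)} {κ k R.* zᵗ w} {Sub.subst (Ẑ p)} {Ev.eval zᵗ p}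
           (R.trans {Sub.subst (ℚ[ħ,t]⟦q⟧.const k ℚ[ħ,t]⟦q⟧.* e)} {Sub.subst (ℚ[ħ,t]⟦q⟧.const k) R.* zᵗ w} {κ k R.* zᵗ w}
             (Sub.subst.*-homo (ℚ[ħ,t]⟦q⟧.const k) e)
             (R.*-congʳ {zᵗ w} {Sub.subst (ℚ[ħ,t]⟦q⟧.const k)} {κ k} (Sub.subst-const k)))
           (subst-Ẑ p) ⟩
    κ k R.* zᵗ w R.+ Ev.eval zᵗ p ∎
    where
    open SetoidReasoning R.setoid
    e : ℚ[ħ,t]⟦q⟧.Carrier
    e = embed (ζᵗ (map suc w))

  open FreeModule ℚ-ring using (basis)
  private
    module FE = FreeModule.Equality ℚ-ring ℕ._≟_
    module tE = SemiringExp ℚ[t].semiring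

  basis-^ : ∀ e → basis 1 tE.^ e ℚ[t].≈ basis e
  basis-^ zero    = ℚ[t].refl
  basis-^ (suc e) = ℚ[t].trans (ℚ[t].*-congˡ {basis 1} (basis-^ e))
    (MonoidAlgebra.basis-⋆ ℚ-ring ℕ._≟_ ℕ.+-0-isMonoid 1 e)

  κ-t : κ t R.≈ ℚ[t]⟦q⟧.const (basis 1)
  κ-t = R.trans {κ t} {ℚ[t]⟦q⟧.const (basis 1) R.* R.1#} (R.+-identityʳ (ℚ[t]⟦q⟧.const (basis 1) R.* R.1#)) (R.*-identityʳ (ℚ[t]⟦q⟧.const (basis 1)))

  κ-t^ : ∀ e → κ t RE.^ e R.≈ ℚ[t]⟦q⟧.const (basis e)
  κ-t^ e = begin
    κ t RE.^ e                           ≈⟨ RE.^-congˡ e {κ t} {ℚ[t]⟦q⟧.const (basis 1)} κ-t ⟩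
    ℚ[t]⟦q⟧.const (basis 1) RE.^ e       ≈⟨ const.^-homo (basis 1) e ⟨
    ℚ[t]⟦q⟧.const (basis 1 tE.^ e)       ≈⟨ const.⟦⟧-cong {basis 1 tE.^ e} {basis e} (basis-^ e) ⟩
    ℚ[t]⟦q⟧.const (basis e)              ∎
    where
    open SetoidReasoning R.setoid
    module const = IsHom {ℚ[t]} {P.commutativeRing} P.const-hom

  poly-∷ : ∀ a e L → poly ((a , e) ∷ L) R.≈ lift a R.* κ t RE.^ e R.+ poly L
  poly-∷ a e L n = ℚ[t].+-congʳ {poly L n} {(a n , e) ∷ []} (ℚ[t].sym (begin
    (lift a R.* κ t RE.^ e) n                       ≈⟨ R.*-congˡ {lift a} (κ-t^ e) n ⟩
    (lift a R.* ℚ[t]⟦q⟧.const (basis e)) n          ≈⟨ R.*-comm (lift a) (ℚ[t]⟦q⟧.const (basis e)) n ⟩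
    (ℚ[t]⟦q⟧.const (basis e) R.* lift a) n          ≈⟨ P.const-⊗ (basis e) (lift a) n ⟩
    basis e ℚ[t].* scalar (a n)                     ≈⟨ FE.mk≋ (λ x → ℚ.+-congʳ (ℚ.*-cong (ℚ.*-identityˡ (a n)) (ℚ.reflexive (≡.cong (FE.δ x) (ℕ.+-identityʳ e))))) ⟩
    (a n , e) ∷ []                                  ∎))
    where open SetoidReasoning ℚ[t].setoid

  lift-1-q : lift (ℚR.1# ℚR.+ ℚR.- ℚ⟦q⟧.q) R.≈ 1-q
  lift-1-q = R.trans {lift (ℚR.1# ℚR.+ ℚR.- ℚ⟦q⟧.q)} {lift ℚR.1# R.+ lift (ℚR.- ℚ⟦q⟧.q)} {1-q}
    (lift.+-homo ℚR.1# (ℚR.- ℚ⟦q⟧.q))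
    (R.+-cong {lift ℚR.1#} {R.1#} {lift (ℚR.- ℚ⟦q⟧.q)} {R.- ℚ[t]⟦q⟧.q} lift.1#-homo
      (R.trans {lift (ℚR.- ℚ⟦q⟧.q)} {R.- lift ℚ⟦q⟧.q} {R.- ℚ[t]⟦q⟧.q} (lift.-‿homo ℚ⟦q⟧.q) (R.-‿cong {lift ℚ⟦q⟧.q} {ℚ[t]⟦q⟧.q} lift-q)))

  poly-interpolate : ∀ s l L → poly (map (λ p → ((ℚR.1# ℚR.+ ℚR.- ℚ⟦q⟧.q) ℚE.^ (s ∸ sum p) ℚR.* ζ p , l ∸ length p)) L)
                   R.≈ Int.interpolate (lift ∘ ζ) s l L
  poly-interpolate s l []      = λ n → ℚ[t].refl
  poly-interpolate s l (p ∷ L) = begin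
    poly ((a , e) ∷ L′)
      ≈⟨ poly-∷ a e L′ ⟩
    lift a R.* κ t RE.^ e R.+ poly L′
      ≈⟨ R.+-cong {lift a R.* κ t RE.^ e} {κ ħ RE.^ k R.* lift (ζ p) R.* κ t RE.^ e} {poly L′} {Int.interpolate (lift ∘ ζ) s l L}
           (R.*-congʳ {κ t RE.^ e} {lift a} {κ ħ RE.^ k R.* lift (ζ p)} lift-a) (poly-interpolate s l L) ⟩
    κ ħ RE.^ k R.* lift (ζ p) R.* κ t RE.^ e R.+ Int.interpolate (lift ∘ ζ) s l L ∎
    where
    open SetoidReasoning R.setoid
    k e : ℕ
    k = s ∸ sum p
    e = l ∸ length p
    a 1-qℚ : ℚR.Carrier
    1-qℚ = ℚR.1# ℚR.+ ℚR.- ℚ⟦q⟧.q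
    a = 1-qℚ ℚE.^ k ℚR.* ζ p
    L′ : List (ℚR.Carrier × ℕ)
    L′ = map (λ p → (1-qℚ ℚE.^ (s ∸ sum p) ℚR.* ζ p , l ∸ length p)) L
    lift-a : lift a R.≈ κ ħ RE.^ k R.* lift (ζ p)
    lift-a = begin
      lift a                                 ≈⟨ lift.*-homo (1-qℚ ℚE.^ k) (ζ p) ⟩
      lift (1-qℚ ℚE.^ k) R.* lift (ζ p)      ≈⟨ R.*-congʳ {lift (ζ p)} {lift (1-qℚ ℚE.^ k)} {lift 1-qℚ RE.^ k} (lift.^-homo 1-qℚ k) ⟩
      lift 1-qℚ RE.^ k R.* lift (ζ p)        ≈⟨ R.*-congʳ {lift (ζ p)} {lift 1-qℚ RE.^ k} {1-q RE.^ k} (RE.^-congˡ k {lift 1-qℚ} {1-q} lift-1-q) ⟩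
      1-q RE.^ k R.* lift (ζ p)              ≈⟨ R.*-congʳ {lift (ζ p)} {1-q RE.^ k} {κ ħ RE.^ k} (RE.^-congˡ k {1-q} {κ ħ} (R.sym {κ ħ} {1-q} κ-ħ)) ⟩
      κ ħ RE.^ k R.* lift (ζ p)              ∎

  -- This is `eval-Sʷ` for h = ζ_q, once 1 - q is recognised as κ ħ and the powers of t as those of
  -- κ t.
  zᵗ≈ : ∀ w → zᵗ w R.≈ Ev.eval z (Sʷ t w)
  zᵗ≈ [] = begin
    Sub.subst (embed ((ℚR.1# , 0) ∷ []))      ≈⟨ subst-embed ((ℚR.1# , 0) ∷ []) ⟩
    lift ℚR.1#                                ≈⟨ (λ n → ℚ[t].refl) ⟩
    z []                                      ≈⟨ Ev.eval-basis z [] ⟨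
    Ev.eval z (Sʷ t [])                       ∎
    where open SetoidReasoning R.setoid
  zᵗ≈ (a ∷ w) = begin
    Sub.subst (embed (ζᵗ (suc a ∷ map suc w)))      ≈⟨ subst-embed (ζᵗ (suc a ∷ map suc w)) ⟩
    poly (ζᵗ (suc a ∷ map suc w))                   ≈⟨ poly-interpolate s l L ⟩
    Int.interpolate (lift ∘ ζ) s l L                ≈⟨ Int.eval-Sʷ w a (lift ∘ ζ) ⟨
    Ev.eval z (Sʷ t (a ∷ w))                        ∎
    where
    open SetoidReasoning R.setoid
    s l : ℕ
    s = sum (suc a ∷ map suc w)
    l = length (suc a ∷ map suc w)
    L : List Index
    L = fillings (suc a) (map suc w)

  Z≈ : ∀ p → Z p R.≈ Ev.eval z (S p)
  Z≈ p = begin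
    f (Ẑ p)                                      ≈⟨ f≈subst (Ẑ p) ⟩
    Sub.subst (Ẑ p)                              ≈⟨ subst-Ẑ p ⟩
    Ev.eval zᵗ p                                 ≈⟨ Ev.eval-cong {f = zᵗ} {g = λ w → Ev.eval z (Sʷ t w)} zᵗ≈ p ⟩
    Ev.eval (λ w → Ev.eval z (Sʷ t w)) p         ≈⟨ Ev.eval-extend z (Sʷ t) p ⟨
    Ev.eval z (S p)           ∎
    where open SetoidReasoning R.setoid

theorem1p2 : ∀ (m : ℕ) → m ≥ 1 → (v w : 𝔥¹) → ι v ∈𝔥y → ι w ∈𝔥y →
    ∑[i+j= m ] (λ i j → Z (φᵗ v ⊛ᵗ b[ i ∸ 1 ]) * Z (φᵗ w ⊛ᵗ b[ j ∸ 1 ]))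
    ≈ - Z (φᵗ (S⁻¹ (S v ∗ S w)) ⊛ᵗ b[ m ∸ 1 ])
theorem1p2 m m≥1 v w v∈ w∈ = begin
  ∑[i+j= m ] (λ i j → Z (left i) * Z (right j))
    ≈⟨ SemiringSum.sum-cong-≋ R.semiring {m ∸ 1} {λ i → Z (left (suc (toℕ i))) * Z (right (m ∸ suc (toℕ i)))}
         (λ i → R.*-cong {Z (left (suc (toℕ i)))} (Z≈ (left (suc (toℕ i)))) (Z≈ (right (m ∸ suc (toℕ i))))) ⟩
  ∑[i+j= m ] (λ i j → Ev.eval z (S (left i)) * Ev.eval z (S (right j)))
    ≈⟨ Kaw.kawashima z z-admissible m m≥1 v w v∈ w∈ ⟩
  - Ev.eval z (S product)
    ≈⟨ R.-‿cong {Z product} (Z≈ product) ⟨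
  - Z product ∎
  where
  open SetoidReasoning R.setoid
  left right : ℕ → 𝔥¹
  left i  = φᵗ v ⊛ᵗ b[ i ∸ 1 ]
  right j = φᵗ w ⊛ᵗ b[ j ∸ 1 ]
  product : 𝔥¹
  product = φᵗ (S⁻¹ (S v ∗ S w)) ⊛ᵗ b[ m ∸ 1 ]
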